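{- Let $G=(V,E)$ be a finite simple connected graph. Then $\beth^{3}(K^{h(G)})\le \beth^{3}(G)$; that is, $$\binom{h(G)}{4}-\binom{h(G)}{3}+\binom{h(G)}{2}-\binom{h(G)}{1}\le \beth^{3}(G).$$
   Context: All graphs are finite and simple. $K^{t}$ is the complete graph on $t$ vertices. The Hadwiger number $h(G)$ is the maximum $t$ such that $K^{t}$ is a minor of $G$. $C(G)$ is the set of all induced cycles in $G$ (of length at least 3). Solid graphs are the graphs of the following four kinds. (1) Pyramid: a graph consisting of a cycle $C$ and a vertex $w\notin V(C)$ together with at least three edges between $w$ and $C$. (2) Trihedron: the union of three paths $P_1,P_2,P_3$, each of length at least 2, having the same two (distinct) endpoints, such that no interior vertex of any of the paths is used in another of the paths. (3) Stamp: the union of a triangle $T$ and three paths $P_1,P_2,P_3$ of length $\ge 1$ that start at the three different vertices of $T$ and all end at the same vertex $x\notin V(T)$, such that the $P_i-x$ are pairwise vertex-disjoint and each $P_i$ meets $T$ only in its starting vertex. (4) Prism: $T\cup T'\cup P_1\cup P_2\cup P_3$ where $T,T'$ are vertex-disjoint triangles with vertices $x_1,x_2,x_3$ and $y_1,y_2,y_3$ respectively, and the $P_i$ are pairwise vertex-disjoint paths from $x_i$ to $y_i$ (so $P_i$ meets $T\cup T'$ only in $x_i,y_i$). A solid in $G$ is an induced subgraph of $G$ that is isomorphic to a solid graph; $S(G)$ is the set of all solids in $G$. The third graph characteristic is $\beth^{3}(G)=|S(G)|-|C(G)|+|E(G)|-|V(G)|$. -}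

module Defs where

open import Level using (0ℓ)
open import Data.Bool using (true; false)
open import Data.Empty using (⊥-elim)
open import Data.Fin using (Fin; zero; suc)
open import Data.Fin.Properties using (_≟_; _<?_; suc-injective; any?; all?; injective⇒≤)
open import Data.Fin.Subset using (Subset; inside; outside; _∈_; ∣_∣)
open import Data.Fin.Subset.Properties using (_∈?_; anySubset?)
open import Data.Integer using (ℤ)
open import Data.List using (List; []; _∷_; [_]; _++_; _∷ʳ_; length; map; zip; drop; filter; head; last; lookup; allFin; cartesianProduct)
open import Data.List.Membership.Propositional using () renaming (_∈_ to _∈ₗ_)
open import Data.List.Membership.Propositional.Properties using (∈-lookup)
open import Data.List.Properties using (length-++-≤ˡ; length-++-≤ʳ)
open import Data.List.Relation.Unary.All as All using (All; []; _∷_)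
open import Data.List.Relation.Unary.All.Properties using (¬Any⇒All¬)
open import Data.List.Relation.Unary.AllPairs using ([]; _∷_)
open import Data.List.Relation.Unary.Any using (here; there)
open import Data.List.Relation.Unary.Linked using (Linked; []; [-]; _∷_; linked?)
open import Data.List.Relation.Unary.Unique.Propositional using (Unique)
import Data.List.Membership.DecPropositional as DecMembership
import Data.List.Relation.Unary.Unique.DecPropositional as DecUnique
open import Data.Maybe using (just)
open import Data.Maybe.Properties using () renaming (≡-dec to Maybe-≡-dec)
open import Data.Nat using (ℕ; zero; suc; _≤_; _≤?_; z≤n; s≤s)
open import Data.Nat.Properties using (≤-trans; ≤-pred; ≤∧≢⇒<)
open import Data.Product using (∃; ∃-syntax; _×_; _,_; proj₁; proj₂)
open import Data.Product.Properties using () renaming (≡-dec to ×-≡-dec)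
open import Data.Sum using (_⊎_; inj₁; inj₂)
open import Data.Vec as Vec using (Vec; []; _∷_)
open import Function using (_∘_)
open import Function.Bundles using (_⇔_; mk⇔; Equivalence)
open import Relation.Binary using (Rel; Symmetric; Irreflexive; Decidable)
open import Relation.Binary.Construct.Closure.ReflexiveTransitive using (Star; ε; _◅_)
open import Relation.Binary.PropositionalEquality using (_≡_; _≢_; refl; sym; cong; subst)
open import Relation.Nullary using (Dec; yes; no)
open import Relation.Nullary.Decidable using (map′; _×-dec_; _⊎-dec_; _→-dec_; ¬?)
open import Relation.Unary using (Pred) renaming (Decidable to Decidable₁)

------------------------------------------------------------------------
-- Finite simple graphs

record Graph : Set₁ where
  field
    order  : ℕ
  V : Set
  V = Fin order
  field
    Adj    : Rel V 0ℓ
    adj?   : Decidable Adj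
    symm   : Symmetric Adj
    irrefl : Irreflexive _≡_ Adj

open Graph

K : ℕ → Graph
K t = record
  { order  = t
  ; Adj    = _≢_
  ; adj?   = λ u v → ¬? (u ≟ v)
  ; symm   = λ u≢v → u≢v ∘ sym
  ; irrefl = λ u≡v u≢v → u≢v u≡v
  }

-- The increasing enumeration of the elements of a subset.
embed : ∀ {n} (S : Subset n) → Fin ∣ S ∣ → Fin n
embed (true  ∷ S) zero    = zero
embed (true  ∷ S) (suc i) = suc (embed S i)
embed (false ∷ S) i       = suc (embed S i)

embed-injective : ∀ {n} (S : Subset n) {i j} → embed S i ≡ embed S j → i ≡ j
embed-injective (true  ∷ S) {zero}  {zero}  _  = refl
embed-injective (true  ∷ S) {suc i} {suc j} eq =
  cong suc (embed-injective S (suc-injective eq))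
embed-injective (false ∷ S) eq = embed-injective S (suc-injective eq)

_⟨_⟩ : (G : Graph) → Subset (order G) → Graph
G ⟨ S ⟩ = record
  { order  = ∣ S ∣
  ; Adj    = λ i j → Adj G (embed S i) (embed S j)
  ; adj?   = λ i j → adj? G (embed S i) (embed S j)
  ; symm   = symm G
  ; irrefl = λ i≡j → irrefl G (cong (embed S) i≡j)
  }

-- A connected graph is non-empty.
Connected : Graph → Set
Connected G = V G × (∀ u v → Star (Adj G) u v)

------------------------------------------------------------------------
-- Minors and the Hadwiger number

IsModel : (H G : Graph) → Vec (Subset (order G)) (order H) → Set
IsModel H G B =
    (∀ i → Connected (G ⟨ Vec.lookup B i ⟩))
  × (∀ i j v → v ∈ Vec.lookup B i → v ∈ Vec.lookup B j → i ≡ j)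
  × (∀ i j → Adj H i j →
       ∃[ u ] ∃[ v ] (u ∈ Vec.lookup B i × v ∈ Vec.lookup B j × Adj G u v))

-- H is a minor of G: some family of pairwise disjoint connected branch sets
-- in G, indexed by the vertices of H, contracts onto a supergraph of H.
infix 4 _≼_
_≼_ : Graph → Graph → Set
H ≼ G = ∃[ B ] IsModel H G B

IsHadwigerNumber : Graph → ℕ → Set
IsHadwigerNumber G h = K h ≼ G × (∀ t → K t ≼ G → t ≤ h)

------------------------------------------------------------------------
-- Cycles and solid graphs

module _ {A : Set} where

  -- Edges of the path, respectively of the cycle, visiting the given
  -- vertices in the given order.
  path cycle : List A → List (A × A)
  path xs = zip xs (drop 1 xs)
  cycle []       = []
  cycle (x ∷ xs) = path (x ∷ xs ∷ʳ x)

-- H has exactly the vertices vs, which are pairwise distinct, and exactly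
-- the (undirected) edges es.
IsGraphOn : (H : Graph) → List (V H) → List (V H × V H) → Set
IsGraphOn H vs es =
    Unique vs
  × (∀ v → v ∈ₗ vs)
  × (∀ u v → Adj H u v ⇔ ((u , v) ∈ₗ es ⊎ (v , u) ∈ₗ es))

-- The predicates below are invariant under isomorphism: they say that H is
-- isomorphic to a graph of the named kind.

IsCycle : Graph → Set
IsCycle H = ∃[ c ] (3 ≤ length c × IsGraphOn H c (cycle c))

-- ns lists the neighbours of w on the cycle c.
IsPyramid : Graph → Set
IsPyramid H = ∃[ w ] ∃[ c ] ∃[ ns ]
  ( 3 ≤ length c
  × Unique ns × All (_∈ₗ c) ns × 3 ≤ length ns
  × IsGraphOn H (w ∷ c) (cycle c ++ map (w ,_) ns))

-- In the next three definitions p₁, p₂, p₃ list the interior vertices of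
-- P₁, P₂, P₃, so that Pᵢ has length 1 + length pᵢ.

IsTrihedron : Graph → Set
IsTrihedron H = ∃[ a ] ∃[ b ] ∃[ p₁ ] ∃[ p₂ ] ∃[ p₃ ]
  ( 1 ≤ length p₁ × 1 ≤ length p₂ × 1 ≤ length p₃
  × IsGraphOn H (a ∷ b ∷ p₁ ++ p₂ ++ p₃)
      (path (a ∷ p₁ ∷ʳ b) ++ path (a ∷ p₂ ∷ʳ b) ++ path (a ∷ p₃ ∷ʳ b)))

IsStamp : Graph → Set
IsStamp H = ∃[ x ] ∃[ t₁ ] ∃[ t₂ ] ∃[ t₃ ] ∃[ p₁ ] ∃[ p₂ ] ∃[ p₃ ]
  IsGraphOn H (x ∷ t₁ ∷ t₂ ∷ t₃ ∷ p₁ ++ p₂ ++ p₃)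
    (cycle (t₁ ∷ t₂ ∷ t₃ ∷ []) ++
     path (t₁ ∷ p₁ ∷ʳ x) ++ path (t₂ ∷ p₂ ∷ʳ x) ++ path (t₃ ∷ p₃ ∷ʳ x))

IsPrism : Graph → Set
IsPrism H =
  ∃[ x₁ ] ∃[ x₂ ] ∃[ x₃ ] ∃[ y₁ ] ∃[ y₂ ] ∃[ y₃ ] ∃[ p₁ ] ∃[ p₂ ] ∃[ p₃ ]
  IsGraphOn H (x₁ ∷ x₂ ∷ x₃ ∷ y₁ ∷ y₂ ∷ y₃ ∷ p₁ ++ p₂ ++ p₃)
    (cycle (x₁ ∷ x₂ ∷ x₃ ∷ []) ++ cycle (y₁ ∷ y₂ ∷ y₃ ∷ []) ++
     path (x₁ ∷ p₁ ∷ʳ y₁) ++ path (x₂ ∷ p₂ ∷ʳ y₂) ++ path (x₃ ∷ p₃ ∷ʳ y₃))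

IsSolid : Graph → Set
IsSolid H = IsPyramid H ⊎ IsTrihedron H ⊎ IsStamp H ⊎ IsPrism H

------------------------------------------------------------------------
-- Decidability

private

  Unique⇒lookup-injective : ∀ {A : Set} {xs : List A} → Unique xs →
    ∀ {i j} → lookup xs i ≡ lookup xs j → i ≡ j
  Unique⇒lookup-injective (_ ∷ _) {zero} {zero} _ = refl
  Unique⇒lookup-injective {xs = _ ∷ xs} (x∉ ∷ _) {zero} {suc j} eq =
    ⊥-elim (All.lookup x∉ (∈-lookup {xs = xs} j) eq)
  Unique⇒lookup-injective {xs = _ ∷ xs} (x∉ ∷ _) {suc i} {zero} eq =
    ⊥-elim (All.lookup x∉ (∈-lookup {xs = xs} i) (sym eq))
  Unique⇒lookup-injective (_ ∷ u) {suc i} {suc j} eq =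
    cong suc (Unique⇒lookup-injective u eq)

Unique⇒length≤ : ∀ {n} {xs : List (Fin n)} → Unique xs → length xs ≤ n
Unique⇒length≤ u = injective⇒≤ (Unique⇒lookup-injective u)

anyBoundedList? : ∀ {n} {P : Pred (List (Fin n)) 0ℓ} → Decidable₁ P →
                  ∀ m → Dec (∃[ xs ] (length xs ≤ m × P xs))
anyBoundedList? P? zero =
  map′ (λ p → [] , z≤n , p) (λ { ([] , _ , p) → p }) (P? [])
anyBoundedList? P? (suc m) =
  map′ (λ { (inj₁ p)                 → [] , z≤n , p
          ; (inj₂ (x , xs , le , p)) → x ∷ xs , s≤s le , p })
       (λ { ([]     , _      , p) → inj₁ p
          ; (x ∷ xs , s≤s le , p) → inj₂ (x , xs , le , p) })
       (P? [] ⊎-dec any? (λ x → anyBoundedList? (P? ∘ (x ∷_)) m))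

anyList? : ∀ {n} {P : Pred (List (Fin n)) 0ℓ} → Decidable₁ P →
           (∀ xs → P xs → length xs ≤ n) → Dec (∃[ xs ] P xs)
anyList? {n} P? bound =
  map′ (λ { (xs , _ , p) → xs , p }) (λ { (xs , p) → xs , bound xs p , p })
       (anyBoundedList? P? n)

anyVec? : ∀ {n t} {P : Pred (Vec (Subset n) t) 0ℓ} → Decidable₁ P → Dec (∃[ B ] P B)
anyVec? {t = zero}  P? = map′ (λ p → [] , p) (λ { ([] , p) → p }) (P? [])
anyVec? {t = suc t} P? =
  map′ (λ { (S , B , p) → S ∷ B , p }) (λ { (S ∷ B , p) → S , B , p })
       (anySubset? (λ S → anyVec? (λ B → P? (S ∷ B))))

_⇔-dec_ : ∀ {A B : Set} → Dec A → Dec B → Dec (A ⇔ B)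
a? ⇔-dec b? = map′ (λ { (f , g) → mk⇔ f g })
                   (λ e → Equivalence.to e , Equivalence.from e)
                   ((a? →-dec b?) ×-dec (b? →-dec a?))

module _ (H : Graph) where

  private
    module M₁ = DecMembership (_≟_ {order H})
    module M₂ = DecMembership (×-≡-dec (_≟_ {order H}) (_≟_ {order H}))
    module U  = DecUnique (_≟_ {order H})

    IsPath : V H → V H → List (V H) → Set
    IsPath u v xs =
      Unique xs × Linked (Adj H) xs × head xs ≡ just u × last xs ≡ just v

    path⇒star : ∀ {u v} xs → IsPath u v xs → Star (Adj H) u v
    path⇒star (x ∷ []) (_ , _ , refl , refl) = ε
    path⇒star (x ∷ y ∷ xs) (_ ∷ u , a ∷ l , refl , eq) =
      a ◅ path⇒star (y ∷ xs) (u , l , refl , eq)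

    suffix : ∀ {u v w} xs → u ∈ₗ xs → IsPath w v xs → ∃[ ys ] IsPath u v ys
    suffix (x ∷ xs)     (here refl) (un , l , _ , eq) = x ∷ xs , un , l , refl , eq
    suffix (x ∷ y ∷ xs) (there m) (_ ∷ un , _ ∷ l , _ , eq) =
      suffix (y ∷ xs) m (un , l , refl , eq)

    star⇒path : ∀ {u v} → Star (Adj H) u v → ∃[ xs ] IsPath u v xs
    star⇒path {u} ε = [ u ] , [] ∷ [] , [-] , refl , refl
    star⇒path {u} (a ◅ s) with star⇒path s
    ... | xs , p with u M₁.∈? xs
    ...   | yes m = suffix xs m p
    star⇒path {u} (a ◅ s) | x ∷ xs , un , l , refl , eq | no ∉ =
      u ∷ x ∷ xs , ¬Any⇒All¬ _ ∉ ∷ un , a ∷ l , refl , eq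

  reachable? : Decidable (Star (Adj H))
  reachable? u v =
    map′ (λ { (xs , p) → path⇒star xs p }) star⇒path
      (anyList?
        (λ xs → U.unique? xs ×-dec linked? (adj? H) xs
          ×-dec Maybe-≡-dec _≟_ (head xs) (just u)
          ×-dec Maybe-≡-dec _≟_ (last xs) (just v))
        (λ _ p → Unique⇒length≤ (proj₁ p)))

  connected? : Dec (Connected H)
  connected? = vertex? (order H) ×-dec all? (λ u → all? (reachable? u))
    where
    vertex? : ∀ n → Dec (Fin n)
    vertex? zero    = no λ ()
    vertex? (suc n) = yes zero

  isGraphOn? : ∀ vs es → Dec (IsGraphOn H vs es)
  isGraphOn? vs es =
    U.unique? vs
    ×-dec all? (λ v → v M₁.∈? vs)
    ×-dec all? (λ u → all? (λ v →
      adj? H u v ⇔-dec (((u , v) M₂.∈? es) ⊎-dec ((v , u) M₂.∈? es))))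

  private
    -- Search for three lists occurring together in a repetition-free list.
    any₃? : ∀ {P : List (V H) → List (V H) → List (V H) → Set}
            (us : List (V H)) →
            (∀ p₁ p₂ p₃ → Dec (P p₁ p₂ p₃)) →
            (∀ {p₁ p₂ p₃} → P p₁ p₂ p₃ → Unique (us ++ p₁ ++ p₂ ++ p₃)) →
            Dec (∃[ p₁ ] ∃[ p₂ ] ∃[ p₃ ] P p₁ p₂ p₃)
    any₃? us P? un =
      anyList? (λ p₁ → anyList? (λ p₂ → anyList? (λ p₃ → P? p₁ p₂ p₃)
        (λ p₃ p → ≤-trans (length-++-≤ʳ p₃ {p₂})
                    (≤-trans (length-++-≤ʳ _ {p₁})
                      (≤-trans (length-++-≤ʳ _ {us}) (Unique⇒length≤ (un p))))))
        (λ { p₂ (p₃ , p) → ≤-trans (length-++-≤ˡ p₂)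
                    (≤-trans (length-++-≤ʳ _ {p₁})
                      (≤-trans (length-++-≤ʳ _ {us}) (Unique⇒length≤ (un p)))) }))
        (λ { p₁ (p₂ , p₃ , p) → ≤-trans (length-++-≤ˡ p₁)
                    (≤-trans (length-++-≤ʳ _ {us}) (Unique⇒length≤ (un p))) })

  isCycle? : Dec (IsCycle H)
  isCycle? = anyList? (λ c → (3 ≤? length c) ×-dec isGraphOn? c (cycle c))
                      (λ { _ (_ , un , _) → Unique⇒length≤ un })

  isPyramid? : Dec (IsPyramid H)
  isPyramid? = any? λ w →
    anyList? (λ c → anyList? (λ ns →
        (3 ≤? length c)
        ×-dec U.unique? ns ×-dec All.all? (M₁._∈? c) ns ×-dec (3 ≤? length ns)
        ×-dec isGraphOn? (w ∷ c) (cycle c ++ map (w ,_) ns))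
      (λ { _ (_ , un , _) → Unique⇒length≤ un }))
    (λ { _ (_ , _ , _ , _ , _ , (_ ∷ un) , _) → Unique⇒length≤ un })

  isTrihedron? : Dec (IsTrihedron H)
  isTrihedron? = any? λ a → any? λ b →
    any₃? (a ∷ b ∷ [])
      (λ p₁ p₂ p₃ → (1 ≤? length p₁) ×-dec (1 ≤? length p₂) ×-dec (1 ≤? length p₃)
                    ×-dec isGraphOn? _ _)
      (λ { (_ , _ , _ , un , _) → un })

  isStamp? : Dec (IsStamp H)
  isStamp? = any? λ x → any? λ t₁ → any? λ t₂ → any? λ t₃ →
    any₃? (x ∷ t₁ ∷ t₂ ∷ t₃ ∷ []) (λ p₁ p₂ p₃ → isGraphOn? _ _) proj₁

  isPrism? : Dec (IsPrism H)
  isPrism? =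
    any? λ x₁ → any? λ x₂ → any? λ x₃ → any? λ y₁ → any? λ y₂ → any? λ y₃ →
    any₃? (x₁ ∷ x₂ ∷ x₃ ∷ y₁ ∷ y₂ ∷ y₃ ∷ [])
      (λ p₁ p₂ p₃ → isGraphOn? _ _) proj₁

  isSolid? : Dec (IsSolid H)
  isSolid? = isPyramid? ⊎-dec isTrihedron? ⊎-dec isStamp? ⊎-dec isPrism?

_≼?_ : Decidable _≼_
H ≼? G = anyVec? λ B →
  all? (λ i → connected? (G ⟨ Vec.lookup B i ⟩))
  ×-dec all? (λ i → all? λ j → all? λ v →
    (v ∈? Vec.lookup B i) →-dec ((v ∈? Vec.lookup B j) →-dec (i ≟ j)))
  ×-dec all? (λ i → all? λ j → adj? H i j →-dec
    any? (λ u → any? λ v →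
      (u ∈? Vec.lookup B i) ×-dec (v ∈? Vec.lookup B j) ×-dec adj? G u v))

------------------------------------------------------------------------
-- Existence of the Hadwiger number

embed-∈ : ∀ {n} (S : Subset n) i → embed S i ∈ S
embed-∈ (true  ∷ S) zero    = Vec.here
embed-∈ (true  ∷ S) (suc i) = Vec.there (embed-∈ S i)
embed-∈ (false ∷ S) i       = Vec.there (embed-∈ S i)

≼⇒order≤ : ∀ {H G} → H ≼ G → order H ≤ order G
≼⇒order≤ {H} {G} (B , conn , disj , _) = injective⇒≤ {f = representative}
  λ {i} {j} eq → disj i j (representative i) (embed-∈ _ _)
                   (subst (_∈ Vec.lookup B j) (sym eq) (embed-∈ _ _))
  where
  representative : V H → V G
  representative i = embed (Vec.lookup B i) (proj₁ (conn i))

private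
  maximum : ∀ {P : Pred ℕ 0ℓ} → Decidable₁ P → P 0 →
            ∀ m → (∀ t → P t → t ≤ m) → ∃[ h ] (P h × (∀ t → P t → t ≤ h))
  maximum P? p₀ zero    bound = 0 , p₀ , bound
  maximum P? p₀ (suc m) bound with P? (suc m)
  ... | yes p = suc m , p , bound
  ... | no ¬p = maximum P? p₀ m λ t p →
    ≤-pred (≤∧≢⇒< (bound t p) λ { refl → ¬p p })

hadwiger : ∀ G → ∃[ h ] IsHadwigerNumber G h
hadwiger G = maximum (λ t → K t ≼? G) ([] , (λ ()) , (λ ()) , (λ ()))
                     (order G) (λ t → ≼⇒order≤ {K t} {G})

h : Graph → ℕ
h G = proj₁ (hadwiger G)

------------------------------------------------------------------------
-- The third graph characteristic

subsets : ∀ n → List (Subset n)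
subsets zero    = [ [] ]
subsets (suc n) = map (outside ∷_) (subsets n) ++ map (inside ∷_) (subsets n)

-- An induced subgraph is identified with its vertex set.

inducedCycles : (G : Graph) → List (Subset (order G))
inducedCycles G = filter (λ S → isCycle? (G ⟨ S ⟩)) (subsets (order G))

solids : (G : Graph) → List (Subset (order G))
solids G = filter (λ S → isSolid? (G ⟨ S ⟩)) (subsets (order G))

edges : (G : Graph) → List (V G × V G)
edges G = filter (λ { (u , v) → (u <? v) ×-dec adj? G u v })
                 (cartesianProduct (allFin (order G)) (allFin (order G)))

ℶ³ : Graph → ℤ
ℶ³ G = + length (solids G) - + length (inducedCycles G) + + length (edges G) - + order G
  where open Data.Integer

{-# OPTIONS --safe #-}

-- Write b(G) = |S(G)| - |C(G)| + |E(G)| - |V(G)|.  Branch sets of a K^h-model are contracted edge by edge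
-- until only K^h is left, so it suffices that contracting an edge uv does not increase b.  This is shown by
-- an injection.  Every solid of G/uv through the contracted vertex lifts to a solid of G through u, through v
-- or through both (a case analysis over the ways in which u and v share the neighbours of that vertex).  A
-- cycle of G keeps its image in G/uv as an induced cycle, with two exceptions: a triangle uvx, which is
-- matched with the edge vx that disappears, and a cycle Q through exactly one of u and v for which Q together
-- with the other one is a solid.  Such a solid is never the lift of a solid of G/uv, since a solid minus a
-- vertex is not a path.

module Submission where

open import Defs
open import Level using (0ℓ)
open import Algebra.Bundles using (CommutativeMonoid)
import Algebra.Solver.CommutativeMonoid
open import Data.Bool using (Bool; true; false)
open import Data.Empty using (⊥; ⊥-elim)
open import Data.Fin using (Fin; zero; suc; _<_)
import Data.Fin.Properties as Fin
open import Data.Fin.Subset using (Subset; inside; outside; ∣_∣; ⁅_⁆) renaming (_∈_ to _∈ˢ_; _⊆_ to _⊆ˢ_; ⊤ to full)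
import Data.Fin.Subset.Properties as Sub
open import Data.Integer using (+_; _+_; _-_; _≤_; -_; +≤+)
import Data.Integer.Properties as ℤ
import Data.Integer.Tactic.RingSolver as ℤRing
open import Data.List using (List; []; _∷_; [_]; _++_; _∷ʳ_; length; map; filter; reverse; allFin; cartesianProduct; initLast; _∷ʳ′_)
import Data.List.Membership.DecPropositional as DecMembership
open import Data.List.Membership.Propositional using (_∈_; _∉_; find)
open import Data.List.Membership.Propositional.Properties
import Data.List.Properties as List
open import Data.List.Relation.Binary.Permutation.Propositional using (_↭_; ↭⇒↭ₛ; ↭-sym; ↭-trans; ↭-refl; ↭-reflexive)
import Data.List.Relation.Binary.Permutation.Propositional.Properties as Perm
import Data.List.Relation.Binary.Permutation.Setoid.Properties as SetoidPerm
open import Data.List.Relation.Binary.Subset.Propositional using (_⊆_)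
open import Data.List.Relation.Unary.All as All using (All; []; _∷_)
import Data.List.Relation.Unary.All.Properties as All
open import Data.List.Relation.Unary.AllPairs as AllPairs using ([]; _∷_)
open import Data.List.Relation.Unary.Any using (here; there)
import Data.List.Relation.Unary.Any.Properties as Any
open import Data.List.Relation.Unary.Unique.Propositional using (Unique)
import Data.List.Relation.Unary.Unique.Propositional.Properties as Unique
open import Data.Maybe using (Maybe; just; nothing)
open import Data.Maybe.Properties using (just-injective)
open import Data.Nat as ℕ using (ℕ; zero; suc; z≤n; s≤s) renaming (_≤_ to _≤ⁿ_; _+_ to _+ⁿ_)
open import Data.Nat.Combinatorics using (_C_; nC1≡n; nCk+nC[k+1]≡[n+1]C[k+1]; k>n⇒nCk≡0)
import Data.Nat.Properties as ℕ
import Data.Nat.Tactic.RingSolver as ℕRing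
open import Data.Product using (∃; ∃-syntax; _×_; _,_; proj₁; proj₂)
open import Data.Sum using (_⊎_; inj₁; inj₂; swap; [_,_]′)
open import Data.Unit using (⊤; tt)
open import Data.Vec as Vec using () renaming (_∷_ to _∷ᵛ_)
open import Data.Vec.Properties using (lookup⇒[]=; []=⇒lookup; lookup∘tabulate)
open import Function using (_∘_; id; case_of_)
open import Function.Bundles using (mk⇔; Equivalence)
open import Relation.Binary using (DecidableEquality; tri<; tri≈; tri>)
open import Relation.Binary.Construct.Closure.ReflexiveTransitive as Star using (Star; ε; _◅_)
open import Relation.Binary.PropositionalEquality using (_≡_; _≢_; refl; sym; trans; cong; cong₂; subst; subst₂; ≢-sym; setoid)
import Relation.Binary.Reasoning.Setoid as SetoidReasoning
open import Relation.Nullary using (¬_; Dec; yes; no; contradiction)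
open import Relation.Nullary.Decidable using (_×-dec_; _⊎-dec_; ¬?; does; dec-true)

-- Minors are reached by contractions only, because deletions can raise b: removing an isolated
-- vertex increases it by one. Connectedness of G makes contractions enough, since a vertex outside
-- all branch sets can be merged into one of them. With its negative terms moved across, the
-- inequality for one contraction is |S(G/uv)| + |C(G)| + |E(G/uv)| + 1 ≤ |S(G)| + |C(G/uv)| +
-- |E(G)|, where the 1 is the lost vertex, matched with the edge uv. The obstacle is that different
-- sources can claim the same target; for instance, cycles of G through u, through v and through
-- both may have the same image. Priority is therefore given to u, and the trace of the target on u
-- and v together with adjacency conditions tells which kind of source claimed it. The case analysis
-- on solids is made free of any ambient graph: a solid is glued from points and arcs, one vertex is
-- removed, and its neighbours are shared out between u and v in all possible ways. What results has
-- to be recognised as a solid again, which amounts to rearranging pieces.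

private variable
  A B : Set

-- Gluing graphs from pieces

infixr 6 _•_

-- An arc contributes its interior vertices and all its edges, so that pieces can be glued without
-- repeating a vertex; an arc without interior vertices is an edge.
data Piece (A : Set) : Set where
  ε      : Piece A
  _•_    : Piece A → Piece A → Piece A
  pt     : A → Piece A
  arc    : A → List A → A → Piece A
  spokes : A → List A → Piece A

verts : Piece A → List A
verts ε            = []
verts (X • Y)      = verts X ++ verts Y
verts (pt a)       = [ a ]
verts (arc _ p _)  = p
verts (spokes _ _) = []

edges′ : Piece A → List (A × A)
edges′ ε             = []
edges′ (X • Y)       = edges′ X ++ edges′ Y
edges′ (pt _)        = []
edges′ (arc a p b)   = path (a ∷ p ∷ʳ b)
edges′ (spokes w ns) = map (w ,_) ns

pattern ed a b = arc a [] b

cyc : List A → Piece A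
cyc []       = ε
cyc (x ∷ xs) = pt x • arc x xs x

Joined : List (A × A) → A → A → Set
Joined es x y = (x , y) ∈ es ⊎ (y , x) ∈ es

infix 4 _≲_ _≋_

-- Vertices are compared with multiplicity, edges as a set of unordered pairs.
_≲_ : List (A × A) → List (A × A) → Set
es ≲ es′ = ∀ {x y} → (x , y) ∈ es → Joined es′ x y

record _≋_ (X Y : Piece A) : Set where
  constructor mk≋
  field
    verts-↭ : verts X ↭ verts Y
    edges-≲ : edges′ X ≲ edges′ Y
    edges-≳ : edges′ Y ≲ edges′ X
open _≋_ public

joined-mono : ∀ {es es′ : List (A × A)} → es ≲ es′ → ∀ {x y} → Joined es x y → Joined es′ x y
joined-mono f (inj₁ m) = f m
joined-mono f (inj₂ m) = swap (f m)

joined-++⁻ : ∀ (es : List (A × A)) {es′ x y} → Joined (es ++ es′) x y → Joined es x y ⊎ Joined es′ x y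
joined-++⁻ es (inj₁ m) = [ inj₁ ∘ inj₁ , inj₂ ∘ inj₁ ]′ (∈-++⁻ es m)
joined-++⁻ es (inj₂ m) = [ inj₁ ∘ inj₂ , inj₂ ∘ inj₂ ]′ (∈-++⁻ es m)

joined-++⁺ˡ : ∀ {es es′ : List (A × A)} {x y} → Joined es x y → Joined (es ++ es′) x y
joined-++⁺ˡ (inj₁ m) = inj₁ (∈-++⁺ˡ m)
joined-++⁺ˡ (inj₂ m) = inj₂ (∈-++⁺ˡ m)

joined-++⁺ʳ : ∀ (es : List (A × A)) {es′ x y} → Joined es′ x y → Joined (es ++ es′) x y
joined-++⁺ʳ es (inj₁ m) = inj₁ (∈-++⁺ʳ es m)
joined-++⁺ʳ es (inj₂ m) = inj₂ (∈-++⁺ʳ es m)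

≡⇒≋ : ∀ {X Y : Piece A} → verts X ≡ verts Y → edges′ X ≡ edges′ Y → X ≋ Y
≡⇒≋ p q = mk≋ (↭-reflexive p) (λ m → inj₁ (subst (_ ∈_) q m)) (λ m → inj₁ (subst (_ ∈_) (sym q) m))

≋-refl : {X : Piece A} → X ≋ X
≋-refl = ≡⇒≋ refl refl

≋-sym : {X Y : Piece A} → X ≋ Y → Y ≋ X
≋-sym (mk≋ v e e′) = mk≋ (↭-sym v) e′ e

≋-trans : {X Y Z : Piece A} → X ≋ Y → Y ≋ Z → X ≋ Z
≋-trans (mk≋ v e e′) (mk≋ w f f′) = mk≋ (↭-trans v w) (joined-mono f ∘ e) (joined-mono e′ ∘ f′)

≲-++ : ∀ {es es′ fs fs′ : List (A × A)} → es ≲ es′ → fs ≲ fs′ → es ++ fs ≲ es′ ++ fs′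
≲-++ {es = es} {es′} f g m with ∈-++⁻ es m
... | inj₁ m′ = joined-++⁺ˡ (f m′)
... | inj₂ m′ = joined-++⁺ʳ es′ (g m′)

•-cong : {X X′ Y Y′ : Piece A} → X ≋ X′ → Y ≋ Y′ → X • Y ≋ X′ • Y′
•-cong (mk≋ v e e′) (mk≋ w f f′) = mk≋ (Perm.++⁺ v w) (≲-++ e f) (≲-++ e′ f′)

infixr 5 ↷_

↷_ : {X Y Z : Piece A} → Y ≋ Z → X • Y ≋ X • Z
↷_ = •-cong ≋-refl

•-comm : (X Y : Piece A) → X • Y ≋ Y • X
•-comm X Y = mk≋ (Perm.++-comm (verts X) (verts Y)) (λ m → inj₁ (Perm.∈-resp-↭ (Perm.++-comm (edges′ X) (edges′ Y)) m))
                 (λ m → inj₁ (Perm.∈-resp-↭ (Perm.++-comm (edges′ Y) (edges′ X)) m))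

-- Recognising a glued graph thereby becomes an identity between words in a commutative monoid,
-- which the solver settles. Only turning an edge round, reversing an arc and cutting it open need
-- lemmas of their own.
pieceMonoid : Set → CommutativeMonoid 0ℓ 0ℓ
pieceMonoid A = record
  { Carrier = Piece A ; _≈_ = _≋_ ; _∙_ = _•_ ; ε = ε
  ; isCommutativeMonoid = record
    { isMonoid = record
      { isSemigroup = record
        { isMagma = record
          { isEquivalence = record { refl = ≋-refl ; sym = ≋-sym ; trans = ≋-trans }
          ; ∙-cong = •-cong }
        ; assoc = λ X Y Z → ≡⇒≋ (List.++-assoc (verts X) (verts Y) (verts Z))
                                (List.++-assoc (edges′ X) (edges′ Y) (edges′ Z)) }
      ; identity = (λ X → ≡⇒≋ refl refl) , (λ X → ≡⇒≋ (List.++-identityʳ _) (List.++-identityʳ _)) }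
    ; comm = •-comm } }

module _ {A : Set} where
  open Algebra.Solver.CommutativeMonoid (pieceMonoid A) public using (solve; _⊜_; _⊕_)
  open SetoidReasoning (CommutativeMonoid.setoid (pieceMonoid A)) public

ed-sym : (a b : A) → ed a b ≋ ed b a
ed-sym a b = mk≋ ↭-refl (λ { (here refl) → inj₂ (here refl) }) (λ { (here refl) → inj₂ (here refl) })

arc-∷ : (a x : A) (p : List A) (b : A) → arc a (x ∷ p) b ≋ ed a x • pt x • arc x p b
arc-∷ a x p b = ≡⇒≋ refl refl

arc-++ : (a : A) (p : List A) (m : A) (q : List A) (b : A) →
         arc a (p ++ m ∷ q) b ≋ arc a p m • pt m • arc m q b
arc-++ a []      m q b = arc-∷ a m q b
arc-++ a (x ∷ p) m q b = begin
  arc a (x ∷ p ++ m ∷ q) b                         ≈⟨ ≡⇒≋ refl refl ⟩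
  (ed a x • pt x) • arc x (p ++ m ∷ q) b           ≈⟨ ↷ arc-++ x p m q b ⟩
  (ed a x • pt x) • arc x p m • pt m • arc m q b   ≈⟨ ≡⇒≋ refl refl ⟩
  arc a (x ∷ p) m • pt m • arc m q b               ∎

arc-∷ʳ : (a : A) (p : List A) (x b : A) → arc a (p ∷ʳ x) b ≋ arc a p x • pt x • ed x b
arc-∷ʳ a p x b = arc-++ a p x [] b

arc-reverse : (a : A) (p : List A) (b : A) → arc a p b ≋ arc b (reverse p) a
arc-reverse a []      b = ed-sym a b
arc-reverse a (x ∷ p) b = begin
  arc a (x ∷ p) b                              ≈⟨ arc-∷ a x p b ⟩
  ed a x • pt x • arc x p b                    ≈⟨ •-cong (ed-sym a x) (↷ arc-reverse x p b) ⟩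
  ed x a • pt x • arc b (reverse p) x          ≈⟨ solve 3 (λ e x r → e ⊕ x ⊕ r ⊜ r ⊕ x ⊕ e) ≋-refl _ _ _ ⟩
  arc b (reverse p) x • pt x • ed x a          ≈⟨ arc-∷ʳ b (reverse p) x a ⟨
  arc b (reverse p ∷ʳ x) a                     ≡⟨ cong (λ r → arc b r a) (List.unfold-reverse x p) ⟨
  arc b (reverse (x ∷ p)) a                    ∎

cyc-rotate : (p : List A) (w : A) (q : List A) → cyc (p ++ w ∷ q) ≋ cyc (w ∷ q ++ p)
cyc-rotate []      w q = ≡⇒≋ (cong (w ∷_) (sym (List.++-identityʳ q))) (cong (λ r → path (w ∷ r ∷ʳ w)) (sym (List.++-identityʳ q)))
cyc-rotate (x ∷ p) w q = begin
  pt x • arc x (p ++ w ∷ q) x                  ≈⟨ ↷ arc-++ x p w q x ⟩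
  pt x • arc x p w • pt w • arc w q x          ≈⟨ solve 4 (λ a b c d → a ⊕ b ⊕ c ⊕ d ⊜ c ⊕ d ⊕ a ⊕ b) ≋-refl _ _ _ _ ⟩
  pt w • arc w q x • pt x • arc x p w          ≈⟨ ↷ arc-++ w q x p w ⟨
  pt w • arc w (q ++ x ∷ p) w                  ∎

-- Solids

-- Each kind is one normal form up to `≋`, so rearranging pieces never leaves the predicate. The
-- paths of stamps and prisms may be single edges, that is, arcs without interior vertices.
data Solid {A : Set} (X : Piece A) : Set where
  pyramid : ∀ w c ns → 3 ≤ⁿ length c → Unique ns → ns ⊆ c → 3 ≤ⁿ length ns →
    X ≋ pt w • cyc c • spokes w ns → Solid X
  trihedron : ∀ a b p q r → 1 ≤ⁿ length p → 1 ≤ⁿ length q → 1 ≤ⁿ length r →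
    X ≋ pt a • pt b • arc a p b • arc a q b • arc a r b → Solid X
  stamp : ∀ x s t u p q r →
    X ≋ pt x • pt s • pt t • pt u • ed s t • ed t u • ed u s • arc s p x • arc t q x • arc u r x → Solid X
  prism : ∀ x₁ x₂ x₃ y₁ y₂ y₃ p q r →
    X ≋ pt x₁ • pt x₂ • pt x₃ • pt y₁ • pt y₂ • pt y₃ • ed x₁ x₂ • ed x₂ x₃ • ed x₃ x₁ •
        ed y₁ y₂ • ed y₂ y₃ • ed y₃ y₁ • arc x₁ p y₁ • arc x₂ q y₂ • arc x₃ r y₃ → Solid X

solid-resp : {X Y : Piece A} → X ≋ Y → Solid Y → Solid X
solid-resp e (pyramid w c ns l u s l′ f)            = pyramid w c ns l u s l′ (≋-trans e f)
solid-resp e (trihedron a b p q r lp lq lr f)       = trihedron a b p q r lp lq lr (≋-trans e f)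
solid-resp e (stamp x s t u p q r f)                = stamp x s t u p q r (≋-trans e f)
solid-resp e (prism x₁ x₂ x₃ y₁ y₂ y₃ p q r f)      = prism x₁ x₂ x₃ y₁ y₂ y₃ p q r (≋-trans e f)

Distinct : Piece A → Set
Distinct X = Unique (verts X)

unique-resp : {xs ys : List A} → xs ↭ ys → Unique xs → Unique ys
unique-resp p = SetoidPerm.Unique-resp-↭ (setoid _) (↭⇒↭ₛ p)

distinct-resp : {X Y : Piece A} → X ≋ Y → Distinct X → Distinct Y
distinct-resp e = unique-resp (verts-↭ e)

unique-++ˡ : (xs : List A) {ys : List A} → Unique (xs ++ ys) → Unique xs
unique-++ˡ []       _        = []
unique-++ˡ (x ∷ xs) (x∉ ∷ u) = All.++⁻ˡ xs x∉ ∷ unique-++ˡ xs u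

unique-++ʳ : (xs : List A) {ys : List A} → Unique (xs ++ ys) → Unique ys
unique-++ʳ []       u       = u
unique-++ʳ (x ∷ xs) (_ ∷ u) = unique-++ʳ xs u

distinctˡ : (X Y : Piece A) → Distinct (X • Y) → Distinct X
distinctˡ X Y = unique-++ˡ (verts X)

All≢⇒∉ : {x : A} {xs : List A} → All (x ≢_) xs → x ∉ xs
All≢⇒∉ a m = All.lookup a m refl

∉⇒All≢ : {x : A} {xs : List A} → x ∉ xs → All (x ≢_) xs
∉⇒All≢ n = All.tabulate λ { m refl → n m }

unique-⊆-length : {xs ys : List A} → Unique xs → xs ⊆ ys → length xs ≤ⁿ length ys
unique-⊆-length []       _ = z≤n
unique-⊆-length {xs = x ∷ xs} (x∉ ∷ u) s with ∈-∃++ (s (here refl))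
... | as , bs , refl = ℕ.≤-trans (s≤s (unique-⊆-length u rest⊆)) (ℕ.≤-reflexive (sym (List.length-++-sucʳ as x bs)))
  where
  rest⊆ : xs ⊆ as ++ bs
  rest⊆ m with ∈-++⁻ as (s (there m))
  ... | inj₁ m′           = ∈-++⁺ˡ m′
  ... | inj₂ (here refl)  = contradiction m (All≢⇒∉ x∉)
  ... | inj₂ (there m′)   = ∈-++⁺ʳ as m′

-- Three distinct spoke ends already force the rim to have length at least 3.
wheel : ∀ (w : A) c {ns X} → Unique ns → ns ⊆ c → 3 ≤ⁿ length ns → X ≋ pt w • cyc c • spokes w ns → Solid X
wheel w c u s l e = pyramid w c _ (ℕ.≤-trans l (unique-⊆-length u s)) u s l e

-- The shape in which pyramids turn up in the case analyses: a rim cut into arcs at its spoke ends.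
-- The rim is assembled here once, and the spoke ends are distinct because `X` is.
wheel₃ : ∀ (w a b c : A) {p q r X} → Distinct X →
  X ≋ pt w • pt a • pt b • pt c • arc a p b • arc b q c • arc c r a • ed w a • ed w b • ed w c → Solid X
wheel₃ w a b c {p} {q} {r} {X} d e with distinct-resp e d
... | _ ∷ (a≢b ∷ a≢c ∷ _) ∷ (b≢c ∷ _) ∷ _ =
  wheel w (a ∷ p ++ b ∷ q ++ c ∷ r) ((a≢b ∷ a≢c ∷ []) ∷ (b≢c ∷ []) ∷ [] ∷ [])
    (λ { (here refl) → here refl ; (there (here refl)) → there (∈-++⁺ʳ p (here refl))
       ; (there (there (here refl))) → there (∈-++⁺ʳ p (there (∈-++⁺ʳ q (here refl)))) })
    (s≤s (s≤s (s≤s z≤n))) (begin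
      X ≈⟨ e ⟩
      _ ≈⟨ solve 10 (λ w a b c p q r e f g → w ⊕ a ⊕ b ⊕ c ⊕ p ⊕ q ⊕ r ⊕ e ⊕ f ⊕ g
                      ⊜ w ⊕ (a ⊕ p ⊕ b ⊕ q ⊕ c ⊕ r) ⊕ e ⊕ f ⊕ g) ≋-refl _ _ _ _ _ _ _ _ _ _ ⟩
      pt w • (pt a • arc a p b • pt b • arc b q c • pt c • arc c r a) • ed w a • ed w b • ed w c
        ≈⟨ ↷ •-cong (↷ ≋-trans (arc-++ a p b (q ++ c ∷ r) a)
             (↷ ↷ arc-++ b q c r a)) (≡⇒≋ refl refl) ⟨
      pt w • cyc (a ∷ p ++ b ∷ q ++ c ∷ r) • spokes w (a ∷ b ∷ c ∷ []) ∎)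

wheel₄ : ∀ (w a b c x : A) {p q r s X} → Distinct X →
  X ≋ pt w • pt a • pt b • pt c • pt x • arc a p b • arc b q c • arc c r x • arc x s a •
      ed w a • ed w b • ed w c • ed w x → Solid X
wheel₄ w a b c x {p} {q} {r} {s} {X} d e with distinct-resp e d
... | _ ∷ (a≢b ∷ a≢c ∷ a≢x ∷ _) ∷ (b≢c ∷ b≢x ∷ _) ∷ (c≢x ∷ _) ∷ _ =
  wheel w (a ∷ p ++ b ∷ q ++ c ∷ r ++ x ∷ s) ((a≢b ∷ a≢c ∷ a≢x ∷ []) ∷ (b≢c ∷ b≢x ∷ []) ∷ (c≢x ∷ []) ∷ [] ∷ [])
    (λ { (here refl) → here refl ; (there (here refl)) → there (∈-++⁺ʳ p (here refl))
       ; (there (there (here refl))) → there (∈-++⁺ʳ p (there (∈-++⁺ʳ q (here refl))))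
       ; (there (there (there (here refl)))) →
           there (∈-++⁺ʳ p (there (∈-++⁺ʳ q (there (∈-++⁺ʳ r (here refl)))))) })
    (s≤s (s≤s (s≤s z≤n))) (begin
      X ≈⟨ e ⟩
      _ ≈⟨ solve 13 (λ w a b c x p q r s e f g h → w ⊕ a ⊕ b ⊕ c ⊕ x ⊕ p ⊕ q ⊕ r ⊕ s ⊕ e ⊕ f ⊕ g ⊕ h
                      ⊜ w ⊕ (a ⊕ p ⊕ b ⊕ q ⊕ c ⊕ r ⊕ x ⊕ s) ⊕ e ⊕ f ⊕ g ⊕ h) ≋-refl _ _ _ _ _ _ _ _ _ _ _ _ _ ⟩
      pt w • (pt a • arc a p b • pt b • arc b q c • pt c • arc c r x • pt x • arc x s a) •
        ed w a • ed w b • ed w c • ed w x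
        ≈⟨ ↷ •-cong (↷ ≋-trans (arc-++ a p b (q ++ c ∷ r ++ x ∷ s) a)
             (↷ ↷ ≋-trans (arc-++ b q c (r ++ x ∷ s) a)
               (↷ ↷ arc-++ c r x s a))) (≡⇒≋ refl refl) ⟨
      pt w • cyc (a ∷ p ++ b ∷ q ++ c ∷ r ++ x ∷ s) • spokes w (a ∷ b ∷ c ∷ x ∷ []) ∎)

-- What an arc leaves behind when its starting point is removed: `first p b` is the neighbour of
-- that point, and `rest p b` is the remainder, whose end `b` is supplied by another piece. For an
-- edge the neighbour is `b` itself.
first : List A → A → A
first []      b = b
first (x ∷ _) b = x

rest : List A → A → Piece A
rest []      b = ε
rest (x ∷ p) b = pt x • arc x p b

peel : (u : A) (p : List A) (b : A) → arc u p b ≋ ed u (first p b) • rest p b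
peel u []      b = ≡⇒≋ refl refl
peel u (x ∷ p) b = arc-∷ u x p b

arc-mid : (a : A) (p : List A) (u : A) (q : List A) (b : A) →
  arc a (p ++ u ∷ q) b ≋
    pt u • (rest (reverse p) a • rest q b) • ed u (first (reverse p) a) • ed u (first q b)
arc-mid a p u q b = begin
  arc a (p ++ u ∷ q) b              ≈⟨ arc-++ a p u q b ⟩
  arc a p u • pt u • arc u q b
    ≈⟨ •-cong (≋-trans (arc-reverse a p u) (peel u (reverse p) a)) (↷ peel u q b) ⟩
  (ed u _ • rest (reverse p) a) • pt u • ed u _ • rest q b
    ≈⟨ solve 5 (λ e r u f s → (e ⊕ r) ⊕ u ⊕ f ⊕ s ⊜ u ⊕ (r ⊕ s) ⊕ e ⊕ f) ≋-refl _ _ _ _ _ ⟩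
  pt u • (rest (reverse p) a • rest q b) • ed u (first (reverse p) a) • ed u (first q b) ∎

arc-mid₂ : (a : A) (p : List A) (u v : A) (q : List A) (b : A) →
  arc a (p ++ u ∷ v ∷ q) b ≋
    pt u • pt v • ed u v • (rest (reverse p) a • rest q b) • ed u (first (reverse p) a) • ed v (first q b)
arc-mid₂ a p u v q b = begin
  arc a (p ++ u ∷ v ∷ q) b          ≈⟨ arc-++ a p u (v ∷ q) b ⟩
  arc a p u • pt u • arc u (v ∷ q) b
    ≈⟨ •-cong (≋-trans (arc-reverse a p u) (peel u (reverse p) a))
              (↷ ≋-trans (arc-∷ u v q b) (↷ ↷ peel v q b)) ⟩
  (ed u _ • rest (reverse p) a) • pt u • ed u v • pt v • ed v _ • rest q b
    ≈⟨ solve 7 (λ e r u g v f s → (e ⊕ r) ⊕ u ⊕ g ⊕ v ⊕ f ⊕ s ⊜ u ⊕ v ⊕ g ⊕ (r ⊕ s) ⊕ e ⊕ f) ≋-refl _ _ _ _ _ _ _ ⟩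
  pt u • pt v • ed u v • (rest (reverse p) a • rest q b) • ed u (first (reverse p) a) • ed v (first q b) ∎

OnVerts OnEnds : (A → Set) → Piece A → Set
OnVerts P ε            = ⊤
OnVerts P (X • Y)      = OnVerts P X × OnVerts P Y
OnVerts P (pt a)       = P a
OnVerts P (arc _ p _)  = All P p
OnVerts P (spokes _ _) = ⊤
OnEnds P ε             = ⊤
OnEnds P (X • Y)       = OnEnds P X × OnEnds P Y
OnEnds P (pt a)        = ⊤
OnEnds P (arc a p b)   = P a × All P p × P b
OnEnds P (spokes z ns) = P z × All P ns

-- A piece may have edges ending at points that it does not list, so `Off w` does not exclude an
-- edge at `w`; `Avoids w` does.
Off Avoids : A → Piece A → Set
Off w    = OnVerts (w ≢_)
Avoids w = OnEnds (w ≢_)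

onVerts : ∀ {P : A → Set} X → (∀ {x} → x ∈ verts X → P x) → OnVerts P X
onVerts ε            n = tt
onVerts (X • Y)      n = onVerts X (n ∘ ∈-++⁺ˡ) , onVerts Y (n ∘ ∈-++⁺ʳ (verts X))
onVerts (pt a)       n = n (here refl)
onVerts (arc _ p _)  n = All.tabulate n
onVerts (spokes _ _) n = tt

off : ∀ {w : A} X → w ∉ verts X → Off w X
off X n = onVerts X (λ { m refl → n m })

onEnds-path : ∀ {P : A → Set} {x y xs} → All P xs → (x , y) ∈ path xs → P x × P y
onEnds-path {xs = _ ∷ []} _ ()
onEnds-path {xs = _ ∷ _ ∷ _} (a ∷ b ∷ _) (here refl) = a , b
onEnds-path {xs = _ ∷ _ ∷ _} (a ∷ as)    (there m)   = onEnds-path as m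

onEnds : ∀ {P : A → Set} {x y} X → OnEnds P X → (x , y) ∈ edges′ X → P x × P y
onEnds (X • Y) (a , b) m with ∈-++⁻ (edges′ X) m
... | inj₁ m′ = onEnds X a m′
... | inj₂ m′ = onEnds Y b m′
onEnds (arc a p b) (n , ns , n′) m = onEnds-path (n ∷ All.++⁺ ns (n′ ∷ [])) m
onEnds (spokes z ns) (n , a) m with ∈-map⁻ _ m
... | _ , m′ , refl = n , All.lookup a m′

avoids-rest : ∀ {w : A} p b → Off w (rest p b) → w ≢ b → Avoids w (rest p b)
avoids-rest []      b _         _ = tt
avoids-rest (x ∷ p) b (n , ns) n′ = tt , n , ns , n′

-- Splitting a vertex of a solid

-- X is a solid without one of its vertices, which is split into u and v; S and T are the edges from u and v to X.
Lifted : Piece A → A → A → Piece A → Piece A → Set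
Lifted X u v S T = Solid (pt u • X • S) ⊎ Solid (pt v • X • T) ⊎ Solid (pt u • pt v • ed u v • X • S • T)

lifted-resp : ∀ {X X′ : Piece A} {u v S S′ T T′} → X ≋ X′ → S ≋ S′ → T ≋ T′ → Lifted X′ u v S′ T′ → Lifted X u v S T
lifted-resp x s t (inj₁ a)        = inj₁ (solid-resp (↷ •-cong x s) a)
lifted-resp x s t (inj₂ (inj₁ b)) = inj₂ (inj₁ (solid-resp (↷ •-cong x t) b))
lifted-resp x s t (inj₂ (inj₂ c)) =
  inj₂ (inj₂ (solid-resp (↷ ↷ ↷ •-cong x (•-cong s t)) c))

lifted-swap : ∀ {X : Piece A} {u v S T} → Lifted X u v S T → Lifted X v u T S
lifted-swap (inj₁ a)        = inj₂ (inj₁ a)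
lifted-swap (inj₂ (inj₁ b)) = inj₁ b
lifted-swap {u = u} {v} (inj₂ (inj₂ c)) = inj₂ (inj₂ (solid-resp (≋-trans
  (↷ ↷ •-cong (ed-sym v u) ≋-refl)
  (solve 6 (λ v u e x t s → v ⊕ u ⊕ e ⊕ x ⊕ t ⊕ s ⊜ u ⊕ v ⊕ e ⊕ x ⊕ s ⊕ t) ≋-refl _ _ _ _ _ _)) c))

spokes-cong : ∀ (u : A) {ns ms} → ns ⊆ ms → ms ⊆ ns → spokes u ns ≋ spokes u ms
spokes-cong u {ns} {ms} f g = mk≋ ↭-refl (half f) (half g)
  where
  half : ∀ {ns ms} → ns ⊆ ms → map (u ,_) ns ≲ map (u ,_) ms
  half f m with ∈-map⁻ _ m
  ... | _ , m′ , refl = inj₁ (∈-map⁺ _ (f m′))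

distinct-swap : ∀ {u v : A} {X} → Distinct (pt u • pt v • X) → Distinct (pt v • pt u • X)
distinct-swap {u = u} {v} {X} =
  distinct-resp (solve 3 (λ u v x → u ⊕ v ⊕ x ⊜ v ⊕ u ⊕ x) ≋-refl (pt u) (pt v) X)

-- `A` and `B` are the shares of `u` and `v` in the neighbours `N` of the contracted vertex. No
-- graph enters: this is a property of the solid and the chosen vertex alone, and it deals with
-- every distribution that covers `N`.
LiftAll : Piece A → List A → Set
LiftAll X N = ∀ {u v A B} → Distinct (pt u • pt v • X) → Unique A → Unique B → A ⊆ N → B ⊆ N →
              (∀ {x} → x ∈ N → x ∈ A ⊎ x ∈ B) → Lifted X u v (spokes u A) (spokes v B)

data Side : Set where
  left right both-sides : Side

onL onR : Side → A → List A → List A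
onL left  x xs = x ∷ xs
onL right  x xs = xs
onL both-sides x xs = x ∷ xs
onR left  x xs = xs
onR right  x xs = x ∷ xs
onR both-sides x xs = x ∷ xs

module _ {A : Set} (_≟_ : DecidableEquality A) where
  open DecMembership _≟_ using (_∈?_)

  -- Brings arbitrary lists `A` and `B` into normal form: each element of `N` is put on the side or
  -- sides where it occurs, so that finitely many explicit pairs of spoke lists remain.
  splitNeighbours : ∀ (N : List A) {A B} → (∀ {x} → x ∈ N → x ∈ A ⊎ x ∈ B) →
    ∀ {x} → x ∈ N → ∃[ s ] (∀ {xs} → (x ∈ A → x ∈ onL s x xs) × (∀ {y} → y ∈ onL s x xs → y ∈ A ⊎ y ∈ xs)
                                  × (∀ {y} → y ∈ xs → y ∈ onL s x xs))
                         × (∀ {xs} → (x ∈ B → x ∈ onR s x xs) × (∀ {y} → y ∈ onR s x xs → y ∈ B ⊎ y ∈ xs)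
                                  × (∀ {y} → y ∈ xs → y ∈ onR s x xs))
  splitNeighbours N {A} {B} cover {x} m with x ∈? A | x ∈? B
  ... | yes a | yes b = both-sides , ((λ _ → here refl) , (λ { (here refl) → inj₁ a ; (there m) → inj₂ m }) , there)
                           , ((λ _ → here refl) , (λ { (here refl) → inj₁ b ; (there m) → inj₂ m }) , there)
  ... | yes a | no ¬b = left  , ((λ _ → here refl) , (λ { (here refl) → inj₁ a ; (there m) → inj₂ m }) , there)
                           , ((λ b → contradiction b ¬b) , inj₂ , λ m → m)
  ... | no ¬a | yes b = right  , ((λ a → contradiction a ¬a) , inj₂ , λ m → m)
                           , ((λ _ → here refl) , (λ { (here refl) → inj₁ b ; (there m) → inj₂ m }) , there)
  ... | no ¬a | no ¬b with cover m
  ...   | inj₁ a = contradiction a ¬a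
  ...   | inj₂ b = contradiction b ¬b

  -- If `u` or `v` has both neighbours, it replaces the contracted vertex by itself. Otherwise each
  -- has exactly one, a single case up to exchanging `u` and `v`.
  lift₂ : ∀ {X : Piece A} {a b} →
    (∀ u v → Distinct (pt u • pt v • X) → Solid (pt u • X • ed u a • ed u b)) →
    (∀ u v → Distinct (pt u • pt v • X) → Lifted X u v (ed u a) (ed v b)) →
    LiftAll X (a ∷ b ∷ [])
  lift₂ {X} {a} {b} one two {u} {v} {A} {B} d _ _ A⊆ B⊆ cover
    with splitNeighbours (a ∷ b ∷ []) {A} {B} cover (here refl)
       | splitNeighbours (a ∷ b ∷ []) {A} {B} cover (there (here refl))
  ... | s , sA , sB | t , tA , tB =
    lifted-resp ≋-refl
      (spokes-cong u
        (λ m → case A⊆ m of λ { (here refl) → proj₁ sA m ; (there (here refl)) → proj₂ (proj₂ sA) (proj₁ tA m) })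
        (λ m → case proj₁ (proj₂ sA) m of λ { (inj₁ m) → m ; (inj₂ m) → case proj₁ (proj₂ tA) m of λ { (inj₁ m) → m ; (inj₂ ()) } }))
      (spokes-cong v
        (λ m → case B⊆ m of λ { (here refl) → proj₁ sB m ; (there (here refl)) → proj₂ (proj₂ sB) (proj₁ tB m) })
        (λ m → case proj₁ (proj₂ sB) m of λ { (inj₁ m) → m ; (inj₂ m) → case proj₁ (proj₂ tB) m of λ { (inj₁ m) → m ; (inj₂ ()) } }))
      (go s t)
    where
    d′ = distinct-swap {X = X} d
    allL : ∀ {T} → Lifted X u v (spokes u (a ∷ b ∷ [])) T
    allL = inj₁ (solid-resp (≡⇒≋ refl refl) (one u v d))
    allR : ∀ {S} → Lifted X u v S (spokes v (a ∷ b ∷ []))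
    allR = inj₂ (inj₁ (solid-resp (≡⇒≋ refl refl) (one v u d′)))
    go : ∀ s t → Lifted X u v (spokes u (onL s a (onL t b []))) (spokes v (onR s a (onR t b [])))
    go left  left  = allL
    go left  both-sides = allL
    go both-sides left  = allL
    go both-sides both-sides = allL
    go right  right  = allR
    go right  both-sides = allR
    go both-sides right  = allR
    go left  right  = lifted-resp ≋-refl (≡⇒≋ refl refl) (≡⇒≋ refl refl) (two u v d)
    go right  left  = lifted-resp ≋-refl (≡⇒≋ refl refl) (≡⇒≋ refl refl) (lifted-swap (two v u d′))

  -- When neither `u` nor `v` has all three neighbours, they either divide them one against two, or
  -- have two each with one in common. Up to exchanging `u` and `v`, one neighbour fixes the case:
  -- the lone one in `only-a`, `only-b`, `only-c`, the common one in `both-a`, `both-b`, `both-c`.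
  lift₃ : ∀ {X : Piece A} {a b c} →
    (∀ u v → Distinct (pt u • pt v • X) → Solid (pt u • X • ed u a • ed u b • ed u c)) →
    (∀ u v → Distinct (pt u • pt v • X) → Lifted X u v (ed u a) (ed v b • ed v c)) →
    (∀ u v → Distinct (pt u • pt v • X) → Lifted X u v (ed u b) (ed v a • ed v c)) →
    (∀ u v → Distinct (pt u • pt v • X) → Lifted X u v (ed u c) (ed v a • ed v b)) →
    (∀ u v → Distinct (pt u • pt v • X) → Lifted X u v (ed u a • ed u b) (ed v a • ed v c)) →
    (∀ u v → Distinct (pt u • pt v • X) → Lifted X u v (ed u a • ed u b) (ed v b • ed v c)) →
    (∀ u v → Distinct (pt u • pt v • X) → Lifted X u v (ed u a • ed u c) (ed v b • ed v c)) →
    LiftAll X (a ∷ b ∷ c ∷ [])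
  lift₃ {X} {a} {b} {c} one only-a only-b only-c both-a both-b both-c {u} {v} {A} {B} d _ _ A⊆ B⊆ cover
    with splitNeighbours (a ∷ b ∷ c ∷ []) {A} {B} cover (here refl)
       | splitNeighbours (a ∷ b ∷ c ∷ []) {A} {B} cover (there (here refl))
       | splitNeighbours (a ∷ b ∷ c ∷ []) {A} {B} cover (there (there (here refl)))
  ... | s , sA , sB | t , tA , tB | r , rA , rB =
    lifted-resp ≋-refl
      (spokes-cong u
        (λ m → case A⊆ m of λ { (here refl) → proj₁ sA m ; (there (here refl)) → proj₂ (proj₂ sA) (proj₁ tA m)
                              ; (there (there (here refl))) → proj₂ (proj₂ sA) (proj₂ (proj₂ tA) (proj₁ rA m)) })
        (λ m → case proj₁ (proj₂ sA) m of λ { (inj₁ m) → m ; (inj₂ m) → case proj₁ (proj₂ tA) m of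
                 λ { (inj₁ m) → m ; (inj₂ m) → case proj₁ (proj₂ rA) m of λ { (inj₁ m) → m ; (inj₂ ()) } } }))
      (spokes-cong v
        (λ m → case B⊆ m of λ { (here refl) → proj₁ sB m ; (there (here refl)) → proj₂ (proj₂ sB) (proj₁ tB m)
                              ; (there (there (here refl))) → proj₂ (proj₂ sB) (proj₂ (proj₂ tB) (proj₁ rB m)) })
        (λ m → case proj₁ (proj₂ sB) m of λ { (inj₁ m) → m ; (inj₂ m) → case proj₁ (proj₂ tB) m of
                 λ { (inj₁ m) → m ; (inj₂ m) → case proj₁ (proj₂ rB) m of λ { (inj₁ m) → m ; (inj₂ ()) } } }))
      (go s t r)
    where
    d′ = distinct-swap {X = X} d
    allL : ∀ {T} → Lifted X u v (spokes u (a ∷ b ∷ c ∷ [])) T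
    allL = inj₁ (solid-resp (≡⇒≋ refl refl) (one u v d))
    allR : ∀ {S} → Lifted X u v S (spokes v (a ∷ b ∷ c ∷ []))
    allR = inj₂ (inj₁ (solid-resp (≡⇒≋ refl refl) (one v u d′)))
    put : ∀ {S S′ T T′} → verts S ≡ verts S′ → edges′ S ≡ edges′ S′ → verts T ≡ verts T′ → edges′ T ≡ edges′ T′ →
          Lifted X u v S′ T′ → Lifted X u v S T
    put p q p′ q′ = lifted-resp ≋-refl (≡⇒≋ p q) (≡⇒≋ p′ q′)
    go : ∀ s t r → Lifted X u v (spokes u (onL s a (onL t b (onL r c [])))) (spokes v (onR s a (onR t b (onR r c []))))
    go left  left  left  = allL
    go left  left  both-sides = allL
    go left  both-sides left  = allL
    go left  both-sides both-sides = allL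
    go both-sides left  left  = allL
    go both-sides left  both-sides = allL
    go both-sides both-sides left  = allL
    go both-sides both-sides both-sides = allL
    go right  right  right  = allR
    go right  right  both-sides = allR
    go right  both-sides right  = allR
    go right  both-sides both-sides = allR
    go both-sides right  right  = allR
    go both-sides right  both-sides = allR
    go both-sides both-sides right  = allR
    go left  right  right  = put refl refl refl refl (only-a u v d)
    go right  left  right  = put refl refl refl refl (only-b u v d)
    go right  right  left  = put refl refl refl refl (only-c u v d)
    go right  left  left  = put refl refl refl refl (lifted-swap (only-a v u d′))
    go left  right  left  = put refl refl refl refl (lifted-swap (only-b v u d′))
    go left  left  right  = put refl refl refl refl (lifted-swap (only-c v u d′))
    go both-sides left  right  = put refl refl refl refl (both-a u v d)
    go both-sides right  left  = put refl refl refl refl (lifted-swap (both-a v u d′))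
    go left  both-sides right  = put refl refl refl refl (both-b u v d)
    go right  both-sides left  = put refl refl refl refl (lifted-swap (both-b v u d′))
    go left  right  both-sides = put refl refl refl refl (both-c u v d)
    go right  left  both-sides = put refl refl refl refl (lifted-swap (both-c v u d′))

-- Reasons why a piece is not a path: a cycle, made of two arcs from a to b, or a vertex of degree 3.
data NonPath {A : Set} (X : Piece A) : Set where
  ring : ∀ a b p q Y → 1 ≤ⁿ length (p ++ q) → X ≋ pt a • pt b • arc a p b • arc a q b • Y → NonPath X
  claw : ∀ a x y z Y → X ≋ pt a • pt x • pt y • pt z • ed a x • ed a y • ed a z • Y → NonPath X

nonPath-•ʳ : (X : Piece A) {Y : Piece A} → NonPath Y → NonPath (X • Y)
nonPath-•ʳ X (ring a b p q Z l f) = ring a b p q (X • Z) l (≋-trans (↷ f)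
  (solve 6 (λ x a b p q z → x ⊕ a ⊕ b ⊕ p ⊕ q ⊕ z ⊜ a ⊕ b ⊕ p ⊕ q ⊕ x ⊕ z) ≋-refl _ _ _ _ _ _))
nonPath-•ʳ X (claw a x y z Z f) = claw a x y z (X • Z) (≋-trans (↷ f)
  (solve 9 (λ w a x y z e f g Z → w ⊕ a ⊕ x ⊕ y ⊕ z ⊕ e ⊕ f ⊕ g ⊕ Z ⊜ a ⊕ x ⊕ y ⊕ z ⊕ e ⊕ f ⊕ g ⊕ w ⊕ Z)
    ≋-refl _ _ _ _ _ _ _ _ _))

-- The solid X₀ seen from its vertex w.
record View {A : Set} (w : A) (X₀ : Piece A) : Set where
  constructor mkView
  field
    X       : Piece A
    N       : List A
    split   : X₀ ≋ pt w • X • spokes w N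
    avoid   : Avoids w X
    N⊆X     : N ⊆ verts X
    some    : ∃ (_∈ N)
    lift    : LiftAll X N
    nonPath : NonPath X

view-resp : ∀ {w : A} {X Y} → X ≋ Y → View w Y → View w X
view-resp e (mkView X N s a n m l o) = mkView X N (≋-trans e s) a n m l o

split-off : ∀ {w : A} {X₀ X N} → Distinct X₀ → X₀ ≋ pt w • X • spokes w N → Off w X
split-off {X = X} d e with distinct-resp e d
... | w∉ ∷ _ = off X (All≢⇒∉ (All.++⁻ˡ (verts X) w∉))

first-∈ : (p : List A) (b : A) {Z : Piece A} → b ∈ verts Z → first p b ∈ verts (rest p b) ++ verts Z
first-∈ []      b m = m
first-∈ (_ ∷ _) b m = here refl

nonempty-mid : (p : List A) {q : List A} {x : A} → 1 ≤ⁿ length (p ++ x ∷ q)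
nonempty-mid []      = s≤s z≤n
nonempty-mid (_ ∷ _) = s≤s z≤n

nonempty-reverse : (p : List A) → 1 ≤ⁿ length p → 1 ≤ⁿ length (reverse p)
nonempty-reverse p l = subst (1 ≤ⁿ_) (sym (List.length-reverse p)) l

∷-≋ : ∀ {X Y : Piece A} {u} → X ≋ Y → pt u • X ≋ pt u • Y
∷-≋ = •-cong ≋-refl

triangle-swap : (a b c : A) → ed a b • ed b c • ed c a ≋ ed a c • ed c b • ed b a
triangle-swap a b c = begin
  ed a b • ed b c • ed c a ≈⟨ •-cong (ed-sym a b) (•-cong (ed-sym b c) (ed-sym c a)) ⟩
  ed b a • ed c b • ed a c ≈⟨ solve 3 (λ a b c → a ⊕ b ⊕ c ⊜ c ⊕ b ⊕ a) ≋-refl _ _ _ ⟩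
  ed a c • ed c b • ed b a ∎

module _ {A : Set} (_≟_ : DecidableEquality A) where

  -- An interior vertex of an arc has degree 2, and dividing its two neighbours between `u` and `v`
  -- only lengthens the arc. `rebuild` says that the solid survives any change of the arc that keeps
  -- an interior vertex. The non-path left after the removal is found in `Y`.
  viewArc : ∀ {w a b : A} p q {Y} → (∀ r → 1 ≤ⁿ length r → Solid (arc a r b • Y)) →
    Distinct (arc a (p ++ w ∷ q) b • Y) → (Off w Y → w ≢ a × w ≢ b × Avoids w Y) →
    a ∈ verts Y → b ∈ verts Y → NonPath Y → View w (arc a (p ++ w ∷ q) b • Y)
  viewArc {w} {a} {b} p q {Y} rebuild d k a∈ b∈ np =
    mkView X (c₁ ∷ c₂ ∷ []) split avoid
      (λ { (here refl) → Perm.∈-resp-↭ (verts-↭ (solve 3 (λ r s y → r ⊕ s ⊕ y ⊜ s ⊕ r ⊕ y) ≋-refl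
                             (rest q b) (rest (reverse p) a) Y))
                           (∈-++⁺ʳ (verts (rest q b)) (first-∈ (reverse p) a {Y} a∈))
         ; (there (here refl)) → ∈-++⁺ʳ (verts (rest (reverse p) a)) (first-∈ q b {Y} b∈) })
      (c₁ , here refl)
      (lift₂ _≟_ (λ u _ _ → solid-resp (≋-sym (one u)) (rebuild (p ++ u ∷ q) (nonempty-mid p)))
                 (λ u v _ → inj₂ (inj₂ (solid-resp (≋-sym (two u v)) (rebuild (p ++ u ∷ v ∷ q) (nonempty-mid p))))))
      (nonPath-•ʳ (rest (reverse p) a) (nonPath-•ʳ (rest q b) np))
    where
    X = rest (reverse p) a • rest q b • Y
    c₁ = first (reverse p) a
    c₂ = first q b
    one : ∀ u → arc a (p ++ u ∷ q) b • Y ≋ pt u • X • ed u c₁ • ed u c₂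
    one u = begin
      arc a (p ++ u ∷ q) b • Y ≈⟨ •-cong (arc-mid a p u q b) ≋-refl ⟩
      (pt u • (rest (reverse p) a • rest q b) • ed u c₁ • ed u c₂) • Y
        ≈⟨ solve 6 (λ u r s e f y → (u ⊕ (r ⊕ s) ⊕ e ⊕ f) ⊕ y ⊜ u ⊕ (r ⊕ s ⊕ y) ⊕ e ⊕ f) ≋-refl _ _ _ _ _ _ ⟩
      pt u • X • ed u c₁ • ed u c₂ ∎
    two : ∀ u v → arc a (p ++ u ∷ v ∷ q) b • Y ≋ pt u • pt v • ed u v • X • ed u c₁ • ed v c₂
    two u v = begin
      arc a (p ++ u ∷ v ∷ q) b • Y ≈⟨ •-cong (arc-mid₂ a p u v q b) ≋-refl ⟩
      (pt u • pt v • ed u v • (rest (reverse p) a • rest q b) • ed u c₁ • ed v c₂) • Y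
        ≈⟨ solve 8 (λ u v g r s e f y → (u ⊕ v ⊕ g ⊕ (r ⊕ s) ⊕ e ⊕ f) ⊕ y ⊜ u ⊕ v ⊕ g ⊕ (r ⊕ s ⊕ y) ⊕ e ⊕ f)
             ≋-refl _ _ _ _ _ _ _ _ ⟩
      pt u • pt v • ed u v • X • ed u c₁ • ed v c₂ ∎
    split : arc a (p ++ w ∷ q) b • Y ≋ pt w • X • spokes w (c₁ ∷ c₂ ∷ [])
    split = ≋-trans (one w) (↷ ↷ ≡⇒≋ refl refl)
    avoid : Avoids w X
    avoid = case split-off {X = X} d split of λ { (o₁ , o₂ , o₃) → case k o₃ of λ
      { (w≢a , w≢b , av) → avoids-rest (reverse p) a o₁ w≢a , avoids-rest q b o₂ w≢b , av } }

distinct-edges : ∀ {u v : A} {X} (S T : Piece A) → verts S ≡ [] → verts T ≡ [] →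
  Distinct (pt u • pt v • X) → Distinct (pt u • pt v • ed u v • X • S • T)
distinct-edges {u = u} {v} {X} S T s t d rewrite s | t | List.++-identityʳ (verts X) = d

stamp′ : ∀ (x s t o : A) p q r {X} →
  X ≋ pt x • pt s • pt t • pt o • ed s t • ed t o • ed o s • arc x p s • arc x q t • arc x r o → Solid X
stamp′ x s t o p q r e = stamp x s t o (reverse p) (reverse q) (reverse r) (≋-trans e
  (↷ ↷ ↷ ↷ ↷ ↷ ↷ •-cong (arc-reverse x p s) (•-cong (arc-reverse x q t) (arc-reverse x r o))))

-- Branch vertices of trihedra, stamps and prisms

module _ {A : Set} (_≟_ : DecidableEquality A) where

  -- If `u` gets one neighbour alone, it becomes a new interior vertex of that path and `v` the new
  -- end. A shared neighbour spans a triangle with `u` and `v`, which makes a stamp with apex `b`.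
  -- Without `w`, the other end `b` still has degree 3.
  viewTrihedronEnd : ∀ (w b : A) p q r → 1 ≤ⁿ length p → 1 ≤ⁿ length q → 1 ≤ⁿ length r →
    Distinct (pt w • pt b • arc w p b • arc w q b • arc w r b) →
    View w (pt w • pt b • arc w p b • arc w q b • arc w r b)
  viewTrihedronEnd w b p q r lp lq lr d =
    mkView (Y p q r) (first p b ∷ first q b ∷ first r b ∷ []) split avoid
      (λ { (here refl) → there (∈-++⁺ˡ (first∈ p lp))
         ; (there (here refl)) → there (∈-++⁺ʳ (verts (rest p b)) (∈-++⁺ˡ (first∈ q lq)))
         ; (there (there (here refl))) → there (∈-++⁺ʳ (verts (rest p b)) (∈-++⁺ʳ (verts (rest q b)) (first∈ r lr))) })
      (_ , here refl)
      (lift₃ _≟_ (λ u _ _ → trihedron u b p q r lp lq lr (one p q r u))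
        (λ u v _ → only p q r lq lr u v)
        (λ u v _ → lifted-resp (Y-swap p q r) ≋-refl ≋-refl (only q p r lp lr u v))
        (λ u v _ → lifted-resp (Y-rot p q r) ≋-refl ≋-refl (only r p q lp lq u v))
        (λ u v _ → both p q r lp u v)
        (λ u v _ → lifted-resp (Y-swap p q r) (•-comm _ _) ≋-refl (both q p r lq u v))
        (λ u v _ → lifted-resp (Y-rot p q r) (•-comm _ _) (•-comm _ _) (both r p q lr u v)))
      (tips p q r lp lq lr)
    where
    Y : List A → List A → List A → Piece A
    Y p q r = pt b • rest p b • rest q b • rest r b
    Y-swap : ∀ p q r → Y p q r ≋ Y q p r
    Y-swap p q r = solve 4 (λ b p q r → b ⊕ p ⊕ q ⊕ r ⊜ b ⊕ q ⊕ p ⊕ r) ≋-refl _ _ _ _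
    Y-rot : ∀ p q r → Y p q r ≋ Y r p q
    Y-rot p q r = solve 4 (λ b p q r → b ⊕ p ⊕ q ⊕ r ⊜ b ⊕ r ⊕ p ⊕ q) ≋-refl _ _ _ _
    first∈ : ∀ p → 1 ≤ⁿ length p → first p b ∈ verts (rest p b)
    first∈ (_ ∷ _) _ = here refl
    one : ∀ p q r u → pt u • Y p q r • ed u (first p b) • ed u (first q b) • ed u (first r b) ≋
                      pt u • pt b • arc u p b • arc u q b • arc u r b
    one p q r u = begin
      pt u • Y p q r • ed u (first p b) • ed u (first q b) • ed u (first r b)
        ≈⟨ solve 8 (λ u b p q r e f g → u ⊕ (b ⊕ p ⊕ q ⊕ r) ⊕ e ⊕ f ⊕ g ⊜ u ⊕ b ⊕ (e ⊕ p) ⊕ (f ⊕ q) ⊕ g ⊕ r)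
             ≋-refl _ _ _ _ _ _ _ _ ⟩
      _ ≈⟨ ↷ ↷ •-cong (peel u p b) (•-cong (peel u q b) (peel u r b)) ⟨
      pt u • pt b • arc u p b • arc u q b • arc u r b ∎
    only : ∀ p q r → 1 ≤ⁿ length q → 1 ≤ⁿ length r → ∀ u v →
           Lifted (Y p q r) u v (ed u (first p b)) (ed v (first q b) • ed v (first r b))
    only p q r lq lr u v = inj₂ (inj₂ (trihedron v b (u ∷ p) q r (s≤s z≤n) lq lr (begin
      pt u • pt v • ed u v • Y p q r • ed u (first p b) • ed v (first q b) • ed v (first r b)
        ≈⟨ ↷ ↷ •-cong (ed-sym u v) ≋-refl ⟩
      _ ≈⟨ solve 10 (λ u v g b p q r e f h → u ⊕ v ⊕ g ⊕ (b ⊕ p ⊕ q ⊕ r) ⊕ e ⊕ f ⊕ h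
             ⊜ v ⊕ b ⊕ (g ⊕ u ⊕ e ⊕ p) ⊕ (f ⊕ q) ⊕ h ⊕ r) ≋-refl _ _ _ _ _ _ _ _ _ _ ⟩
      _ ≈⟨ ↷ ↷ •-cong (≋-trans (arc-∷ v u p b) (↷ ↷ peel u p b))
             (•-cong (peel v q b) (peel v r b)) ⟨
      pt v • pt b • arc v (u ∷ p) b • arc v q b • arc v r b ∎)))
    both : ∀ p q r → 1 ≤ⁿ length p → ∀ u v → Lifted (Y p q r) u v
           (ed u (first p b) • ed u (first q b)) (ed v (first p b) • ed v (first r b))
    both (c ∷ p) q r _ u v = inj₂ (inj₂ (stamp′ b u v c (reverse q) (reverse r) (reverse p) (begin
      pt u • pt v • ed u v • (pt b • (pt c • arc c p b) • rest q b • rest r b) •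
        (ed u c • ed u (first q b)) • ed v c • ed v (first r b)
        ≈⟨ ↷ ↷ ↷ ↷ •-cong (•-cong (ed-sym u c) ≋-refl) ≋-refl ⟩
      _ ≈⟨ solve 12 (λ u v g b c p q r e f h k → u ⊕ v ⊕ g ⊕ (b ⊕ (c ⊕ p) ⊕ q ⊕ r) ⊕ (e ⊕ f) ⊕ h ⊕ k
             ⊜ b ⊕ u ⊕ v ⊕ c ⊕ g ⊕ h ⊕ e ⊕ (f ⊕ q) ⊕ (k ⊕ r) ⊕ p) ≋-refl _ _ _ _ _ _ _ _ _ _ _ _ ⟩
      _ ≈⟨ ↷ ↷ ↷ ↷ ↷ ↷ ↷ •-cong (≋-trans (≋-sym (peel u q b)) (arc-reverse u q b))
               (•-cong (≋-trans (≋-sym (peel v r b)) (arc-reverse v r b)) (arc-reverse c p b))  ⟩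
      pt b • pt u • pt v • pt c • ed u v • ed v c • ed c u •
        arc b (reverse q) u • arc b (reverse r) v • arc b (reverse p) c ∎)))
    split : pt w • pt b • arc w p b • arc w q b • arc w r b ≋
            pt w • Y p q r • spokes w (first p b ∷ first q b ∷ first r b ∷ [])
    split = ≋-trans (≋-sym (one p q r w)) (↷ ↷ ≡⇒≋ refl refl)
    avoid : Avoids w (Y p q r)
    avoid = case split-off {X = Y p q r} d split of λ
      { (n , op , oq , or) → tt , avoids-rest p b op n , avoids-rest q b oq n , avoids-rest r b or n }
    -- Reading the path backwards from `b` exhibits the neighbour of `b` on it, one prong of the
    -- claw.
    tip : ∀ p → 1 ≤ⁿ length p → ∃[ x ] ∃[ Z ] rest p b ≋ pt x • ed b x • Z
    tip (x ∷ p) _ with reverse p | arc-reverse x p b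
    ... | p′ | e = last′ p′ (≋-trans e (peel b p′ x))
      where
      last′ : ∀ p′ → arc x p b ≋ ed b (first p′ x) • rest p′ x → ∃[ y ] ∃[ Z ] pt x • arc x p b ≋ pt y • ed b y • Z
      last′ []       e = x , ε , ∷-≋ e
      last′ (y ∷ p′) e = y , pt x • arc y p′ x , (begin
        pt x • arc x p b                  ≈⟨ ↷ e ⟩
        pt x • ed b y • pt y • arc y p′ x ≈⟨ solve 4 (λ x e y a → x ⊕ e ⊕ y ⊕ a ⊜ y ⊕ e ⊕ x ⊕ a) ≋-refl _ _ _ _ ⟩
        pt y • ed b y • pt x • arc y p′ x ∎)
    tips : ∀ p q r → 1 ≤ⁿ length p → 1 ≤ⁿ length q → 1 ≤ⁿ length r → NonPath (Y p q r)
    tips p q r lp lq lr with tip p lp | tip q lq | tip r lr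
    ... | x , Z₁ , e₁ | y , Z₂ , e₂ | z , Z₃ , e₃ = claw b x y z (Z₁ • Z₂ • Z₃)
      (≋-trans (↷ •-cong e₁ (•-cong e₂ e₃))
        (solve 10 (λ b x e Z₁ y f Z₂ z g Z₃ → b ⊕ (x ⊕ e ⊕ Z₁) ⊕ (y ⊕ f ⊕ Z₂) ⊕ z ⊕ g ⊕ Z₃
           ⊜ b ⊕ x ⊕ y ⊕ z ⊕ e ⊕ f ⊕ g ⊕ Z₁ ⊕ Z₂ ⊕ Z₃) ≋-refl _ _ _ _ _ _ _ _ _ _))

module _ {A : Set} (_≟_ : DecidableEquality A) where

  -- A lone neighbour of `u` again lengthens one path. A shared neighbour inside a path makes a
  -- second triangle with `u` and `v`, hence a prism; if it is a corner of the triangle, it becomes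
  -- the hub of a pyramid whose rim runs through `u`, `v` and the other two corners. The triangle
  -- survives the removal of the apex.
  viewStampApex : ∀ (w s t o : A) p q r →
    let X₀ = pt w • pt s • pt t • pt o • ed s t • ed t o • ed o s • arc w p s • arc w q t • arc w r o in
    Distinct X₀ → View w X₀
  viewStampApex w s t o p q r d =
    mkView (Y s t o p q r) (first p s ∷ first q t ∷ first r o ∷ []) split avoid
      (λ { (here refl) → first∈ s t o p q r
         ; (there (here refl)) → Perm.∈-resp-↭ (verts-↭ (≋-sym (Y-swap s t o p q r))) (first∈ t s o q p r)
         ; (there (there (here refl))) → Perm.∈-resp-↭ (verts-↭ (≋-sym (Y-rot s t o p q r))) (first∈ o s t r p q) })
      (_ , here refl)
      (lift₃ _≟_ (λ u _ _ → stamp′ u s t o p q r (one u))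
        (λ u v _ → only s t o p q r u v)
        (λ u v _ → lifted-resp (Y-swap s t o p q r) ≋-refl ≋-refl (only t s o q p r u v))
        (λ u v _ → lifted-resp (Y-rot s t o p q r) ≋-refl ≋-refl (only o s t r p q u v))
        (λ u v d → both s t o p q r u v d)
        (λ u v d → lifted-resp (Y-swap s t o p q r) (•-comm _ _) ≋-refl
                     (both t s o q p r u v (distinct-resp (∷-≋ (∷-≋ (Y-swap s t o p q r))) d)))
        (λ u v d → lifted-resp (Y-rot s t o p q r) (•-comm _ _) (•-comm _ _)
                     (both o s t r p q u v (distinct-resp (∷-≋ (∷-≋ (Y-rot s t o p q r))) d))))
      (ring s t [] (o ∷ []) (rest p s • rest q t • rest r o) (s≤s z≤n) (begin
        Y s t o p q r
          ≈⟨ •-cong (↷ ↷ ↷ ↷ •-cong (ed-sym t o) (ed-sym o s)) ≋-refl ⟩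
        _ ≈⟨ solve 9 (λ s t o e f g p q r → (s ⊕ t ⊕ o ⊕ e ⊕ f ⊕ g) ⊕ p ⊕ q ⊕ r
               ⊜ s ⊕ t ⊕ e ⊕ (g ⊕ o ⊕ f) ⊕ p ⊕ q ⊕ r) ≋-refl _ _ _ _ _ _ _ _ _ ⟩
        _ ≈⟨ ↷ ↷ ↷ •-cong (arc-∷ s o [] t) ≋-refl ⟨
        pt s • pt t • ed s t • arc s (o ∷ []) t • rest p s • rest q t • rest r o ∎))
    where
    Y : A → A → A → List A → List A → List A → Piece A
    Y s t o p q r = (pt s • pt t • pt o • ed s t • ed t o • ed o s) • rest p s • rest q t • rest r o
    Y-swap : ∀ s t o p q r → Y s t o p q r ≋ Y t s o q p r
    Y-swap s t o p q r = begin
      Y s t o p q r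
        ≈⟨ solve 9 (λ s t o e f g p q r → (s ⊕ t ⊕ o ⊕ e ⊕ f ⊕ g) ⊕ p ⊕ q ⊕ r
             ⊜ (t ⊕ s ⊕ o ⊕ (f ⊕ g ⊕ e)) ⊕ q ⊕ p ⊕ r) ≋-refl _ _ _ _ _ _ _ _ _ ⟩
      _ ≈⟨ •-cong (↷ ↷ ↷ triangle-swap t o s) ≋-refl ⟩
      Y t s o q p r ∎
    Y-rot : ∀ s t o p q r → Y s t o p q r ≋ Y o s t r p q
    Y-rot s t o p q r = solve 9 (λ s t o e f g p q r → (s ⊕ t ⊕ o ⊕ e ⊕ f ⊕ g) ⊕ p ⊕ q ⊕ r
      ⊜ (o ⊕ s ⊕ t ⊕ g ⊕ e ⊕ f) ⊕ r ⊕ p ⊕ q) ≋-refl _ _ _ _ _ _ _ _ _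
    first∈ : ∀ s t o p q r → first p s ∈ verts (Y s t o p q r)
    first∈ s t o []      q r = here refl
    first∈ s t o (c ∷ p) q r = there (there (there (here refl)))
    one : ∀ u → pt u • Y s t o p q r • ed u (first p s) • ed u (first q t) • ed u (first r o) ≋
                pt u • pt s • pt t • pt o • ed s t • ed t o • ed o s • arc u p s • arc u q t • arc u r o
    one u = begin
      pt u • Y s t o p q r • ed u (first p s) • ed u (first q t) • ed u (first r o)
        ≈⟨ solve 13 (λ u s t o e f g p q r h k l → u ⊕ ((s ⊕ t ⊕ o ⊕ e ⊕ f ⊕ g) ⊕ p ⊕ q ⊕ r) ⊕ h ⊕ k ⊕ l
             ⊜ u ⊕ s ⊕ t ⊕ o ⊕ e ⊕ f ⊕ g ⊕ (h ⊕ p) ⊕ (k ⊕ q) ⊕ l ⊕ r) ≋-refl _ _ _ _ _ _ _ _ _ _ _ _ _ ⟩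
      _ ≈⟨ ↷ ↷ ↷ ↷ ↷ ↷ ↷ •-cong (peel u p s) (•-cong (peel u q t) (peel u r o)) ⟨
      pt u • pt s • pt t • pt o • ed s t • ed t o • ed o s • arc u p s • arc u q t • arc u r o ∎
    only : ∀ s t o p q r u v → Lifted (Y s t o p q r) u v (ed u (first p s)) (ed v (first q t) • ed v (first r o))
    only s t o p q r u v = inj₂ (inj₂ (stamp′ v s t o (u ∷ p) q r (begin
      pt u • pt v • ed u v • Y s t o p q r • ed u (first p s) • ed v (first q t) • ed v (first r o)
        ≈⟨ ↷ ↷ •-cong (ed-sym u v) ≋-refl ⟩
      _ ≈⟨ solve 15 (λ u v m s t o e f g p q r h k l →
             u ⊕ v ⊕ m ⊕ ((s ⊕ t ⊕ o ⊕ e ⊕ f ⊕ g) ⊕ p ⊕ q ⊕ r) ⊕ h ⊕ k ⊕ l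
             ⊜ v ⊕ s ⊕ t ⊕ o ⊕ e ⊕ f ⊕ g ⊕ (m ⊕ u ⊕ h ⊕ p) ⊕ (k ⊕ q) ⊕ l ⊕ r)
             ≋-refl _ _ _ _ _ _ _ _ _ _ _ _ _ _ _ ⟩
      _ ≈⟨ ↷ ↷ ↷ ↷ ↷ ↷ ↷ •-cong (≋-trans (arc-∷ v u p s) (↷ ↷ peel u p s))
               (•-cong (peel v q t) (peel v r o)) ⟨
      pt v • pt s • pt t • pt o • ed s t • ed t o • ed o s • arc v (u ∷ p) s • arc v q t • arc v r o ∎)))
    both : ∀ s t o p q r u v → Distinct (pt u • pt v • Y s t o p q r) → Lifted (Y s t o p q r) u v
           (ed u (first p s) • ed u (first q t)) (ed v (first p s) • ed v (first r o))
    both s t o [] q r u v d = inj₂ (inj₂ (wheel₄ s u v o t {p = []} {q = r} {r = []} {s = reverse q}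
      (distinct-edges {X = Y s t o [] q r} (ed u s • ed u (first q t)) (ed v s • ed v (first r o)) refl refl d) (begin
      pt u • pt v • ed u v • Y s t o [] q r • (ed u s • ed u (first q t)) • ed v s • ed v (first r o)
        ≈⟨ ↷ ↷ ↷ •-cong (•-cong (↷ ↷ ↷ ↷ •-cong (ed-sym t o) (ed-sym o s)) ≋-refl)
             (•-cong (•-cong (ed-sym u s) ≋-refl) (•-cong (ed-sym v s) ≋-refl)) ⟩
      _ ≈⟨ solve 16 (λ u v m s t o e f g p q r h k l n →
             u ⊕ v ⊕ m ⊕ ((s ⊕ t ⊕ o ⊕ e ⊕ f ⊕ g) ⊕ p ⊕ q ⊕ r) ⊕ (h ⊕ k) ⊕ l ⊕ n
             ⊜ p ⊕ s ⊕ u ⊕ v ⊕ o ⊕ t ⊕ m ⊕ (n ⊕ r) ⊕ f ⊕ (k ⊕ q) ⊕ h ⊕ l ⊕ g ⊕ e)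
             ≋-refl _ _ _ _ _ _ _ _ _ _ _ _ _ _ _ _ ⟩
      _ ≈⟨ ↷ ↷ ↷ ↷ ↷ ↷ ↷ •-cong (≋-sym (peel v r o)) (↷ •-cong (≋-trans (≋-sym (peel u q t)) (arc-reverse u q t)) ≋-refl) ⟩
      _ ≈⟨ ≡⇒≋ refl refl ⟩
      pt s • pt u • pt v • pt o • pt t • ed u v • arc v r o • ed o t • arc t (reverse q) u •
        ed s u • ed s v • ed s o • ed s t ∎)))
    both s t o (c ∷ p) q r u v d = inj₂ (inj₂ (prism c u v s t o p q r (begin
      pt u • pt v • ed u v • Y s t o (c ∷ p) q r • (ed u c • ed u (first q t)) • ed v c • ed v (first r o)
        ≈⟨ ↷ ↷ ↷ ↷ •-cong (•-cong (ed-sym u c) ≋-refl) ≋-refl ⟩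
      _ ≈⟨ solve 17 (λ u v m s t o e f g c p q r h k l n →
             u ⊕ v ⊕ m ⊕ ((s ⊕ t ⊕ o ⊕ e ⊕ f ⊕ g) ⊕ (c ⊕ p) ⊕ q ⊕ r) ⊕ (h ⊕ k) ⊕ l ⊕ n
             ⊜ c ⊕ u ⊕ v ⊕ s ⊕ t ⊕ o ⊕ h ⊕ m ⊕ l ⊕ e ⊕ f ⊕ g ⊕ p ⊕ (k ⊕ q) ⊕ n ⊕ r)
             ≋-refl _ _ _ _ _ _ _ _ _ _ _ _ _ _ _ _ _ ⟩
      _ ≈⟨ ↷ ↷ ↷ ↷ ↷ ↷ ↷ ↷ ↷ ↷ ↷ ↷ ↷ •-cong (peel u q t) (peel v r o) ⟨
      pt c • pt u • pt v • pt s • pt t • pt o • ed c u • ed u v • ed v c • ed s t • ed t o • ed o s •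
        arc c p s • arc u q t • arc v r o ∎)))
    split : pt w • pt s • pt t • pt o • ed s t • ed t o • ed o s • arc w p s • arc w q t • arc w r o ≋
            pt w • Y s t o p q r • spokes w (first p s ∷ first q t ∷ first r o ∷ [])
    split = ≋-trans (≋-sym (one w)) (↷ ↷ ≡⇒≋ refl refl)
    avoid : Avoids w (Y s t o p q r)
    avoid = case split-off {X = Y s t o p q r} d split of λ
      { ((ns , nt , n₃ , _) , op , oq , or) →
        (tt , tt , tt , (ns , [] , nt) , (nt , [] , n₃) , n₃ , [] , ns) ,
        avoids-rest p s op ns , avoids-rest q t oq nt , avoids-rest r o or n₃ }

module _ {A : Set} (_≟_ : DecidableEquality A) where

  -- The neighbours are the corners `d`, `d′` and the vertex `f` towards the apex. A vertex that
  -- sees `f` and one corner gives a trihedron between that corner and `x`, unless the path joining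
  -- these two is an edge. This exception leads to pyramids and, when both paths are edges and `f`
  -- is shared, to a prism or a pyramid.
  viewStampCorner : ∀ (x w d d′ : A) r p q →
    let X₀ = pt x • pt w • pt d • pt d′ • ed w d • ed d d′ • ed d′ w • arc w r x • arc d p x • arc d′ q x in
    Distinct X₀ → View w X₀
  viewStampCorner x w d d′ r p q dist =
    mkView (Y d p d′ q) (d ∷ d′ ∷ f ∷ []) split avoid
      (λ { (here refl) → here refl ; (there (here refl)) → there (here refl)
         ; (there (there (here refl))) → first∈ r })
      (_ , here refl)
      (lift₃ _≟_ (λ u _ _ → stamp x u d d′ r p q (one u))
        (λ u v D → only-d d p d′ q u v D)
        (λ u v D → lifted-resp (Y-swap d p d′ q r) ≋-refl ≋-refl
                     (only-d d′ q d p u v (distinct-resp (∷-≋ (∷-≋ (Y-swap d p d′ q r))) D)))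
        (λ u v _ → only-f u v)
        (λ u v D → lifted-resp (Y-swap d p d′ q r) (•-comm _ _) ≋-refl
                     (both-d′ d′ q d p u v (distinct-resp (∷-≋ (∷-≋ (Y-swap d p d′ q r))) D)))
        (λ u v D → both-d′ d p d′ q u v D)
        (λ u v D → both-f p q r u v D))
      (ring d′ x q (d ∷ p) (rest r x) (nonempty-mid q) (begin
        Y d p d′ q
          ≈⟨ •-cong (↷ ↷ ed-sym d d′) ≋-refl ⟩
        _ ≈⟨ solve 7 (λ d e g x p q r → (d ⊕ e ⊕ g) ⊕ (x ⊕ p ⊕ q) ⊕ r
               ⊜ e ⊕ x ⊕ q ⊕ (g ⊕ d ⊕ p) ⊕ r) ≋-refl _ _ _ _ _ _ _ ⟩
        _ ≈⟨ ↷ ↷ ↷ •-cong (arc-∷ d′ d p x) ≋-refl ⟨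
        pt d′ • pt x • arc d′ q x • arc d′ (d ∷ p) x • rest r x ∎))
    where
    f = first r x
    Y′ : A → List A → A → List A → List A → Piece A
    Y′ d p d′ q r = (pt d • pt d′ • ed d d′) • (pt x • arc d p x • arc d′ q x) • rest r x
    Y : A → List A → A → List A → Piece A
    Y d p d′ q = Y′ d p d′ q r
    Y-swap : ∀ d p d′ q r → Y′ d p d′ q r ≋ Y′ d′ q d p r
    Y-swap d p d′ q r = ≋-trans (•-cong (↷ ↷ ed-sym d d′) ≋-refl)
      (solve 7 (λ d e g x p q r → (d ⊕ e ⊕ g) ⊕ (x ⊕ p ⊕ q) ⊕ r ⊜ (e ⊕ d ⊕ g) ⊕ (x ⊕ q ⊕ p) ⊕ r)
        ≋-refl _ _ _ _ _ _ _)
    first∈ : ∀ r → first r x ∈ d ∷ d′ ∷ (x ∷ p ++ q) ++ verts (rest r x)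
    first∈ []      = there (there (here refl))
    first∈ (c ∷ r) = there (there (∈-++⁺ʳ (x ∷ p ++ q) (here refl)))
    one : ∀ u → pt u • Y d p d′ q • ed u d • ed u d′ • ed u f ≋
          pt x • pt u • pt d • pt d′ • ed u d • ed d d′ • ed d′ u • arc u r x • arc d p x • arc d′ q x
    one u = begin
      pt u • Y d p d′ q • ed u d • ed u d′ • ed u f
        ≈⟨ ↷ ↷ ↷ •-cong (ed-sym u d′) ≋-refl ⟩
      _ ≈⟨ solve 11 (λ u d e g x p q r h k l → u ⊕ ((d ⊕ e ⊕ g) ⊕ (x ⊕ p ⊕ q) ⊕ r) ⊕ h ⊕ k ⊕ l
             ⊜ x ⊕ u ⊕ d ⊕ e ⊕ h ⊕ g ⊕ k ⊕ (l ⊕ r) ⊕ p ⊕ q) ≋-refl _ _ _ _ _ _ _ _ _ _ _ ⟩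
      _ ≈⟨ ↷ ↷ ↷ ↷ ↷ ↷ ↷ •-cong (peel u r x) ≋-refl ⟨
      pt x • pt u • pt d • pt d′ • ed u d • ed d d′ • ed d′ u • arc u r x • arc d p x • arc d′ q x ∎
    second : ∀ d p d′ q r v → 1 ≤ⁿ length q → Solid (pt v • Y′ d p d′ q r • ed v d′ • ed v (first r x))
    second d p d′ q r v l = trihedron d′ x (d ∷ p) q (v ∷ r) (s≤s z≤n) l (s≤s z≤n) (begin
      pt v • Y′ d p d′ q r • ed v d′ • ed v (first r x)
        ≈⟨ ↷ •-cong (•-cong (↷ ↷ ed-sym d d′) ≋-refl) (•-cong (ed-sym v d′) ≋-refl) ⟩
      _ ≈⟨ solve 10 (λ v d e g x p q r h k → v ⊕ ((d ⊕ e ⊕ g) ⊕ (x ⊕ p ⊕ q) ⊕ r) ⊕ h ⊕ k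
             ⊜ e ⊕ x ⊕ (g ⊕ d ⊕ p) ⊕ q ⊕ h ⊕ v ⊕ k ⊕ r) ≋-refl _ _ _ _ _ _ _ _ _ _ ⟩
      _ ≈⟨ ↷ ↷ •-cong (arc-∷ d′ d p x) (↷ ≋-trans (arc-∷ d′ v r x) (↷ ↷ peel v r x)) ⟨
      pt d′ • pt x • arc d′ (d ∷ p) x • arc d′ q x • arc d′ (v ∷ r) x ∎)
    only-d : ∀ d p d′ q u v → Distinct (pt u • pt v • Y d p d′ q) →
             Lifted (Y d p d′ q) u v (ed u d) (ed v d′ • ed v f)
    only-d d p d′ (c ∷ q) u v _ = inj₂ (inj₁ (second d p d′ (c ∷ q) r v (s≤s z≤n)))
    only-d d p d′ [] u v D = inj₂ (inj₂ (wheel₃ d′ d x v {p = p} {q = reverse r} {r = u ∷ []}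
      (distinct-edges {X = Y d p d′ []} (ed u d) (ed v d′ • ed v f) refl refl D) (begin
      pt u • pt v • ed u v • Y d p d′ [] • ed u d • ed v d′ • ed v f
        ≈⟨ ↷ ↷ •-cong (ed-sym u v) (•-cong (•-cong (↷ ↷ ed-sym d d′) ≋-refl)
             (↷ •-cong (ed-sym v d′) ≋-refl)) ⟩
      _ ≈⟨ solve 13 (λ u v m d e g x p q r h k l → u ⊕ v ⊕ m ⊕ ((d ⊕ e ⊕ g) ⊕ (x ⊕ p ⊕ q) ⊕ r) ⊕ h ⊕ k ⊕ l
             ⊜ e ⊕ d ⊕ x ⊕ v ⊕ p ⊕ (l ⊕ r) ⊕ (m ⊕ u ⊕ h) ⊕ g ⊕ q ⊕ k) ≋-refl _ _ _ _ _ _ _ _ _ _ _ _ _ ⟩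
      _ ≈⟨ ↷ ↷ ↷ ↷ ↷ •-cong (≋-trans (≋-sym (peel v r x)) (arc-reverse v r x))
             (•-cong (≋-sym (arc-∷ v u [] d)) ≋-refl) ⟩
      pt d′ • pt d • pt x • pt v • arc d p x • arc x (reverse r) v • arc v (u ∷ []) d • ed d′ d • ed d′ x • ed d′ v ∎)))
    only-f : ∀ u v → Lifted (Y d p d′ q) u v (ed u f) (ed v d • ed v d′)
    only-f u v = inj₂ (inj₂ (stamp x v d d′ (u ∷ r) p q (begin
      pt u • pt v • ed u v • Y d p d′ q • ed u f • ed v d • ed v d′
        ≈⟨ ↷ ↷ •-cong (ed-sym u v) (↷ ↷ ↷ ed-sym v d′) ⟩
      _ ≈⟨ solve 13 (λ u v m d e g x p q r h k l → u ⊕ v ⊕ m ⊕ ((d ⊕ e ⊕ g) ⊕ (x ⊕ p ⊕ q) ⊕ r) ⊕ h ⊕ k ⊕ l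
             ⊜ x ⊕ v ⊕ d ⊕ e ⊕ k ⊕ g ⊕ l ⊕ (m ⊕ u ⊕ h ⊕ r) ⊕ p ⊕ q) ≋-refl _ _ _ _ _ _ _ _ _ _ _ _ _ ⟩
      _ ≈⟨ ↷ ↷ ↷ ↷ ↷ ↷ ↷ •-cong
             (≋-trans (arc-∷ v u r x) (↷ ↷ peel u r x)) ≋-refl ⟨
      pt x • pt v • pt d • pt d′ • ed v d • ed d d′ • ed d′ v • arc v (u ∷ r) x • arc d p x • arc d′ q x ∎)))
    both-d′ : ∀ d p d′ q u v → Distinct (pt u • pt v • Y d p d′ q) →
              Lifted (Y d p d′ q) u v (ed u d • ed u d′) (ed v d′ • ed v f)
    both-d′ d p d′ (c ∷ q) u v _ = inj₂ (inj₁ (second d p d′ (c ∷ q) r v (s≤s z≤n)))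
    both-d′ d p d′ [] u v D = inj₂ (inj₂ (wheel₄ d′ d x v u {p = p} {q = reverse r} {r = []} {s = []}
      (distinct-edges {X = Y d p d′ []} (ed u d • ed u d′) (ed v d′ • ed v f) refl refl D) (begin
      pt u • pt v • ed u v • Y d p d′ [] • (ed u d • ed u d′) • ed v d′ • ed v f
        ≈⟨ ↷ ↷ •-cong (ed-sym u v) (•-cong (•-cong (↷ ↷ ed-sym d d′) ≋-refl)
             (•-cong (↷ ed-sym u d′) (•-cong (ed-sym v d′) ≋-refl))) ⟩
      _ ≈⟨ solve 14 (λ u v m d e g x p q r h i k l → u ⊕ v ⊕ m ⊕ ((d ⊕ e ⊕ g) ⊕ (x ⊕ p ⊕ q) ⊕ r) ⊕ (h ⊕ i) ⊕ k ⊕ l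
             ⊜ e ⊕ d ⊕ x ⊕ v ⊕ u ⊕ p ⊕ (l ⊕ r) ⊕ m ⊕ h ⊕ g ⊕ q ⊕ k ⊕ i) ≋-refl _ _ _ _ _ _ _ _ _ _ _ _ _ _ ⟩
      _ ≈⟨ ↷ ↷ ↷ ↷ ↷ ↷ •-cong (≋-trans (≋-sym (peel v r x)) (arc-reverse v r x)) ≋-refl ⟩
      pt d′ • pt d • pt x • pt v • pt u • arc d p x • arc x (reverse r) v • ed v u • ed u d •
        ed d′ d • ed d′ x • ed d′ v • ed d′ u ∎)))
    both-f : ∀ p q r u v → Distinct (pt u • pt v • Y′ d p d′ q r) →
             Lifted (Y′ d p d′ q r) u v (ed u d • ed u (first r x)) (ed v d′ • ed v (first r x))
    both-f p (c ∷ q) r u v _ = inj₂ (inj₁ (second d p d′ (c ∷ q) r v (s≤s z≤n)))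
    both-f (c ∷ p) [] r u v _ = inj₁ (solid-resp (↷ •-cong (Y-swap d (c ∷ p) d′ [] r) ≋-refl)
                                  (second d′ [] d (c ∷ p) r u (s≤s z≤n)))
    both-f [] [] (c ∷ r) u v _ = inj₂ (inj₂ (prism x d d′ c u v (reverse r) [] [] (begin
      pt u • pt v • ed u v • Y′ d [] d′ [] (c ∷ r) • (ed u d • ed u c) • ed v d′ • ed v c
        ≈⟨ ↷ ↷ ↷ •-cong (↷ •-cong (↷ •-cong (ed-sym d x) ≋-refl)
             (↷ arc-reverse c r x)) (•-cong (•-cong (ed-sym u d) (ed-sym u c)) (•-cong (ed-sym v d′) ≋-refl)) ⟩
      _ ≈⟨ solve 15 (λ u v m d e g x p q c r h i k l →
             u ⊕ v ⊕ m ⊕ ((d ⊕ e ⊕ g) ⊕ (x ⊕ p ⊕ q) ⊕ (c ⊕ r)) ⊕ (h ⊕ i) ⊕ k ⊕ l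
             ⊜ x ⊕ d ⊕ e ⊕ c ⊕ u ⊕ v ⊕ p ⊕ g ⊕ q ⊕ i ⊕ m ⊕ l ⊕ r ⊕ h ⊕ k) ≋-refl _ _ _ _ _ _ _ _ _ _ _ _ _ _ _ ⟩
      pt x • pt d • pt d′ • pt c • pt u • pt v • ed x d • ed d d′ • ed d′ x • ed c u • ed u v • ed v c •
        arc x (reverse r) c • ed d u • ed d′ v ∎)))
    both-f [] [] [] u v D = inj₂ (inj₂ (wheel₄ x d d′ v u {p = []} {q = []} {r = []} {s = []}
      (distinct-edges {X = Y′ d [] d′ [] []} (ed u d • ed u x) (ed v d′ • ed v x) refl refl D) (begin
      pt u • pt v • ed u v • Y′ d [] d′ [] [] • (ed u d • ed u x) • ed v d′ • ed v x
        ≈⟨ ↷ ↷ •-cong (ed-sym u v) (•-cong (↷ •-cong (↷ •-cong (ed-sym d x) (ed-sym d′ x))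
             ≋-refl) (•-cong (↷ ed-sym u x) (•-cong (ed-sym v d′) (ed-sym v x)))) ⟩
      _ ≈⟨ solve 14 (λ u v m d e g x p q r h i k l → u ⊕ v ⊕ m ⊕ ((d ⊕ e ⊕ g) ⊕ (x ⊕ p ⊕ q) ⊕ r) ⊕ (h ⊕ i) ⊕ k ⊕ l
             ⊜ r ⊕ x ⊕ d ⊕ e ⊕ v ⊕ u ⊕ g ⊕ k ⊕ m ⊕ h ⊕ p ⊕ q ⊕ l ⊕ i) ≋-refl _ _ _ _ _ _ _ _ _ _ _ _ _ _ ⟩
      _ ≈⟨ ≡⇒≋ refl refl ⟩
      pt x • pt d • pt d′ • pt v • pt u • ed d d′ • ed d′ v • ed v u • ed u d • ed x d • ed x d′ • ed x v • ed x u ∎)))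
    split : pt x • pt w • pt d • pt d′ • ed w d • ed d d′ • ed d′ w • arc w r x • arc d p x • arc d′ q x ≋
            pt w • Y d p d′ q • spokes w (d ∷ d′ ∷ f ∷ [])
    split = ≋-trans (≋-sym (one w)) (↷ ↷ ≡⇒≋ refl refl)
    avoid : Avoids w (Y d p d′ q)
    avoid = case split-off {X = Y d p d′ q} dist split of λ
      { ((nd , nd′ , _) , (nx , np , nq) , or) →
        (tt , tt , nd , [] , nd′) , (tt , (nd , np , nx) , (nd′ , nq , nx)) , avoids-rest r x or nx }

module _ {A : Set} (_≟_ : DecidableEquality A) where

  -- A vertex that sees `f` and one of `d`, `d′` is already enough: that corner is the apex of a
  -- stamp on the opposite triangle. The only other distribution gives `f` alone to one of the two,
  -- which lengthens a path of the prism.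
  viewPrismCorner : ∀ (w d d′ y e e′ : A) r p q →
    let X₀ = pt w • pt d • pt d′ • pt y • pt e • pt e′ • ed w d • ed d d′ • ed d′ w •
             ed y e • ed e e′ • ed e′ y • arc w r y • arc d p e • arc d′ q e′ in
    Distinct X₀ → View w X₀
  viewPrismCorner w d d′ y e e′ r p q dist =
    mkView (Y d p e d′ q e′) (d ∷ d′ ∷ f ∷ []) split avoid
      (λ { (here refl) → here refl ; (there (here refl)) → there (here refl)
         ; (there (there (here refl))) → first∈ r })
      (_ , here refl)
      (lift₃ _≟_ (λ u _ _ → prism u d d′ y e e′ r p q (one u))
        (λ u v _ → inj₂ (inj₁ (second d p e d′ q e′ v)))
        (λ u v _ → inj₂ (inj₁ (second′ v)))
        (λ u v _ → only-f u v)
        (λ u v _ → inj₂ (inj₁ (second′ v)))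
        (λ u v _ → inj₂ (inj₁ (second d p e d′ q e′ v)))
        (λ u v _ → inj₂ (inj₁ (second d p e d′ q e′ v))))
      (ring d′ e (d ∷ p) (q ++ e′ ∷ []) (pt y • ed y e • ed e′ y • rest r y) (s≤s z≤n) (begin
        Y d p e d′ q e′
          ≈⟨ •-cong (↷ ↷ ed-sym d d′) (•-cong (↷ ↷ ↷ ↷ •-cong (ed-sym e e′) ≋-refl) ≋-refl) ⟩
        _ ≈⟨ solve 12 (λ d d′ g y e e′ h k l p q r → (d ⊕ d′ ⊕ g) ⊕ (y ⊕ e ⊕ e′ ⊕ h ⊕ k ⊕ l ⊕ p ⊕ q) ⊕ r
               ⊜ d′ ⊕ e ⊕ (g ⊕ d ⊕ p) ⊕ (q ⊕ e′ ⊕ k) ⊕ y ⊕ h ⊕ l ⊕ r) ≋-refl _ _ _ _ _ _ _ _ _ _ _ _ ⟩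
        _ ≈⟨ ↷ ↷ •-cong (arc-∷ d′ d p e) (•-cong (arc-∷ʳ d′ q e′ e) ≋-refl) ⟨
        pt d′ • pt e • arc d′ (d ∷ p) e • arc d′ (q ++ e′ ∷ []) e • pt y • ed y e • ed e′ y • rest r y ∎))
    where
    f = first r y
    Y : A → List A → A → A → List A → A → Piece A
    Y d p e d′ q e′ =
      (pt d • pt d′ • ed d d′) • (pt y • pt e • pt e′ • ed y e • ed e e′ • ed e′ y • arc d p e • arc d′ q e′) • rest r y
    Y-swap : Y d p e d′ q e′ ≋ Y d′ q e′ d p e
    Y-swap = begin
      Y d p e d′ q e′
        ≈⟨ •-cong (↷ ↷ ed-sym d d′)
             (•-cong (↷ ↷ ↷ •-cong (ed-sym y e) (•-cong (ed-sym e e′) (•-cong (ed-sym e′ y) ≋-refl))) ≋-refl) ⟩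
      _ ≈⟨ solve 12 (λ d d′ g y e e′ h k l p q r → (d ⊕ d′ ⊕ g) ⊕ (y ⊕ e ⊕ e′ ⊕ h ⊕ k ⊕ l ⊕ p ⊕ q) ⊕ r
             ⊜ (d′ ⊕ d ⊕ g) ⊕ (y ⊕ e′ ⊕ e ⊕ l ⊕ k ⊕ h ⊕ q ⊕ p) ⊕ r) ≋-refl _ _ _ _ _ _ _ _ _ _ _ _ ⟩
      Y d′ q e′ d p e ∎
    first∈ : ∀ r → first r y ∈ d ∷ d′ ∷ (y ∷ e ∷ e′ ∷ p ++ q) ++ verts (rest r y)
    first∈ []      = there (there (here refl))
    first∈ (c ∷ r) = there (there (∈-++⁺ʳ (y ∷ e ∷ e′ ∷ p ++ q) (here refl)))
    one : ∀ u → pt u • Y d p e d′ q e′ • ed u d • ed u d′ • ed u f ≋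
          pt u • pt d • pt d′ • pt y • pt e • pt e′ • ed u d • ed d d′ • ed d′ u •
          ed y e • ed e e′ • ed e′ y • arc u r y • arc d p e • arc d′ q e′
    one u = begin
      pt u • Y d p e d′ q e′ • ed u d • ed u d′ • ed u f
        ≈⟨ ↷ ↷ ↷ •-cong (ed-sym u d′) ≋-refl ⟩
      _ ≈⟨ solve 16 (λ u d d′ g y e e′ h k l p q r i j m →
             u ⊕ ((d ⊕ d′ ⊕ g) ⊕ (y ⊕ e ⊕ e′ ⊕ h ⊕ k ⊕ l ⊕ p ⊕ q) ⊕ r) ⊕ i ⊕ j ⊕ m
             ⊜ u ⊕ d ⊕ d′ ⊕ y ⊕ e ⊕ e′ ⊕ i ⊕ g ⊕ j ⊕ h ⊕ k ⊕ l ⊕ (m ⊕ r) ⊕ p ⊕ q)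
             ≋-refl _ _ _ _ _ _ _ _ _ _ _ _ _ _ _ _ ⟩
      _ ≈⟨ ↷ ↷ ↷ ↷ ↷ ↷ ↷ ↷ ↷ ↷ ↷ ↷ •-cong (peel u r y) ≋-refl ⟨
      pt u • pt d • pt d′ • pt y • pt e • pt e′ • ed u d • ed d d′ • ed d′ u •
        ed y e • ed e e′ • ed e′ y • arc u r y • arc d p e • arc d′ q e′ ∎
    second : ∀ d p e d′ q e′ v → Solid (pt v • Y d p e d′ q e′ • ed v d′ • ed v f)
    second d p e d′ q e′ v = stamp′ d′ y e e′ (v ∷ r) (d ∷ p) q (begin
      pt v • Y d p e d′ q e′ • ed v d′ • ed v f
        ≈⟨ ↷ •-cong (•-cong (↷ ↷ ed-sym d d′) ≋-refl) (•-cong (ed-sym v d′) ≋-refl) ⟩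
      _ ≈⟨ solve 15 (λ v d d′ g y e e′ h k l p q r i j →
             v ⊕ ((d ⊕ d′ ⊕ g) ⊕ (y ⊕ e ⊕ e′ ⊕ h ⊕ k ⊕ l ⊕ p ⊕ q) ⊕ r) ⊕ i ⊕ j
             ⊜ d′ ⊕ y ⊕ e ⊕ e′ ⊕ h ⊕ k ⊕ l ⊕ (i ⊕ v ⊕ j ⊕ r) ⊕ (g ⊕ d ⊕ p) ⊕ q)
             ≋-refl _ _ _ _ _ _ _ _ _ _ _ _ _ _ _ ⟩
      _ ≈⟨ ↷ ↷ ↷ ↷ ↷ ↷ ↷ •-cong
             (≋-trans (arc-∷ d′ v r y) (↷ ↷ peel v r y))
             (•-cong (arc-∷ d′ d p e) ≋-refl) ⟨
      pt d′ • pt y • pt e • pt e′ • ed y e • ed e e′ • ed e′ y •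
        arc d′ (v ∷ r) y • arc d′ (d ∷ p) e • arc d′ q e′ ∎)
    second′ : ∀ v → Solid (pt v • Y d p e d′ q e′ • ed v d • ed v f)
    second′ v = solid-resp (↷ •-cong Y-swap ≋-refl) (second d′ q e′ d p e v)
    only-f : ∀ u v → Lifted (Y d p e d′ q e′) u v (ed u f) (ed v d • ed v d′)
    only-f u v = inj₂ (inj₂ (prism v d d′ y e e′ (u ∷ r) p q (begin
      pt u • pt v • ed u v • Y d p e d′ q e′ • ed u f • ed v d • ed v d′
        ≈⟨ ↷ ↷ •-cong (ed-sym u v) (↷ ↷ ↷ ed-sym v d′) ⟩
      _ ≈⟨ solve 18 (λ u v n d d′ g y e e′ h k l p q r m i j →
             u ⊕ v ⊕ n ⊕ ((d ⊕ d′ ⊕ g) ⊕ (y ⊕ e ⊕ e′ ⊕ h ⊕ k ⊕ l ⊕ p ⊕ q) ⊕ r) ⊕ m ⊕ i ⊕ j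
             ⊜ v ⊕ d ⊕ d′ ⊕ y ⊕ e ⊕ e′ ⊕ i ⊕ g ⊕ j ⊕ h ⊕ k ⊕ l ⊕ (n ⊕ u ⊕ m ⊕ r) ⊕ p ⊕ q)
             ≋-refl _ _ _ _ _ _ _ _ _ _ _ _ _ _ _ _ _ _ ⟩
      _ ≈⟨ ↷ ↷ ↷ ↷ ↷ ↷ ↷ ↷ ↷ ↷ ↷ ↷ •-cong (≋-trans (arc-∷ v u r y) (↷ ↷ peel u r y)) ≋-refl ⟨
      pt v • pt d • pt d′ • pt y • pt e • pt e′ • ed v d • ed d d′ • ed d′ v •
        ed y e • ed e e′ • ed e′ y • arc v (u ∷ r) y • arc d p e • arc d′ q e′ ∎)))
    split : pt w • pt d • pt d′ • pt y • pt e • pt e′ • ed w d • ed d d′ • ed d′ w •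
            ed y e • ed e e′ • ed e′ y • arc w r y • arc d p e • arc d′ q e′ ≋
            pt w • Y d p e d′ q e′ • spokes w (d ∷ d′ ∷ f ∷ [])
    split = ≋-trans (≋-sym (one w)) (↷ ↷ ≡⇒≋ refl refl)
    avoid : Avoids w (Y d p e d′ q e′)
    avoid = case split-off {X = Y d p e d′ q e′} dist split of λ
      { ((nd , nd′ , _) , (ny , ne , ne′ , _ , _ , _ , np , nq) , or) →
        (tt , tt , nd , [] , nd′) ,
        (tt , tt , tt , (ny , [] , ne) , (ne , [] , ne′) , (ne′ , [] , ny) , (nd , np , ne) , nd′ , nq , ne′) ,
        avoids-rest r y or ny }

-- One vertex, or two adjacent vertices, attached to a cycle

verts-cyc : (c : List A) → verts (cyc c) ≡ c
verts-cyc []      = refl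
verts-cyc (_ ∷ _) = refl

rotate-to : ∀ {x : A} {c} → x ∈ c → ∃[ r ] cyc c ≋ cyc (x ∷ r)
rotate-to m with ∈-∃++ m
... | p , q , refl = q ++ p , cyc-rotate p _ q

cyc-↭ : {c c′ : List A} → cyc c ≋ cyc c′ → c ↭ c′
cyc-↭ {c = c} {c′} e =
  ↭-trans (↭-reflexive (sym (verts-cyc c))) (↭-trans (verts-↭ e) (↭-reflexive (verts-cyc c′)))

spokes-extract : ∀ (z : A) {y ns} → y ∈ ns → Unique ns →
  ∃[ ms ] ns ↭ y ∷ ms × Unique (y ∷ ms) × spokes z ns ≋ ed z y • spokes z ms
spokes-extract z {y} m u with ∈-∃++ m
... | p , q , refl = p ++ q , Perm.shift y p q , unique-resp (Perm.shift y p q) u ,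
  ≋-trans (spokes-cong z (Perm.∈-resp-↭ (Perm.shift y p q)) (Perm.∈-resp-↭ (↭-sym (Perm.shift y p q)))) (≡⇒≋ refl refl)

-- As both arcs have interior vertices, they serve as two paths of a trihedron, and the detour
-- through `z` is the third.
chord-solid : ∀ {d e z : A} {p q} → 1 ≤ⁿ length p → 1 ≤ⁿ length q →
  Solid (pt z • (pt d • pt e • arc d p e • arc e q d) • ed z d • ed z e)
chord-solid {d = d} {e} {z} {p} {q} lp lq =
  trihedron d e p (reverse q) (z ∷ []) lp (nonempty-reverse q lq) (s≤s z≤n) (begin
    pt z • (pt d • pt e • arc d p e • arc e q d) • ed z d • ed z e
      ≈⟨ ↷ •-cong (↷ ↷ ↷ arc-reverse e q d) (•-cong (ed-sym z d) ≋-refl) ⟩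
    _ ≈⟨ solve 7 (λ z d e p q f g → z ⊕ (d ⊕ e ⊕ p ⊕ q) ⊕ f ⊕ g ⊜ d ⊕ e ⊕ p ⊕ q ⊕ f ⊕ z ⊕ g) ≋-refl _ _ _ _ _ _ _ ⟩
    _ ≈⟨ ↷ ↷ ↷ ↷ arc-∷ d z [] e ⟨
    pt d • pt e • arc d p e • arc d (reverse q) e • arc d (z ∷ []) e ∎)

-- A vertex off a cycle gives a pyramid or a trihedron unless its neighbours there form the empty
-- set, a point or an edge. In the last case the cycle is presented as cut open at that edge.
data Attached {A : Set} (z : A) (c : List A) : List A → Set where
  solid  : ∀ {ns} → Solid (pt z • cyc c • spokes z ns) → Attached z c ns
  none   : Attached z c []
  single : ∀ {d} → Attached z c (d ∷ [])
  pair   : ∀ {d d′} p → 1 ≤ⁿ length p → cyc c ≋ pt d • pt d′ • ed d d′ • arc d′ p d → Attached z c (d ∷ d′ ∷ [])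

attach : ∀ (z : A) c ns → 3 ≤ⁿ length c → Unique ns → ns ⊆ c → Attached z c ns
attach z c []      l u s = none
attach z c (d ∷ []) l u s = single
attach z c ns@(_ ∷ _ ∷ _ ∷ _) l u s = solid (wheel z c u s (s≤s (s≤s (s≤s z≤n))) ≋-refl)
attach z c (d ∷ d′ ∷ []) l ((d≢d′ ∷ _) ∷ _) s with rotate-to (s (here refl))
... | r , e with Perm.∈-resp-↭ (cyc-↭ e) (s (there (here refl)))
...   | here refl = contradiction refl d≢d′
...   | there m with ∈-∃++ m
...     | p , q , refl = go p q (ℕ.≤-trans l (ℕ.≤-reflexive (Perm.↭-length (cyc-↭ e))))
  (≋-trans e (≋-trans (↷ arc-++ d p d′ q d)
    (solve 4 (λ d p d′ q → d ⊕ p ⊕ d′ ⊕ q ⊜ d ⊕ d′ ⊕ p ⊕ q) ≋-refl _ _ _ _)))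
  where
  go : ∀ p q → 3 ≤ⁿ length (d ∷ p ++ d′ ∷ q) → cyc c ≋ pt d • pt d′ • arc d p d′ • arc d′ q d →
       Attached z c (d ∷ d′ ∷ [])
  go [] (x ∷ q) _ e = pair (x ∷ q) (s≤s z≤n) e
  go [] [] (s≤s (s≤s ())) e
  go p@(_ ∷ _) [] _ e = pair (reverse p) (nonempty-reverse p (s≤s z≤n)) (≋-trans e
    (↷ ↷ ≋-trans (•-comm _ _) (•-cong (ed-sym d′ d) (arc-reverse d p d′))))
  go (_ ∷ _) (_ ∷ _) _ e = solid (solid-resp (↷ •-cong e (≡⇒≋ refl refl)) (chord-solid (s≤s z≤n) (s≤s z≤n)))

private
  -- Two adjacent vertices u and v off the cycle C, where u is joined to the ends d and e of an edge of C.
  pair-one-split : ∀ {u v d e y : A} {p q C} → C ≋ pt d • pt e • ed d e • arc e p y • pt y • arc y q d →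
    Solid (pt u • pt v • ed u v • C • (ed u d • ed u e) • ed v y)
  pair-one-split {u = u} {v} {d} {e} {y} {p} {q} {C} c = stamp′ y u d e (v ∷ []) q (reverse p) (begin
    pt u • pt v • ed u v • C • (ed u d • ed u e) • ed v y
      ≈⟨ ↷ ↷ •-cong (ed-sym u v) (•-cong c (•-cong (↷ ed-sym u e) (ed-sym v y))) ⟩
    _ ≈⟨ solve 12 (λ u v m d e f p y q g h k → u ⊕ v ⊕ m ⊕ (d ⊕ e ⊕ f ⊕ p ⊕ y ⊕ q) ⊕ (g ⊕ h) ⊕ k
           ⊜ y ⊕ u ⊕ d ⊕ e ⊕ g ⊕ f ⊕ h ⊕ (k ⊕ v ⊕ m) ⊕ q ⊕ p) ≋-refl _ _ _ _ _ _ _ _ _ _ _ _ ⟩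
    _ ≈⟨ ↷ ↷ ↷ ↷ ↷ ↷ ↷ •-cong (≋-sym (arc-∷ y v [] u))
           (↷ arc-reverse e p y) ⟩
    pt y • pt u • pt d • pt e • ed u d • ed d e • ed e u • arc y (v ∷ []) u • arc y q d • arc y (reverse p) e ∎)

  -- If the neighbours `y`, `y′` of `v` are not consecutive on the cycle, `v` alone gives a
  -- trihedron. If they are, their edge either meets the edge `d e`, and the common end is the hub
  -- of a pyramid, or is disjoint from it, and the triangles at `u` and `v` are those of a prism.
  pair-two : ∀ {u v d e y y′ : A} p q {C} → C ≋ pt d • pt e • ed d e • arc e p y • pt y • arc y q d →
    y′ ∈ d ∷ e ∷ p ++ q → Distinct (pt u • pt v • C) →
    Solid (pt v • C • ed v y • ed v y′) ⊎
    Solid (pt u • pt v • ed u v • C • (ed u d • ed u e) • ed v y • ed v y′)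
  pair-two {u = u} {v} {d} {e} {y} p [] {C} c (here refl) D = inj₂ (wheel₄ d e y v u {p = p} {q = []} {r = []} {s = []}
    (distinct-edges {X = C} (ed u d • ed u e) (ed v y • ed v d) refl refl D) (begin
      pt u • pt v • ed u v • C • (ed u d • ed u e) • ed v y • ed v d
        ≈⟨ ↷ ↷ •-cong (ed-sym u v) (•-cong (≋-trans c (↷ ↷ ↷ ↷ ↷ ed-sym y d))
             (•-cong (•-cong (ed-sym u d) ≋-refl) (•-cong (ed-sym v y) (ed-sym v d)))) ⟩
      _ ≈⟨ solve 13 (λ u v m d e f p y q g h k l → u ⊕ v ⊕ m ⊕ (d ⊕ e ⊕ f ⊕ p ⊕ y ⊕ q) ⊕ (g ⊕ h) ⊕ k ⊕ l
             ⊜ d ⊕ e ⊕ y ⊕ v ⊕ u ⊕ p ⊕ k ⊕ m ⊕ h ⊕ f ⊕ q ⊕ l ⊕ g) ≋-refl _ _ _ _ _ _ _ _ _ _ _ _ _ ⟩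
      pt d • pt e • pt y • pt v • pt u • arc e p y • ed y v • ed v u • ed u e • ed d e • ed d y • ed d v • ed d u ∎))
  pair-two {u = u} {v} {d} {e} {y} p (x ∷ q) {C} c (here refl) D = inj₁ (solid-resp
    (↷ •-cong (begin
      C ≈⟨ c ⟩
      _ ≈⟨ solve 6 (λ d e f p y q → d ⊕ e ⊕ f ⊕ p ⊕ y ⊕ q ⊜ y ⊕ d ⊕ q ⊕ f ⊕ e ⊕ p) ≋-refl _ _ _ _ _ _ ⟩
      _ ≈⟨ ↷ ↷ ↷ arc-∷ d e p y ⟨
      pt y • pt d • arc y (x ∷ q) d • arc d (e ∷ p) y ∎) ≋-refl)
    (chord-solid (s≤s z≤n) (s≤s z≤n)))
  pair-two {u = u} {v} {d} {e} {y} [] q {C} c (there (here refl)) D =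
    inj₂ (wheel₄ e d y v u {p = reverse q} {q = []} {r = []} {s = []}
    (distinct-edges {X = C} (ed u d • ed u e) (ed v y • ed v e) refl refl D) (begin
      pt u • pt v • ed u v • C • (ed u d • ed u e) • ed v y • ed v e
        ≈⟨ ↷ ↷ •-cong (ed-sym u v) (•-cong (≋-trans c (↷ ↷ •-cong (ed-sym d e) (↷ ↷ arc-reverse y q d)))
             (•-cong (↷ ed-sym u e) (•-cong (ed-sym v y) (ed-sym v e)))) ⟩
      _ ≈⟨ solve 13 (λ u v m d e f p y q g h k l → u ⊕ v ⊕ m ⊕ (d ⊕ e ⊕ f ⊕ p ⊕ y ⊕ q) ⊕ (g ⊕ h) ⊕ k ⊕ l
             ⊜ e ⊕ d ⊕ y ⊕ v ⊕ u ⊕ q ⊕ k ⊕ m ⊕ g ⊕ f ⊕ p ⊕ l ⊕ h) ≋-refl _ _ _ _ _ _ _ _ _ _ _ _ _ ⟩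
      pt e • pt d • pt y • pt v • pt u • arc d (reverse q) y • ed y v • ed v u • ed u d •
        ed e d • ed e y • ed e v • ed e u ∎))
  pair-two {u = u} {v} {d} {e} {y} (x ∷ p) q {C} c (there (here refl)) D = inj₁ (solid-resp
    (↷ •-cong (begin
      C ≈⟨ c ⟩
      _ ≈⟨ solve 6 (λ d e f p y q → d ⊕ e ⊕ f ⊕ p ⊕ y ⊕ q ⊜ y ⊕ e ⊕ (q ⊕ d ⊕ f) ⊕ p) ≋-refl _ _ _ _ _ _ ⟩
      _ ≈⟨ ↷ ↷ •-cong (arc-∷ʳ y q d e) ≋-refl ⟨
      pt y • pt e • arc y (q ++ d ∷ []) e • arc e (x ∷ p) y ∎) ≋-refl)
    (chord-solid (nonempty-mid q) (s≤s z≤n)))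
  pair-two {u = u} {v} {d} {e} {y} {y′} p q {C} c (there (there m)) D with ∈-++⁻ p m
  ... | inj₁ m′ with ∈-∃++ m′
  ...   | r , x ∷ s , refl = inj₁ (solid-resp
    (↷ •-cong (begin
      C ≈⟨ ≋-trans c (↷ ↷ ↷ •-cong (arc-++ e r y′ (x ∷ s) y) ≋-refl) ⟩
      _ ≈⟨ solve 8 (λ d e f r z s y q → d ⊕ e ⊕ f ⊕ (r ⊕ z ⊕ s) ⊕ y ⊕ q ⊜ y ⊕ z ⊕ (q ⊕ d ⊕ f ⊕ e ⊕ r) ⊕ s)
             ≋-refl _ _ _ _ _ _ _ _ ⟩
      _ ≈⟨ ↷ ↷ •-cong (≋-trans (arc-++ y q d (e ∷ r) y′) (↷ ↷ arc-∷ d e r y′)) ≋-refl ⟨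
      pt y • pt y′ • arc y (q ++ d ∷ e ∷ r) y′ • arc y′ (x ∷ s) y ∎) ≋-refl)
    (chord-solid (nonempty-mid q) (s≤s z≤n)))
  ...   | r , [] , refl = inj₂ (prism u d e v y y′ [] (reverse q) r (begin
      pt u • pt v • ed u v • C • (ed u d • ed u e) • ed v y • ed v y′
        ≈⟨ ↷ ↷ ↷ •-cong (≋-trans c (↷ ↷ ↷ •-cong
             (≋-trans (arc-++ e r y′ [] y) (↷ ↷ ed-sym y′ y)) (↷ arc-reverse y q d)))
             (•-cong (↷ ed-sym u e) (↷ ed-sym v y′)) ⟩
      _ ≈⟨ solve 15 (λ u v m d e f r z s y q g h k l → u ⊕ v ⊕ m ⊕ (d ⊕ e ⊕ f ⊕ (r ⊕ z ⊕ s) ⊕ y ⊕ q) ⊕ (g ⊕ h) ⊕ k ⊕ l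
             ⊜ u ⊕ d ⊕ e ⊕ v ⊕ y ⊕ z ⊕ g ⊕ f ⊕ h ⊕ k ⊕ s ⊕ l ⊕ m ⊕ q ⊕ r) ≋-refl _ _ _ _ _ _ _ _ _ _ _ _ _ _ _ ⟩
      pt u • pt d • pt e • pt v • pt y • pt y′ • ed u d • ed d e • ed e u • ed v y • ed y y′ • ed y′ v •
        ed u v • arc d (reverse q) y • arc e r y′ ∎))
  pair-two {u = u} {v} {d} {e} {y} {y′} p q {C} c (there (there m)) D | inj₂ m′ with ∈-∃++ m′
  ...   | x ∷ r , s , refl = inj₁ (solid-resp
    (↷ •-cong (begin
      C ≈⟨ ≋-trans c (↷ ↷ ↷ ↷ ↷ arc-++ y (x ∷ r) y′ s d) ⟩
      _ ≈⟨ solve 8 (λ d e f p y r z s → d ⊕ e ⊕ f ⊕ p ⊕ y ⊕ r ⊕ z ⊕ s ⊜ y ⊕ z ⊕ r ⊕ s ⊕ d ⊕ f ⊕ e ⊕ p)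
             ≋-refl _ _ _ _ _ _ _ _ ⟩
      _ ≈⟨ ↷ ↷ ↷ ≋-trans (arc-++ y′ s d (e ∷ p) y) (↷ ↷ arc-∷ d e p y) ⟨
      pt y • pt y′ • arc y (x ∷ r) y′ • arc y′ (s ++ d ∷ e ∷ p) y ∎) ≋-refl)
    (chord-solid (s≤s z≤n) (nonempty-mid s)))
  ...   | [] , s , refl = inj₂ (prism u d e v y′ y [] (reverse s) p (begin
      pt u • pt v • ed u v • C • (ed u d • ed u e) • ed v y • ed v y′
        ≈⟨ ↷ ↷ ↷ •-cong (≋-trans c (↷ ↷ ↷ ↷ ↷ ≋-trans (arc-++ y [] y′ s d) (•-cong (ed-sym y y′) (↷ arc-reverse y′ s d))))
             (•-cong (↷ ed-sym u e) (•-cong (ed-sym v y) ≋-refl)) ⟩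
      _ ≈⟨ solve 15 (λ u v m d e f p y r z s g h k l → u ⊕ v ⊕ m ⊕ (d ⊕ e ⊕ f ⊕ p ⊕ y ⊕ r ⊕ z ⊕ s) ⊕ (g ⊕ h) ⊕ k ⊕ l
             ⊜ u ⊕ d ⊕ e ⊕ v ⊕ z ⊕ y ⊕ g ⊕ f ⊕ h ⊕ l ⊕ r ⊕ k ⊕ m ⊕ s ⊕ p) ≋-refl _ _ _ _ _ _ _ _ _ _ _ _ _ _ _ ⟩
      pt u • pt d • pt e • pt v • pt y′ • pt y • ed u d • ed d e • ed e u • ed v y′ • ed y′ y • ed y v •
        ed u v • arc d (reverse s) y′ • arc e p y ∎))

-- The vertex `v` has a neighbour `y` off the edge `d e`, and the number of its further neighbours
-- decides: none gives a stamp, one is `pair-two`, and with two or more `v` is the hub of a pyramid.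
split-pair : ∀ {u v d e y : A} {p B C} → C ≋ pt d • pt e • ed d e • arc e p d → Unique B → B ⊆ d ∷ e ∷ p →
  y ∈ B → y ∈ p → Distinct (pt u • pt v • C) →
  Solid (pt v • C • spokes v B) ⊎ Solid (pt u • pt v • ed u v • C • (ed u d • ed u e) • spokes v B)
split-pair {u = u} {v} {d} {e} {y} {p} {B} {C} c uB B⊆ y∈B y∈p D with spokes-extract v y∈B uB | ∈-∃++ y∈p
... | ms , perm , (y∉ ∷ um) , sp | p₁ , p₂ , refl = go ms perm y∉ sp
  where
  c′ : C ≋ pt d • pt e • ed d e • arc e p₁ y • pt y • arc y p₂ d
  c′ = ≋-trans c (↷ ↷ ↷ arc-++ e p₁ y p₂ d)
  go : ∀ ms → B ↭ y ∷ ms → All (y ≢_) ms → spokes v B ≋ ed v y • spokes v ms →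
       Solid (pt v • C • spokes v B) ⊎ Solid (pt u • pt v • ed u v • C • (ed u d • ed u e) • spokes v B)
  go [] _ _ sp = inj₂ (solid-resp (↷ ↷ ↷ ↷ ↷ ≋-trans sp (≡⇒≋ refl refl))
                   (pair-one-split c′))
  go (y′ ∷ []) perm (y≢y′ ∷ _) sp with B⊆ (Perm.∈-resp-↭ (↭-sym perm) (there (here refl)))
  ... | m = [ (λ s → inj₁ (solid-resp (↷ ↷ ≋-trans sp (≡⇒≋ refl refl)) s))
            , (λ s → inj₂ (solid-resp (↷ ↷ ↷ ↷ ↷ ≋-trans sp (≡⇒≋ refl refl)) s)) ]′
            (pair-two p₁ p₂ c′ (drop-y m) D)
    where
    drop-y : y′ ∈ d ∷ e ∷ p₁ ++ y ∷ p₂ → y′ ∈ d ∷ e ∷ p₁ ++ p₂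
    drop-y (here eq)          = here eq
    drop-y (there (here eq))  = there (here eq)
    drop-y (there (there m)) with ∈-++⁻ p₁ m
    ... | inj₁ m′          = there (there (∈-++⁺ˡ m′))
    ... | inj₂ (here refl) = contradiction refl y≢y′
    ... | inj₂ (there m′)  = there (there (∈-++⁺ʳ p₁ m′))
  go (_ ∷ _ ∷ _) perm _ _ = inj₁ (wheel v (d ∷ e ∷ p₁ ++ y ∷ p₂) uB B⊆
    (ℕ.≤-trans (s≤s (s≤s (s≤s z≤n))) (ℕ.≤-reflexive (sym (Perm.↭-length perm))))
    (↷ •-cong (begin
      C ≈⟨ c ⟩
      _ ≈⟨ solve 4 (λ d e f p → d ⊕ e ⊕ f ⊕ p ⊜ d ⊕ f ⊕ e ⊕ p) ≋-refl _ _ _ _ ⟩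
      _ ≈⟨ ↷ arc-∷ d e (p₁ ++ y ∷ p₂) d ⟨
      cyc (d ∷ e ∷ p₁ ++ y ∷ p₂) ∎) ≋-refl))

-- By `attach`, `v` alone succeeds unless its neighbours form an edge of the cycle. Then `d` lies
-- off this edge, and `pair-one-split` applies with `u` and `v` exchanged.
split-single : ∀ {u v d : A} {r B} → Unique B → B ⊆ r → 2 ≤ⁿ length B → Distinct (cyc (d ∷ r)) →
  Solid (pt v • cyc (d ∷ r) • spokes v B) ⊎ Solid (pt u • pt v • ed u v • cyc (d ∷ r) • ed u d • spokes v B)
split-single {u = u} {v} {d} {r} {B} uB B⊆ l (d∉ ∷ _)
  with attach v (d ∷ r) B (s≤s (ℕ.≤-trans l (unique-⊆-length uB B⊆))) uB (there ∘ B⊆)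
split-single uB B⊆ l _ | solid s = inj₁ s
split-single uB B⊆ () _ | none
split-single uB B⊆ (s≤s ()) _ | single
split-single {u = u} {v} {d} {r} uB B⊆ l (d∉ ∷ _) | pair {e} {e′} p _ c
  with Perm.∈-resp-↭ (verts-↭ c) (here refl)
... | here refl                 = contradiction (B⊆ (here refl)) (All≢⇒∉ d∉)
... | there (here refl)         = contradiction (B⊆ (there (here refl))) (All≢⇒∉ d∉)
... | there (there m) with ∈-∃++ m
...   | p₁ , p₂ , refl = inj₂ (solid-resp (begin
    pt u • pt v • ed u v • cyc (d ∷ r) • ed u d • spokes v (e ∷ e′ ∷ [])
      ≈⟨ ↷ ↷ •-cong (ed-sym u v) ≋-refl ⟩
    _ ≈⟨ solve 6 (λ u v f c g s → u ⊕ v ⊕ f ⊕ c ⊕ g ⊕ s ⊜ v ⊕ u ⊕ f ⊕ c ⊕ s ⊕ g) ≋-refl _ _ _ _ _ _ ⟩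
    _ ≈⟨ ↷ ↷ ↷ ↷ ≡⇒≋ refl refl ⟩
    pt v • pt u • ed v u • cyc (d ∷ r) • (ed v e • ed v e′) • ed u d ∎)
  (pair-one-split (≋-trans c (↷ ↷ ↷ arc-++ e′ p₁ d p₂ e))))

avoids-cyc : ∀ {w : A} c → w ∉ c → Avoids w (cyc c)
avoids-cyc []       n = tt
avoids-cyc (x ∷ xs) n = tt , n ∘ here , ∉⇒All≢ (n ∘ there) , n ∘ here

nonPath-cyc : ∀ (c : List A) → 3 ≤ⁿ length c → NonPath (cyc c)
nonPath-cyc (x ∷ y ∷ c) (s≤s (s≤s l)) = ring x y [] (reverse c) ε (nonempty-reverse c l) (begin
  pt x • arc x (y ∷ c) x       ≈⟨ ↷ arc-∷ x y c x ⟩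
  pt x • ed x y • pt y • arc y c x
    ≈⟨ solve 4 (λ x e y c → x ⊕ e ⊕ y ⊕ c ⊜ x ⊕ y ⊕ e ⊕ c) ≋-refl _ _ _ _ ⟩
  pt x • pt y • ed x y • arc y c x ≈⟨ ↷ ↷ ↷ ≋-trans (arc-reverse y c x) (≡⇒≋ (sym (List.++-identityʳ _)) (sym (List.++-identityʳ _))) ⟩
  pt x • pt y • ed x y • arc x (reverse c) y • ε ∎)

chain : List A → Piece A
chain []          = ε
chain (x ∷ [])    = pt x
chain (x ∷ y ∷ r) = pt x • ed x y • chain (y ∷ r)

chain-arc : ∀ (x : A) p y r → chain (x ∷ p ++ y ∷ r) ≋ pt x • arc x p y • chain (y ∷ r)
chain-arc x []      y r = ≋-refl
chain-arc x (z ∷ p) y r = begin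
  pt x • ed x z • chain (z ∷ p ++ y ∷ r)                ≈⟨ ↷ ↷ chain-arc z p y r ⟩
  pt x • ed x z • pt z • arc z p y • chain (y ∷ r)      ≈⟨ ≡⇒≋ refl refl ⟩
  pt x • (ed x z • pt z • arc z p y) • chain (y ∷ r)    ≈⟨ ↷ •-cong (arc-∷ x z p y) ≋-refl ⟨
  pt x • arc x (z ∷ p) y • chain (y ∷ r) ∎

chain-suffix : ∀ (p : List A) y r → ∃[ Y ] chain (p ++ y ∷ r) ≋ chain (y ∷ r) • Y
chain-suffix []          y r = ε , ≋-trans (≡⇒≋ refl refl) (•-comm ε _)
chain-suffix (x ∷ [])    y r = pt x • ed x y ,
  solve 3 (λ x e c → x ⊕ e ⊕ c ⊜ c ⊕ x ⊕ e) ≋-refl _ _ _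
chain-suffix (x ∷ z ∷ p) y r with chain-suffix (z ∷ p) y r
... | Y , e = pt x • ed x z • Y , ≋-trans (↷ ↷ e)
  (solve 4 (λ x e c y → x ⊕ e ⊕ c ⊕ y ⊜ c ⊕ x ⊕ e ⊕ y) ≋-refl _ _ _ _)

chain-head : ∀ (y : A) s → ∃[ Z ] chain (y ∷ s) ≋ pt y • Z
chain-head y []      = ε , ≡⇒≋ refl refl
chain-head y (_ ∷ _) = _ , ≋-refl

chain-two-ordered : ∀ p (y : A) r y′ s → ∃[ Y ] chain (p ++ y ∷ r ++ y′ ∷ s) ≋ pt y • pt y′ • arc y r y′ • Y
chain-two-ordered p y r y′ s with chain-suffix p y (r ++ y′ ∷ s) | chain-head y′ s
... | Y , e | Z , f = Z • Y , ≋-trans e (≋-trans (•-cong (≋-trans (chain-arc y r y′ s)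
    (↷ ↷ f)) ≋-refl)
  (solve 5 (λ y a z Z Y → (y ⊕ a ⊕ z ⊕ Z) ⊕ Y ⊜ y ⊕ z ⊕ a ⊕ Z ⊕ Y) ≋-refl _ _ _ _ _))

-- Supplies the ring in a pyramid that has lost a rim vertex: the hub closes the stretch of the
-- remaining rim between two spoke ends.
chain-two : ∀ {y y′ : A} {c} → y ∈ c → y′ ∈ c → y ≢ y′ →
  ∃[ p ] ∃[ Y ] chain c ≋ pt y • pt y′ • arc y p y′ • Y
chain-two {y = y} {y′} m m′ y≢y′ with ∈-∃++ m
... | p , q , refl with ∈-++⁻ p m′
...   | inj₂ (here refl) = contradiction refl y≢y′
...   | inj₂ (there m″) with ∈-∃++ m″
...     | r , s , refl = r , chain-two-ordered p y r y′ s
chain-two {y = y} {y′} m m′ y≢y′ | p , q , refl | inj₁ m″ with ∈-∃++ m″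
...   | r , s , refl with chain-two-ordered r y′ s y q
...     | Y , e rewrite List.++-assoc r (y′ ∷ s) (y ∷ q) = reverse s , Y , ≋-trans e
  (≋-trans (↷ ↷ •-cong (arc-reverse y′ s y) ≋-refl)
    (solve 4 (λ y z a Y → y ⊕ z ⊕ a ⊕ Y ⊜ z ⊕ y ⊕ a ⊕ Y) ≋-refl _ _ _ _))

module _ {A : Set} (_≟_ : DecidableEquality A) where
  open DecMembership _≟_ using (_∈?_)

  ∃-fresh : ∀ (ns ms : List A) → Unique ns → suc (length ms) ≤ⁿ length ns → ∃[ y ] y ∈ ns × y ∉ ms
  ∃-fresh ns ms u l with All.all? (_∈? ms) ns
  ... | yes a = contradiction (ℕ.≤-trans l (unique-⊆-length u (All.lookup a))) (ℕ.<-irrefl refl)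
  ... | no ¬a = find (All.¬All⇒Any¬ (_∈? ms) ns ¬a)

  -- Splitting the hub leaves two adjacent vertices off the rim that together see at least three rim
  -- vertices. If `u` sees none of them, or a single one that `v` sees too, then `v` inherits all
  -- spokes; the other cases in which `u` alone fails are `split-single` and `split-pair`.
  viewHub : ∀ (w : A) c ns → 3 ≤ⁿ length c → Unique ns → ns ⊆ c → 3 ≤ⁿ length ns →
    Distinct (pt w • cyc c • spokes w ns) → View w (pt w • cyc c • spokes w ns)
  viewHub w c ns lc un ns⊆ ln d = mkView (cyc c) ns ≋-refl (avoids-cyc c w∉)
    (λ m → subst (_ ∈_) (sym (verts-cyc c)) (ns⊆ m)) some lift (nonPath-cyc c lc)
    where
    w∉ : w ∉ c
    w∉ m = All≢⇒∉ (AllPairs.head d) (∈-++⁺ˡ (subst (w ∈_) (sym (verts-cyc c)) m))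
    some : ∃ (_∈ ns)
    some = proj₁ f , proj₁ (proj₂ f) where f = ∃-fresh ns [] un (ℕ.≤-trans (s≤s z≤n) ln)
    lift : LiftAll (cyc c) ns
    lift {u} {v} {S} {T} D uS uT S⊆ T⊆ cover with attach u c S lc uS (ns⊆ ∘ S⊆)
    ... | solid s = inj₁ s
    ... | none = inj₂ (inj₁ (wheel v c uT (ns⊆ ∘ T⊆)
                   (ℕ.≤-trans ln (unique-⊆-length un (λ m → case cover m of λ { (inj₂ t) → t }))) ≋-refl))
    ... | single {y} with y ∈? T
    ...   | yes y∈ = inj₂ (inj₁ (wheel v c uT (ns⊆ ∘ T⊆)
                   (ℕ.≤-trans ln (unique-⊆-length un (λ m → case cover m of λ { (inj₂ t) → t ; (inj₁ (here refl)) → y∈ }))) ≋-refl))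
    ...   | no y∉ with rotate-to (ns⊆ (S⊆ (here refl)))
    ...     | r , e with split-single {u = u} {v} {y} {r} {T} uT T⊆r
                         (ℕ.≤-pred (ℕ.≤-trans ln (unique-⊆-length {ys = y ∷ T} un
                           (λ m → case cover m of λ { (inj₂ t) → there t ; (inj₁ (here refl)) → here refl }))))
                         (distinct-resp e (AllPairs.tail (AllPairs.tail D)))
      where
      T⊆r : T ⊆ r
      T⊆r m with Perm.∈-resp-↭ (cyc-↭ e) (ns⊆ (T⊆ m))
      ... | here refl = contradiction m y∉
      ... | there m′  = m′
    ...       | inj₁ s = inj₂ (inj₁ (solid-resp (↷ •-cong e ≋-refl) s))
    ...       | inj₂ s = inj₂ (inj₂ (solid-resp (↷ ↷ ↷ •-cong e (•-cong (≡⇒≋ refl refl) ≋-refl)) s))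
    lift {u} {v} {S} {T} D uS uT S⊆ T⊆ cover | pair {y} {y′} p _ e
      -- Among at least three spoke ends one lies off the pair seen by `u`; it must be seen by `v`.
      with ∃-fresh ns (y ∷ y′ ∷ []) un ln
    ... | z , z∈ , z∉ with cover z∈
    ...   | inj₁ m = contradiction m z∉
    ...   | inj₂ z∈T with split-pair {u = u} e uT (λ m → on-cycle (ns⊆ (T⊆ m))) z∈T (after-pair (on-cycle (ns⊆ z∈))) D
      where
      on-cycle : ∀ {x} → x ∈ c → x ∈ y ∷ y′ ∷ p
      on-cycle m = Perm.∈-resp-↭ (verts-↭ e) (subst (_ ∈_) (sym (verts-cyc c)) m)
      after-pair : z ∈ y ∷ y′ ∷ p → z ∈ p
      after-pair (here eq)         = contradiction (here eq) z∉
      after-pair (there (here eq)) = contradiction (there (here eq)) z∉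
      after-pair (there (there m)) = m
    ...     | inj₁ s = inj₂ (inj₁ s)
    ...     | inj₂ s = inj₂ (inj₂ (solid-resp (↷ ↷ ↷ ↷ •-cong (≡⇒≋ refl refl) ≋-refl) s))

-- Rim vertices of pyramids

module _ {A : Set} where

  rim : A → List A → A → Piece A
  rim a m b = pt a • arc a m b • pt b

  rim-≋ : ∀ (u a : A) m b → cyc (u ∷ a ∷ m ∷ʳ b) ≋ pt u • rim a m b • ed u a • ed u b
  rim-≋ u a m b = begin
    pt u • arc u (a ∷ m ∷ʳ b) u
      ≈⟨ ↷ ≋-trans (arc-∷ u a (m ∷ʳ b) u) (↷ ↷ ≋-trans (arc-∷ʳ a m b u) (↷ ↷ ed-sym b u)) ⟩
    pt u • ed u a • pt a • arc a m b • pt b • ed u b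
      ≈⟨ solve 6 (λ u e a m b f → u ⊕ e ⊕ a ⊕ m ⊕ b ⊕ f ⊜ u ⊕ (a ⊕ m ⊕ b) ⊕ e ⊕ f) ≋-refl _ _ _ _ _ _ ⟩
    pt u • rim a m b • ed u a • ed u b ∎

  rim-≋₂ : ∀ (u v a : A) m b → cyc (u ∷ v ∷ a ∷ m ∷ʳ b) ≋ pt u • pt v • ed u v • rim a m b • ed v a • ed u b
  rim-≋₂ u v a m b = begin
    pt u • arc u (v ∷ a ∷ m ∷ʳ b) u
      ≈⟨ ↷ ≋-trans (arc-∷ u v (a ∷ m ∷ʳ b) u) (↷ ↷ ≋-trans (arc-∷ v a (m ∷ʳ b) u) (↷ ↷ ≋-trans (arc-∷ʳ a m b u) (↷ ↷ ed-sym b u))) ⟩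
    pt u • ed u v • pt v • ed v a • pt a • arc a m b • pt b • ed u b
      ≈⟨ solve 8 (λ u g v e a m b f → u ⊕ g ⊕ v ⊕ e ⊕ a ⊕ m ⊕ b ⊕ f ⊜ u ⊕ v ⊕ g ⊕ (a ⊕ m ⊕ b) ⊕ e ⊕ f)
           ≋-refl _ _ _ _ _ _ _ _ ⟩
    pt u • pt v • ed u v • rim a m b • ed v a • ed u b ∎

  rim-chain : ∀ (a : A) m b → rim a m b ≋ chain (a ∷ m ∷ʳ b)
  rim-chain a m b = ≋-sym (chain-arc a m b [])

  -- `X` is a pyramid that has lost a rim vertex: the hub `z`, the rim path from `a` to `b` and the
  -- spokes to it. The lost vertex was adjacent to `a`, `b` and possibly `z`.
  module Rim (z a : A) (m : List A) (b : A) (ns : List A) (un : Unique ns) (ns⊆ : ns ⊆ a ∷ m ∷ʳ b) where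

    X : Piece A
    X = pt z • rim a m b • spokes z ns

    avoid : ∀ {w} → Off w X → Avoids w X
    avoid {w} (w≢z , (w≢a , w∉m , w≢b) , _) = tt , (tt , (w≢a , w∉m , w≢b) , tt) , w≢z , All.tabulate (λ n → All.lookup w∉P (ns⊆ n))
      where
      w∉P : All (w ≢_) (a ∷ m ∷ʳ b)
      w∉P = w≢a ∷ All.++⁺ w∉m (w≢b ∷ [])

    nonPath : 2 ≤ⁿ length ns → NonPath X
    nonPath l = go ns un ns⊆ l
      where
      go : ∀ ns → Unique ns → ns ⊆ a ∷ m ∷ʳ b → 2 ≤ⁿ length ns → NonPath (pt z • rim a m b • spokes z ns)
      go (_ ∷ []) _ _ (s≤s ())
      go (y ∷ y′ ∷ ns) ((y≢y′ ∷ _) ∷ _) s _ with chain-two (s (here refl)) (s (there (here refl))) y≢y′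
      ... | p , Y , e = ring y y′ p (z ∷ []) (Y • spokes z ns) (nonempty-mid p) (begin
        pt z • rim a m b • spokes z (y ∷ y′ ∷ ns)
          ≈⟨ ↷ •-cong (≋-trans (rim-chain a m b) e) (≡⇒≋ refl refl) ⟩
        pt z • (pt y • pt y′ • arc y p y′ • Y) • ed z y • ed z y′ • spokes z ns
          ≈⟨ ↷ ↷ •-cong (ed-sym z y) ≋-refl ⟩
        _ ≈⟨ solve 8 (λ z y y′ p Y e f s → z ⊕ (y ⊕ y′ ⊕ p ⊕ Y) ⊕ e ⊕ f ⊕ s ⊜ y ⊕ y′ ⊕ p ⊕ (e ⊕ z ⊕ f) ⊕ Y ⊕ s)
               ≋-refl _ _ _ _ _ _ _ _ ⟩
        _ ≈⟨ ↷ ↷ ↷ •-cong (arc-∷ y z [] y′) ≋-refl ⟨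
        pt y • pt y′ • arc y p y′ • arc y (z ∷ []) y′ • Y • spokes z ns ∎)

    wheel-one : ∀ u → 3 ≤ⁿ length ns → Solid (pt u • X • ed u a • ed u b)
    wheel-one u l = wheel z (u ∷ a ∷ m ∷ʳ b) un (there ∘ ns⊆) l (begin
      pt u • X • ed u a • ed u b
        ≈⟨ solve 6 (λ u z r s e f → u ⊕ (z ⊕ r ⊕ s) ⊕ e ⊕ f ⊜ z ⊕ (u ⊕ r ⊕ e ⊕ f) ⊕ s) ≋-refl _ _ _ _ _ _ ⟩
      _ ≈⟨ ↷ •-cong (rim-≋ u a m b) ≋-refl ⟨
      pt z • cyc (u ∷ a ∷ m ∷ʳ b) • spokes z ns ∎)

    wheel-two : ∀ u v → 3 ≤ⁿ length ns → Solid (pt u • pt v • ed u v • X • ed u a • ed v b)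
    wheel-two u v l = wheel z (v ∷ u ∷ a ∷ m ∷ʳ b) un (there ∘ there ∘ ns⊆) l (begin
      pt u • pt v • ed u v • X • ed u a • ed v b
        ≈⟨ ↷ ↷ •-cong (ed-sym u v) ≋-refl ⟩
      _ ≈⟨ solve 8 (λ u v g z r s e f → u ⊕ v ⊕ g ⊕ (z ⊕ r ⊕ s) ⊕ e ⊕ f ⊜ z ⊕ (v ⊕ u ⊕ g ⊕ r ⊕ e ⊕ f) ⊕ s)
             ≋-refl _ _ _ _ _ _ _ _ ⟩
      _ ≈⟨ ↷ •-cong (rim-≋₂ v u a m b) ≋-refl ⟨
      pt z • cyc (v ∷ u ∷ a ∷ m ∷ʳ b) • spokes z ns ∎)

    rim-∉ : ∀ {u v} → Distinct (pt u • pt v • X) → u ∉ ns × v ∉ ns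
    rim-∉ ((_ ∷ u∉) ∷ v∉ ∷ _) =
      (λ n → All≢⇒∉ u∉ (in-X (ns⊆ n))) , (λ n → All≢⇒∉ v∉ (in-X (ns⊆ n)))
      where
      in-X : ∀ {x} → x ∈ a ∷ m ∷ʳ b → x ∈ z ∷ (a ∷ m ∷ʳ b) ++ []
      in-X n = there (∈-++⁺ˡ n)

    -- Here the rim vertex that is split is joined to the hub z.
    module _ (l : 2 ≤ⁿ length ns) where

      spoke-one : ∀ u v → Distinct (pt u • pt v • X) → Solid (pt u • X • ed u a • ed u b • ed u z)
      spoke-one u v D = wheel z (u ∷ a ∷ m ∷ʳ b) {ns = u ∷ ns} (∉⇒All≢ (proj₁ (rim-∉ D)) ∷ un)
        (λ { (here refl) → here refl ; (there n) → there (ns⊆ n) }) (s≤s l) (begin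
        pt u • X • ed u a • ed u b • ed u z
          ≈⟨ ↷ ↷ ↷ ↷ ed-sym u z ⟩
        _ ≈⟨ solve 7 (λ u z r s e f g → u ⊕ (z ⊕ r ⊕ s) ⊕ e ⊕ f ⊕ g ⊜ z ⊕ (u ⊕ r ⊕ e ⊕ f) ⊕ g ⊕ s) ≋-refl _ _ _ _ _ _ _ ⟩
        _ ≈⟨ ↷ •-cong (≋-sym (rim-≋ u a m b)) (≡⇒≋ refl refl) ⟩
        pt z • cyc (u ∷ a ∷ m ∷ʳ b) • spokes z (u ∷ ns) ∎)

      spoke-a : ∀ u v → Distinct (pt u • pt v • X) → Lifted X u v (ed u a) (ed v b • ed v z)
      spoke-a u v D = inj₂ (inj₂ (wheel z (v ∷ u ∷ a ∷ m ∷ʳ b) {ns = v ∷ ns} (∉⇒All≢ (proj₂ (rim-∉ D)) ∷ un)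
        (λ { (here refl) → here refl ; (there n) → there (there (ns⊆ n)) }) (s≤s l) (begin
        pt u • pt v • ed u v • X • ed u a • ed v b • ed v z
          ≈⟨ ↷ ↷ •-cong (ed-sym u v) (↷ ↷ ↷ ed-sym v z) ⟩
        _ ≈⟨ solve 9 (λ u v h z r s e f g → u ⊕ v ⊕ h ⊕ (z ⊕ r ⊕ s) ⊕ e ⊕ f ⊕ g ⊜ z ⊕ (v ⊕ u ⊕ h ⊕ r ⊕ e ⊕ f) ⊕ g ⊕ s)
               ≋-refl _ _ _ _ _ _ _ _ _ ⟩
        _ ≈⟨ ↷ •-cong (≋-sym (rim-≋₂ v u a m b)) (≡⇒≋ refl refl) ⟩
        pt z • cyc (v ∷ u ∷ a ∷ m ∷ʳ b) • spokes z (v ∷ ns) ∎)))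

      spoke-b : ∀ u v → Distinct (pt u • pt v • X) → Lifted X u v (ed u b) (ed v a • ed v z)
      spoke-b u v D = inj₂ (inj₂ (wheel z (u ∷ v ∷ a ∷ m ∷ʳ b) {ns = v ∷ ns} (∉⇒All≢ (proj₂ (rim-∉ D)) ∷ un)
        (λ { (here refl) → there (here refl) ; (there n) → there (there (ns⊆ n)) }) (s≤s l) (begin
        pt u • pt v • ed u v • X • ed u b • ed v a • ed v z
          ≈⟨ ↷ ↷ ↷ ↷ ↷ ↷ ed-sym v z ⟩
        _ ≈⟨ solve 9 (λ u v h z r s f e g → u ⊕ v ⊕ h ⊕ (z ⊕ r ⊕ s) ⊕ f ⊕ e ⊕ g ⊜ z ⊕ (u ⊕ v ⊕ h ⊕ r ⊕ e ⊕ f) ⊕ g ⊕ s)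
               ≋-refl _ _ _ _ _ _ _ _ _ ⟩
        _ ≈⟨ ↷ •-cong (≋-sym (rim-≋₂ u v a m b)) (≡⇒≋ refl refl) ⟩
        pt z • cyc (u ∷ v ∷ a ∷ m ∷ʳ b) • spokes z (v ∷ ns) ∎)))

      rim-distinct : ∀ {u v} → Distinct (pt u • pt v • X) → Distinct (pt v • pt z • cyc (u ∷ a ∷ m ∷ʳ b))
      rim-distinct {u} {v} D = distinctˡ (pt v • pt z • cyc (u ∷ a ∷ m ∷ʳ b)) (spokes z ns)
        (distinct-resp {X = pt u • pt v • X • ed u a • ed u b} (begin
        pt u • pt v • X • ed u a • ed u b
          ≈⟨ solve 7 (λ u v z r s e f → u ⊕ v ⊕ (z ⊕ r ⊕ s) ⊕ e ⊕ f ⊜ (v ⊕ z ⊕ (u ⊕ r ⊕ e ⊕ f)) ⊕ s) ≋-refl _ _ _ _ _ _ _ ⟩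
        _ ≈⟨ •-cong (↷ ↷ rim-≋ u a m b) ≋-refl ⟨
        (pt v • pt z • cyc (u ∷ a ∷ m ∷ʳ b)) • spokes z ns ∎)
        (distinct-edges {X = X} (ed u a) (ed u b) refl refl D))

      -- With `v` closing the rim, `z` and `u` are adjacent vertices off the resulting cycle and `u`
      -- is joined to `v` alone. So `split-single` applies with `z` in the role of its second
      -- vertex.
      spoke-z : ∀ u v → Distinct (pt u • pt v • X) → Lifted X u v (ed u z) (ed v a • ed v b)
      spoke-z u v D with split-single {u = u} {z} {v} {a ∷ m ∷ʳ b} {ns} un ns⊆ l
                           (AllPairs.tail (AllPairs.tail (rim-distinct (distinct-swap {X = X} D))))
      ... | inj₁ s = inj₂ (inj₁ (solid-resp (begin
        pt v • X • ed v a • ed v b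
          ≈⟨ solve 6 (λ v z r s e f → v ⊕ (z ⊕ r ⊕ s) ⊕ e ⊕ f ⊜ z ⊕ (v ⊕ r ⊕ e ⊕ f) ⊕ s) ≋-refl _ _ _ _ _ _ ⟩
        _ ≈⟨ ↷ •-cong (rim-≋ v a m b) ≋-refl ⟨
        pt z • cyc (v ∷ a ∷ m ∷ʳ b) • spokes z ns ∎) s))
      ... | inj₂ s = inj₂ (inj₂ (solid-resp (begin
        pt u • pt v • ed u v • X • ed u z • ed v a • ed v b
          ≈⟨ solve 9 (λ u v g z r s h e f → u ⊕ v ⊕ g ⊕ (z ⊕ r ⊕ s) ⊕ h ⊕ e ⊕ f ⊜ u ⊕ z ⊕ h ⊕ (v ⊕ r ⊕ e ⊕ f) ⊕ g ⊕ s)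
               ≋-refl _ _ _ _ _ _ _ _ _ ⟩
        _ ≈⟨ ↷ ↷ ↷ •-cong (rim-≋ v a m b) ≋-refl ⟨
        pt u • pt z • ed u z • cyc (v ∷ a ∷ m ∷ʳ b) • ed u v • spokes z ns ∎) s))

      -- The neighbours u and t (t = a or t = b) on the cycle through u form the pair of v.
      spoke-both : ∀ u v t p → cyc (u ∷ a ∷ m ∷ʳ b) ≋ pt u • pt t • ed u t • arc t p u →
        (∃[ y ] y ∈ ns × y ∈ p) → Distinct (pt u • pt v • X) → ns ⊆ u ∷ t ∷ p →
        Solid (pt u • X • ed u a • ed u b) ⊎
        Solid (pt u • pt v • ed u v • X • (ed u a • ed u b) • ed v t • ed v z)
      spoke-both u v t p e (y , y∈ , y∈p) D ns⊆′
        with split-pair {u = v} {z} e un ns⊆′ y∈ y∈p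
               (rim-distinct D)
      ... | inj₁ s = inj₁ (solid-resp (begin
        pt u • X • ed u a • ed u b
          ≈⟨ solve 6 (λ v z r s e f → v ⊕ (z ⊕ r ⊕ s) ⊕ e ⊕ f ⊜ z ⊕ (v ⊕ r ⊕ e ⊕ f) ⊕ s) ≋-refl _ _ _ _ _ _ ⟩
        _ ≈⟨ ↷ •-cong (rim-≋ u a m b) ≋-refl ⟨
        pt z • cyc (u ∷ a ∷ m ∷ʳ b) • spokes z ns ∎) s)
      ... | inj₂ s = inj₂ (solid-resp (begin
        pt u • pt v • ed u v • X • (ed u a • ed u b) • ed v t • ed v z
          ≈⟨ ↷ ↷ •-cong (ed-sym u v) ≋-refl ⟩
        _ ≈⟨ solve 10 (λ u v g z r s e f h k → u ⊕ v ⊕ g ⊕ (z ⊕ r ⊕ s) ⊕ (e ⊕ f) ⊕ h ⊕ k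
               ⊜ v ⊕ z ⊕ k ⊕ (u ⊕ r ⊕ e ⊕ f) ⊕ (g ⊕ h) ⊕ s) ≋-refl _ _ _ _ _ _ _ _ _ _ ⟩
        _ ≈⟨ ↷ ↷ ↷ •-cong (rim-≋ u a m b) ≋-refl ⟨
        pt v • pt z • ed v z • cyc (u ∷ a ∷ m ∷ʳ b) • (ed v u • ed v t) • spokes z ns ∎) s)

      spoke-both-z : ∀ u v → Distinct (pt u • pt v • X) → Lifted X u v (ed u a • ed u z) (ed v b • ed v z)
      spoke-both-z u v D@((u≢v ∷ _) ∷ _) = inj₂ (inj₂ (wheel z (v ∷ u ∷ a ∷ m ∷ʳ b) {ns = u ∷ v ∷ ns}
        ((u≢v ∷ ∉⇒All≢ (proj₁ (rim-∉ D))) ∷ ∉⇒All≢ (proj₂ (rim-∉ D)) ∷ un)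
        (λ { (here refl) → there (here refl) ; (there (here refl)) → here refl ; (there (there n)) → there (there (ns⊆ n)) })
        (s≤s (ℕ.m≤n⇒m≤1+n l)) (begin
        pt u • pt v • ed u v • X • (ed u a • ed u z) • ed v b • ed v z
          ≈⟨ ↷ ↷ •-cong (ed-sym u v) (↷ •-cong (↷ ed-sym u z) (↷ ed-sym v z)) ⟩
        _ ≈⟨ solve 10 (λ u v h z r s e i f g → u ⊕ v ⊕ h ⊕ (z ⊕ r ⊕ s) ⊕ (e ⊕ i) ⊕ f ⊕ g
               ⊜ z ⊕ (v ⊕ u ⊕ h ⊕ r ⊕ e ⊕ f) ⊕ i ⊕ g ⊕ s) ≋-refl _ _ _ _ _ _ _ _ _ _ ⟩
        _ ≈⟨ ↷ •-cong (≋-sym (rim-≋₂ v u a m b)) (≡⇒≋ refl refl) ⟩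
        pt z • cyc (v ∷ u ∷ a ∷ m ∷ʳ b) • spokes z (u ∷ v ∷ ns) ∎)))

module _ {A : Set} (_≟_ : DecidableEquality A) where

  module _ (z a : A) (m : List A) (b : A) (ns : List A) (un : Unique ns) (ns⊆ : ns ⊆ a ∷ m ∷ʳ b) where
    open Rim z a m b ns un ns⊆

    viewRim : ∀ w → 3 ≤ⁿ length ns → Distinct (pt z • cyc (w ∷ a ∷ m ∷ʳ b) • spokes z ns) →
              View w (pt z • cyc (w ∷ a ∷ m ∷ʳ b) • spokes z ns)
    viewRim w l d = mkView X (a ∷ b ∷ []) split (avoid (split-off {X = X} d split))
      (λ { (here refl) → there (here refl) ; (there (here refl)) → there (there (∈-++⁺ˡ (∈-++⁺ʳ m (here refl)))) })
      (a , here refl) (lift₂ _≟_ (λ u _ _ → wheel-one u l) (λ u v _ → inj₂ (inj₂ (wheel-two u v l))))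
      (nonPath (ℕ.≤-trans (s≤s (s≤s z≤n)) l))
      where
      split : pt z • cyc (w ∷ a ∷ m ∷ʳ b) • spokes z ns ≋ pt w • X • spokes w (a ∷ b ∷ [])
      split = begin
        pt z • cyc (w ∷ a ∷ m ∷ʳ b) • spokes z ns ≈⟨ ↷ •-cong (rim-≋ w a m b) ≋-refl ⟩
        _ ≈⟨ solve 6 (λ z w r e f s → z ⊕ (w ⊕ r ⊕ e ⊕ f) ⊕ s ⊜ w ⊕ (z ⊕ r ⊕ s) ⊕ e ⊕ f) ≋-refl _ _ _ _ _ _ ⟩
        pt w • X • ed w a • ed w b ≈⟨ ↷ ↷ ≡⇒≋ refl refl ⟩
        pt w • X • spokes w (a ∷ b ∷ []) ∎

    viewSpoke : ∀ w → 2 ≤ⁿ length ns → Distinct (pt z • cyc (w ∷ a ∷ m ∷ʳ b) • ed z w • spokes z ns) →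
                View w (pt z • cyc (w ∷ a ∷ m ∷ʳ b) • ed z w • spokes z ns)
    viewSpoke w l d = mkView X (a ∷ b ∷ z ∷ []) split (avoid (split-off {X = X} d split))
      (λ { (here refl) → there (here refl) ; (there (here refl)) → there (there (∈-++⁺ˡ (∈-++⁺ʳ m (here refl))))
         ; (there (there (here refl))) → here refl })
      (a , here refl) (lift₃ _≟_ (spoke-one l) (spoke-a l) (spoke-b l) (spoke-z l) both-a both-b (spoke-both-z l))
      (nonPath l)
      where
      split : pt z • cyc (w ∷ a ∷ m ∷ʳ b) • ed z w • spokes z ns ≋ pt w • X • spokes w (a ∷ b ∷ z ∷ [])
      split = begin
        pt z • cyc (w ∷ a ∷ m ∷ʳ b) • ed z w • spokes z ns
          ≈⟨ ↷ •-cong (rim-≋ w a m b) (•-cong (ed-sym z w) ≋-refl) ⟩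
        _ ≈⟨ solve 7 (λ z w r e f g s → z ⊕ (w ⊕ r ⊕ e ⊕ f) ⊕ g ⊕ s ⊜ w ⊕ (z ⊕ r ⊕ s) ⊕ e ⊕ f ⊕ g) ≋-refl _ _ _ _ _ _ _ ⟩
        pt w • X • ed w a • ed w b • ed w z ≈⟨ ↷ ↷ ≡⇒≋ refl refl ⟩
        pt w • X • spokes w (a ∷ b ∷ z ∷ []) ∎
      -- Two spokes remain, so one of them ends away from the shared neighbour `t`; this is the
      -- vertex off the edge `u t` that `spoke-both` asks for.
      other : ∀ t → ∃[ y ] y ∈ ns × y ∉ t ∷ []
      other t = ∃-fresh _≟_ ns (t ∷ []) un l
      both-a : ∀ u v → Distinct (pt u • pt v • X) → Lifted X u v (ed u a • ed u b) (ed v a • ed v z)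
      both-a u v D = let (y , y∈ , y∉) = other a in [ inj₁ , inj₂ ∘ inj₂ ]′
        (spoke-both l u v a (m ∷ʳ b)
          (≋-trans (↷ arc-∷ u a (m ∷ʳ b) u) (solve 4 (λ u e a q → u ⊕ e ⊕ a ⊕ q ⊜ u ⊕ a ⊕ e ⊕ q) ≋-refl _ _ _ _))
          (y , y∈ , (case ns⊆ y∈ of λ { (here eq) → contradiction (here eq) y∉ ; (there n) → n })) D (there ∘ ns⊆))
      both-b : ∀ u v → Distinct (pt u • pt v • X) → Lifted X u v (ed u a • ed u b) (ed v b • ed v z)
      both-b u v D = let (y , y∈ , y∉) = other b in [ inj₁ , inj₂ ∘ inj₂ ]′
        (spoke-both l u v b (reverse (a ∷ m)) (begin
          pt u • arc u ((a ∷ m) ∷ʳ b) u ≈⟨ ↷ arc-∷ʳ u (a ∷ m) b u ⟩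
          pt u • arc u (a ∷ m) b • pt b • ed b u
            ≈⟨ ↷ •-cong (arc-reverse u (a ∷ m) b) (↷ ed-sym b u) ⟩
          _ ≈⟨ solve 4 (λ u q b e → u ⊕ q ⊕ b ⊕ e ⊜ u ⊕ b ⊕ e ⊕ q) ≋-refl _ _ _ _ ⟩
          pt u • pt b • ed u b • arc b (reverse (a ∷ m)) u ∎)
          (y , y∈ , Any.reverse⁺ ([ id , (λ n → contradiction n y∉) ]′ (∈-++⁻ (a ∷ m) (ns⊆ y∈)))) D
          (λ n → there ([ there ∘ Any.reverse⁺ , (λ { (here refl) → here refl }) ]′ (∈-++⁻ (a ∷ m) (ns⊆ n)))))

two-ends : (r : List A) → 2 ≤ⁿ length r → ∃[ a ] ∃[ m ] ∃[ b ] r ≡ a ∷ m ∷ʳ b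
two-ends (a ∷ r) l with initLast r
two-ends (a ∷ .[])        (s≤s ()) | []
two-ends (a ∷ .(m ∷ʳ b))  l        | m ∷ʳ′ b = a , m , b , refl

•-identityʳ : (X : Piece A) → X • ε ≋ X
•-identityʳ X = ≡⇒≋ (List.++-identityʳ _) (List.++-identityʳ _)

-- Views of every solid from every vertex

trihedronPiece : A → A → List A → List A → List A → Piece A
trihedronPiece a b p q r = pt a • pt b • arc a p b • arc a q b • arc a r b

stampPiece : A → A → A → A → List A → List A → List A → Piece A
stampPiece x s t u p q r =
  pt x • pt s • pt t • pt u • ed s t • ed t u • ed u s • arc s p x • arc t q x • arc u r x

prismPiece : A → A → A → A → A → A → List A → List A → List A → Piece A
prismPiece x₁ x₂ x₃ y₁ y₂ y₃ p q r =
  pt x₁ • pt x₂ • pt x₃ • pt y₁ • pt y₂ • pt y₃ • ed x₁ x₂ • ed x₂ x₃ • ed x₃ x₁ •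
  ed y₁ y₂ • ed y₂ y₃ • ed y₃ y₁ • arc x₁ p y₁ • arc x₂ q y₂ • arc x₃ r y₃

stamp-rotate : ∀ (x s t u : A) p q r → stampPiece x s t u p q r ≋ stampPiece x t u s q r p
stamp-rotate x s t u p q r =
  solve 10 (λ x s t u e f g p q r → x ⊕ s ⊕ t ⊕ u ⊕ e ⊕ f ⊕ g ⊕ p ⊕ q ⊕ r ⊜ x ⊕ t ⊕ u ⊕ s ⊕ f ⊕ g ⊕ e ⊕ q ⊕ r ⊕ p)
    ≋-refl _ _ _ _ _ _ _ _ _ _

prism-rotate : ∀ (x₁ x₂ x₃ y₁ y₂ y₃ : A) p q r →
  prismPiece x₁ x₂ x₃ y₁ y₂ y₃ p q r ≋ prismPiece x₂ x₃ x₁ y₂ y₃ y₁ q r p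
prism-rotate x₁ x₂ x₃ y₁ y₂ y₃ p q r =
  solve 15 (λ x₁ x₂ x₃ y₁ y₂ y₃ e f g h k l p q r →
      x₁ ⊕ x₂ ⊕ x₃ ⊕ y₁ ⊕ y₂ ⊕ y₃ ⊕ e ⊕ f ⊕ g ⊕ h ⊕ k ⊕ l ⊕ p ⊕ q ⊕ r
    ⊜ x₂ ⊕ x₃ ⊕ x₁ ⊕ y₂ ⊕ y₃ ⊕ y₁ ⊕ f ⊕ g ⊕ e ⊕ k ⊕ l ⊕ h ⊕ q ⊕ r ⊕ p)
    ≋-refl _ _ _ _ _ _ _ _ _ _ _ _ _ _ _

prism-flip : ∀ (x₁ x₂ x₃ y₁ y₂ y₃ : A) p q r →
  prismPiece x₁ x₂ x₃ y₁ y₂ y₃ p q r ≋ prismPiece y₁ y₂ y₃ x₁ x₂ x₃ (reverse p) (reverse q) (reverse r)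
prism-flip x₁ x₂ x₃ y₁ y₂ y₃ p q r = begin
  prismPiece x₁ x₂ x₃ y₁ y₂ y₃ p q r
    ≈⟨ solve 15 (λ x₁ x₂ x₃ y₁ y₂ y₃ e f g h k l p q r →
         x₁ ⊕ x₂ ⊕ x₃ ⊕ y₁ ⊕ y₂ ⊕ y₃ ⊕ e ⊕ f ⊕ g ⊕ h ⊕ k ⊕ l ⊕ p ⊕ q ⊕ r
       ⊜ y₁ ⊕ y₂ ⊕ y₃ ⊕ x₁ ⊕ x₂ ⊕ x₃ ⊕ h ⊕ k ⊕ l ⊕ e ⊕ f ⊕ g ⊕ p ⊕ q ⊕ r)
         ≋-refl _ _ _ _ _ _ _ _ _ _ _ _ _ _ _ ⟩
  _ ≈⟨ ↷ ↷ ↷ ↷ ↷ ↷ ↷ ↷ ↷ ↷ ↷ ↷ •-cong (arc-reverse x₁ p y₁) (•-cong (arc-reverse x₂ q y₂) (arc-reverse x₃ r y₃)) ⟩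
  prismPiece y₁ y₂ y₃ x₁ x₂ x₃ (reverse p) (reverse q) (reverse r) ∎

module _ {A : Set} (_≟_ : DecidableEquality A) where
  open DecMembership _≟_ using (_∈?_)

  viewPyramid : ∀ {w : A} z c ns → 3 ≤ⁿ length c → Unique ns → ns ⊆ c → 3 ≤ⁿ length ns →
    Distinct (pt z • cyc c • spokes z ns) → w ∈ verts (pt z • cyc c • spokes z ns) →
    View w (pt z • cyc c • spokes z ns)
  viewPyramid {w} z c ns lc un ns⊆ ln d (here refl) = viewHub _≟_ w c ns lc un ns⊆ ln d
  viewPyramid {w} z c ns lc un ns⊆ ln d (there m)
    with rotate-to (subst (w ∈_) (trans (List.++-identityʳ _) (verts-cyc c)) m)
  ... | r , f with two-ends r (ℕ.≤-pred (ℕ.≤-trans lc (ℕ.≤-reflexive (Perm.↭-length (cyc-↭ f)))))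
  ...   | a , p , b , refl with w ∈? ns
  ...     | no w∉ = view-resp g (viewRim _≟_ z a p b ns un on-rim w ln (distinct-resp g d))
    where
    g = ∷-≋ (•-cong f ≋-refl)
    on-rim : ns ⊆ a ∷ p ∷ʳ b
    on-rim n with Perm.∈-resp-↭ (cyc-↭ f) (ns⊆ n)
    ... | here refl = contradiction n w∉
    ... | there n′  = n′
  ...     | yes w∈ns with spokes-extract z w∈ns un
  ...       | ms , perm , (w∉ ∷ ums) , h = view-resp g
    (viewSpoke _≟_ z a p b ms ums on-rim w (ℕ.≤-pred (ℕ.≤-trans ln (ℕ.≤-reflexive (Perm.↭-length perm)))) (distinct-resp g d))
    where
    g = ∷-≋ (•-cong f h)
    on-rim : ms ⊆ a ∷ p ∷ʳ b
    on-rim n with Perm.∈-resp-↭ (cyc-↭ f) (ns⊆ (Perm.∈-resp-↭ (↭-sym perm) (there n)))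
    ... | here refl = contradiction n (All≢⇒∉ w∉)
    ... | there n′  = n′

  viewTrihedronSide : ∀ {w a b : A} p q r → 1 ≤ⁿ length q → 1 ≤ⁿ length r → w ∈ p →
    Distinct (trihedronPiece a b p q r) → View w (trihedronPiece a b p q r)
  viewTrihedronSide {w} {a} {b} p q r lq lr w∈ d with ∈-∃++ w∈
  ... | p₁ , p₂ , refl = view-resp g (viewArc _≟_ p₁ p₂
            (λ s ls → trihedron a b s q r ls lq lr (≋-sym (front s)))
            (distinct-resp g d)
            (λ { (na , nb , nq , nr) → na , nb , tt , tt , (na , nq , nb) , (na , nr , nb) })
            (here refl) (there (here refl))
            (ring a b q r ε (ℕ.≤-trans lq (ℕ.≤-trans (ℕ.m≤m+n _ _) (ℕ.≤-reflexive (sym (List.length-++ q)))))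
              (↷ ↷ ↷ ≋-sym (•-identityʳ _))))
    where
    front : ∀ s → trihedronPiece a b s q r ≋ arc a s b • pt a • pt b • arc a q b • arc a r b
    front s = solve 5 (λ a b p q r → a ⊕ b ⊕ p ⊕ q ⊕ r ⊜ p ⊕ a ⊕ b ⊕ q ⊕ r) ≋-refl _ _ _ _ _
    g = front (p₁ ++ w ∷ p₂)

  viewTrihedron : ∀ {w : A} a b p q r → 1 ≤ⁿ length p → 1 ≤ⁿ length q → 1 ≤ⁿ length r →
    Distinct (trihedronPiece a b p q r) → w ∈ verts (trihedronPiece a b p q r) → View w (trihedronPiece a b p q r)
  viewTrihedron {w} a b p q r lp lq lr d (here refl) = viewTrihedronEnd _≟_ w b p q r lp lq lr d
  viewTrihedron {w} a b p q r lp lq lr d (there (here refl)) =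
    view-resp g (viewTrihedronEnd _≟_ w a _ _ _ (nonempty-reverse p lp) (nonempty-reverse q lq)
                              (nonempty-reverse r lr) (distinct-resp g d))
    where
    g = ≋-trans (↷ ↷ •-cong (arc-reverse a p b) (•-cong (arc-reverse a q b) (arc-reverse a r b)))
          (solve 5 (λ a b p q r → a ⊕ b ⊕ p ⊕ q ⊕ r ⊜ b ⊕ a ⊕ p ⊕ q ⊕ r) ≋-refl _ _ _ _ _)
  viewTrihedron {w} a b p q r lp lq lr d (there (there m)) with ∈-++⁻ p m
  ... | inj₁ m′ = viewTrihedronSide p q r lq lr m′ d
  ... | inj₂ m′ with ∈-++⁻ q m′
  ...   | inj₁ m″ = view-resp g (viewTrihedronSide q p r lp lr m″ (distinct-resp g d))
    where g = solve 5 (λ a b p q r → a ⊕ b ⊕ p ⊕ q ⊕ r ⊜ a ⊕ b ⊕ q ⊕ p ⊕ r) ≋-refl _ _ _ _ _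
  ...   | inj₂ m″ = view-resp g (viewTrihedronSide r p q lp lq m″ (distinct-resp g d))
    where g = solve 5 (λ a b p q r → a ⊕ b ⊕ p ⊕ q ⊕ r ⊜ a ⊕ b ⊕ r ⊕ p ⊕ q) ≋-refl _ _ _ _ _

  viewStampSide : ∀ {w : A} x s t u p q r → w ∈ p → Distinct (stampPiece x s t u p q r) → View w (stampPiece x s t u p q r)
  viewStampSide {w} x s t u p q r w∈ d with ∈-∃++ w∈
  ... | p₁ , p₂ , refl = view-resp g (viewArc _≟_ p₁ p₂
            (λ p _ → stamp x s t u p q r (≋-sym (front p)))
            (distinct-resp g d)
            (λ { (nx , ns , nt , nu , _ , _ , _ , nq , nr) →
                 ns , nx , tt , tt , tt , tt , (ns , [] , nt) , (nt , [] , nu) , (nu , [] , ns) , (nt , nq , nx) , (nu , nr , nx) })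
            (there (here refl)) (here refl)
            (ring t x q (u ∷ r) (pt s • ed s t • ed u s) (nonempty-mid q)
              (≋-trans (solve 9 (λ x s t u e f g q r → x ⊕ s ⊕ t ⊕ u ⊕ e ⊕ f ⊕ g ⊕ q ⊕ r
                  ⊜ t ⊕ x ⊕ q ⊕ (f ⊕ u ⊕ r) ⊕ s ⊕ e ⊕ g) ≋-refl _ _ _ _ _ _ _ _ _)
                (↷ ↷ ↷ •-cong (≋-sym (arc-∷ t u r x)) ≋-refl))))
    where
    front : ∀ p → stampPiece x s t u p q r ≋
            arc s p x • pt x • pt s • pt t • pt u • ed s t • ed t u • ed u s • arc t q x • arc u r x
    front p = solve 10 (λ x s t u e f g p q r → x ⊕ s ⊕ t ⊕ u ⊕ e ⊕ f ⊕ g ⊕ p ⊕ q ⊕ r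
        ⊜ p ⊕ x ⊕ s ⊕ t ⊕ u ⊕ e ⊕ f ⊕ g ⊕ q ⊕ r) ≋-refl _ _ _ _ _ _ _ _ _ _
    g = front (p₁ ++ w ∷ p₂)

  viewStamp : ∀ {w : A} x s t u p q r →
    Distinct (stampPiece x s t u p q r) → w ∈ verts (stampPiece x s t u p q r) → View w (stampPiece x s t u p q r)
  viewStamp {w} x s t u p q r d (here refl) = view-resp g (viewStampApex _≟_ w s t u _ _ _ (distinct-resp g d))
    where g = ∷-≋ (↷ ↷ ↷ ↷ ↷ ↷ •-cong (arc-reverse s p x) (•-cong (arc-reverse t q x) (arc-reverse u r x)))
  viewStamp {w} x s t u p q r d (there (here refl)) = viewStampCorner _≟_ x w t u p q r d
  viewStamp {w} x s t u p q r d (there (there (here refl))) =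
    view-resp g (viewStampCorner _≟_ x w u s q r p (distinct-resp g d))
    where g = stamp-rotate x s t u p q r
  viewStamp {w} x s t u p q r d (there (there (there (here refl)))) =
    view-resp g (viewStampCorner _≟_ x w s t r p q (distinct-resp g d))
    where g = ≋-trans (stamp-rotate x s t u p q r) (stamp-rotate x t u s q r p)
  viewStamp {w} x s t u p q r d (there (there (there (there m)))) with ∈-++⁻ p m
  ... | inj₁ m′ = viewStampSide x s t u p q r m′ d
  ... | inj₂ m′ with ∈-++⁻ q m′
  ...   | inj₁ m″ = view-resp g (viewStampSide x t u s q r p m″ (distinct-resp g d))
    where g = stamp-rotate x s t u p q r
  ...   | inj₂ m″ = view-resp g (viewStampSide x u s t r p q m″ (distinct-resp g d))
    where g = ≋-trans (stamp-rotate x s t u p q r) (stamp-rotate x t u s q r p)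

  viewPrismSide : ∀ {w : A} x₁ x₂ x₃ y₁ y₂ y₃ p q r → w ∈ p →
    Distinct (prismPiece x₁ x₂ x₃ y₁ y₂ y₃ p q r) → View w (prismPiece x₁ x₂ x₃ y₁ y₂ y₃ p q r)
  viewPrismSide {w} x₁ x₂ x₃ y₁ y₂ y₃ p q r w∈ d with ∈-∃++ w∈
  ... | p₁ , p₂ , refl = view-resp g (viewArc _≟_ p₁ p₂
            (λ p _ → prism x₁ x₂ x₃ y₁ y₂ y₃ p q r (≋-sym (front p)))
            (distinct-resp g d)
            (λ { (n₁ , n₂ , n₃ , m₁ , m₂ , m₃ , _ , _ , _ , _ , _ , _ , nq , nr) →
                 n₁ , m₁ , tt , tt , tt , tt , tt , tt , (n₁ , [] , n₂) , (n₂ , [] , n₃) , (n₃ , [] , n₁) ,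
                 (m₁ , [] , m₂) , (m₂ , [] , m₃) , (m₃ , [] , m₁) , (n₂ , nq , m₂) , (n₃ , nr , m₃) })
            (here refl) (there (there (there (here refl))))
            (ring x₂ y₃ (x₃ ∷ r) (q ++ y₂ ∷ []) (pt x₁ • pt y₁ • ed x₁ x₂ • ed x₃ x₁ • ed y₁ y₂ • ed y₃ y₁) (s≤s z≤n)
              (≋-trans (solve 14 (λ x₁ x₂ x₃ y₁ y₂ y₃ e f g h k l q r →
                  x₁ ⊕ x₂ ⊕ x₃ ⊕ y₁ ⊕ y₂ ⊕ y₃ ⊕ e ⊕ f ⊕ g ⊕ h ⊕ k ⊕ l ⊕ q ⊕ r
                  ⊜ x₂ ⊕ y₃ ⊕ (f ⊕ x₃ ⊕ r) ⊕ (q ⊕ y₂ ⊕ k) ⊕ x₁ ⊕ y₁ ⊕ e ⊕ g ⊕ h ⊕ l)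
                  ≋-refl _ _ _ _ _ _ _ _ _ _ _ _ _ _)
                (↷ ↷ •-cong (≋-sym (arc-∷ x₂ x₃ r y₃)) (•-cong (≋-sym (arc-∷ʳ x₂ q y₂ y₃)) ≋-refl)))))
    where
    front : ∀ p → prismPiece x₁ x₂ x₃ y₁ y₂ y₃ p q r ≋
            arc x₁ p y₁ • pt x₁ • pt x₂ • pt x₃ • pt y₁ • pt y₂ • pt y₃ • ed x₁ x₂ • ed x₂ x₃ • ed x₃ x₁ •
            ed y₁ y₂ • ed y₂ y₃ • ed y₃ y₁ • arc x₂ q y₂ • arc x₃ r y₃
    front p = solve 15 (λ x₁ x₂ x₃ y₁ y₂ y₃ e f g h k l p q r →
        x₁ ⊕ x₂ ⊕ x₃ ⊕ y₁ ⊕ y₂ ⊕ y₃ ⊕ e ⊕ f ⊕ g ⊕ h ⊕ k ⊕ l ⊕ p ⊕ q ⊕ r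
      ⊜ p ⊕ x₁ ⊕ x₂ ⊕ x₃ ⊕ y₁ ⊕ y₂ ⊕ y₃ ⊕ e ⊕ f ⊕ g ⊕ h ⊕ k ⊕ l ⊕ q ⊕ r)
      ≋-refl _ _ _ _ _ _ _ _ _ _ _ _ _ _ _
    g = front (p₁ ++ w ∷ p₂)

  viewPrismHalf : ∀ {w : A} x₁ x₂ x₃ y₁ y₂ y₃ p q r → w ≡ x₁ ⊎ w ∈ p →
    Distinct (prismPiece x₁ x₂ x₃ y₁ y₂ y₃ p q r) → View w (prismPiece x₁ x₂ x₃ y₁ y₂ y₃ p q r)
  viewPrismHalf x₁ x₂ x₃ y₁ y₂ y₃ p q r (inj₁ refl) d = viewPrismCorner _≟_ x₁ x₂ x₃ y₁ y₂ y₃ p q r d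
  viewPrismHalf x₁ x₂ x₃ y₁ y₂ y₃ p q r (inj₂ m)    d = viewPrismSide x₁ x₂ x₃ y₁ y₂ y₃ p q r m d

  viewPrismTop : ∀ {w : A} x₁ x₂ x₃ y₁ y₂ y₃ p q r → w ∈ x₁ ∷ x₂ ∷ x₃ ∷ p ++ q ++ r →
    Distinct (prismPiece x₁ x₂ x₃ y₁ y₂ y₃ p q r) → View w (prismPiece x₁ x₂ x₃ y₁ y₂ y₃ p q r)
  viewPrismTop {w} x₁ x₂ x₃ y₁ y₂ y₃ p q r w∈ d = go (sides w∈)
    where
    sides : w ∈ x₁ ∷ x₂ ∷ x₃ ∷ p ++ q ++ r → (w ≡ x₁ ⊎ w ∈ p) ⊎ (w ≡ x₂ ⊎ w ∈ q) ⊎ (w ≡ x₃ ⊎ w ∈ r)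
    sides (here eq)                 = inj₁ (inj₁ eq)
    sides (there (here eq))         = inj₂ (inj₁ (inj₁ eq))
    sides (there (there (here eq))) = inj₂ (inj₂ (inj₁ eq))
    sides (there (there (there m))) with ∈-++⁻ p m
    ... | inj₁ m′ = inj₁ (inj₂ m′)
    ... | inj₂ m′ = inj₂ ([ inj₁ ∘ inj₂ , inj₂ ∘ inj₂ ]′ (∈-++⁻ q m′))
    g₁ = prism-rotate x₁ x₂ x₃ y₁ y₂ y₃ p q r
    g₂ = ≋-trans g₁ (prism-rotate x₂ x₃ x₁ y₂ y₃ y₁ q r p)
    go : (w ≡ x₁ ⊎ w ∈ p) ⊎ (w ≡ x₂ ⊎ w ∈ q) ⊎ (w ≡ x₃ ⊎ w ∈ r) → View w (prismPiece x₁ x₂ x₃ y₁ y₂ y₃ p q r)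
    go (inj₁ s)        = viewPrismHalf x₁ x₂ x₃ y₁ y₂ y₃ p q r s d
    go (inj₂ (inj₁ s)) = view-resp g₁ (viewPrismHalf x₂ x₃ x₁ y₂ y₃ y₁ q r p s (distinct-resp g₁ d))
    go (inj₂ (inj₂ s)) = view-resp g₂ (viewPrismHalf x₃ x₁ x₂ y₃ y₁ y₂ r p q s (distinct-resp g₂ d))

  viewPrism : ∀ {w : A} x₁ x₂ x₃ y₁ y₂ y₃ p q r → Distinct (prismPiece x₁ x₂ x₃ y₁ y₂ y₃ p q r) →
    w ∈ verts (prismPiece x₁ x₂ x₃ y₁ y₂ y₃ p q r) → View w (prismPiece x₁ x₂ x₃ y₁ y₂ y₃ p q r)
  viewPrism {w} x₁ x₂ x₃ y₁ y₂ y₃ p q r d w∈ with w ∈? (x₁ ∷ x₂ ∷ x₃ ∷ p ++ q ++ r)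
  ... | yes m = viewPrismTop x₁ x₂ x₃ y₁ y₂ y₃ p q r m d
  ... | no w∉ = view-resp g (viewPrismTop y₁ y₂ y₃ x₁ x₂ x₃ _ _ _ (bottom w∈) (distinct-resp g d))
    where
    g = prism-flip x₁ x₂ x₃ y₁ y₂ y₃ p q r
    bottom : ∀ {zs} → w ∈ x₁ ∷ x₂ ∷ x₃ ∷ y₁ ∷ y₂ ∷ y₃ ∷ p ++ q ++ r → w ∈ y₁ ∷ y₂ ∷ y₃ ∷ zs
    bottom (here eq)                                         = contradiction (here eq) w∉
    bottom (there (here eq))                                 = contradiction (there (here eq)) w∉
    bottom (there (there (here eq)))                         = contradiction (there (there (here eq))) w∉
    bottom (there (there (there (here eq))))                 = here eq
    bottom (there (there (there (there (here eq)))))         = there (here eq)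
    bottom (there (there (there (there (there (here eq)))))) = there (there (here eq))
    bottom (there (there (there (there (there (there m)))))) = contradiction (there (there (there m))) w∉

  -- Rotations, reflections and reversals reduce the position of `w` to those treated above. From
  -- here on, lifting and the non-path property are available without reference to the kind of
  -- solid.
  view : ∀ {w : A} {X₀} → Solid X₀ → Distinct X₀ → w ∈ verts X₀ → View w X₀
  view (pyramid z c ns lc un ns⊆ ln e) d w∈ =
    view-resp e (viewPyramid z c ns lc un ns⊆ ln (distinct-resp e d) (Perm.∈-resp-↭ (verts-↭ e) w∈))
  view (trihedron a b p q r lp lq lr e) d w∈ =
    view-resp e (viewTrihedron a b p q r lp lq lr (distinct-resp e d) (Perm.∈-resp-↭ (verts-↭ e) w∈))
  view (stamp x s t u p q r e) d w∈ =
    view-resp e (viewStamp x s t u p q r (distinct-resp e d) (Perm.∈-resp-↭ (verts-↭ e) w∈))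
  view (prism x₁ x₂ x₃ y₁ y₂ y₃ p q r e) d w∈ =
    view-resp e (viewPrism x₁ x₂ x₃ y₁ y₂ y₃ p q r (distinct-resp e d) (Perm.∈-resp-↭ (verts-↭ e) w∈))

-- Pieces as induced subgraphs

data Cycle {A : Set} (X : Piece A) : Set where
  cycleOn : ∀ c → 3 ≤ⁿ length c → X ≋ cyc c → Cycle X

Closed : Piece A → Set
Closed X = ∀ {x y} → (x , y) ∈ edges′ X → x ∈ verts X × y ∈ verts X

closed-resp : {X Y : Piece A} → X ≋ Y → Closed Y → Closed X
closed-resp e k m with edges-≲ e m
... | inj₁ m′ = let (a , b) = k m′ in Perm.∈-resp-↭ (↭-sym (verts-↭ e)) a , Perm.∈-resp-↭ (↭-sym (verts-↭ e)) b
... | inj₂ m′ = let (a , b) = k m′ in Perm.∈-resp-↭ (↭-sym (verts-↭ e)) b , Perm.∈-resp-↭ (↭-sym (verts-↭ e)) a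

-- As the hypothesis holds for every predicate, it can be instantiated at membership in `verts X`.
close : (X : Piece A) → (∀ {P : A → Set} → OnVerts P X → OnEnds P X) → Closed X
close X k = onEnds X (k (onVerts X id))

close-cyc : (c : List A) → ∀ {P : A → Set} → OnVerts P (cyc c) → OnEnds P (cyc c)
close-cyc []       _        = tt
close-cyc (x ∷ xs) (n , ns) = tt , n , ns , n

cycle-closed : {X : Piece A} → Cycle X → Closed X
cycle-closed (cycleOn c _ e) = closed-resp e (close (cyc c) (close-cyc c))

solid-closed : {X : Piece A} → Solid X → Closed X
solid-closed (pyramid w c ns _ _ ns⊆ _ e) = closed-resp e
  (onEnds (pt w • cyc c • spokes w ns) (tt , close-cyc c (onVerts (cyc c) (there ∘ ∈-++⁺ˡ)) , here refl ,
    All.tabulate (λ n → there (∈-++⁺ˡ (subst (_ ∈_) (sym (verts-cyc c)) (ns⊆ n))))))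
solid-closed (trihedron a b p q r _ _ _ e) = closed-resp e (close (trihedronPiece a b p q r)
  λ { (na , nb , np , nq , nr) → tt , tt , (na , np , nb) , (na , nq , nb) , (na , nr , nb) })
solid-closed (stamp x s t u p q r e) = closed-resp e (close (stampPiece x s t u p q r)
  λ { (nx , ns , nt , nu , _ , _ , _ , np , nq , nr) → tt , tt , tt , tt , (ns , [] , nt) , (nt , [] , nu) , (nu , [] , ns) ,
      (ns , np , nx) , (nt , nq , nx) , (nu , nr , nx) })
solid-closed (prism x₁ x₂ x₃ y₁ y₂ y₃ p q r e) = closed-resp e (close (prismPiece x₁ x₂ x₃ y₁ y₂ y₃ p q r)
  λ { (n₁ , n₂ , n₃ , m₁ , m₂ , m₃ , _ , _ , _ , _ , _ , _ , np , nq , nr) →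
      tt , tt , tt , tt , tt , tt , (n₁ , [] , n₂) , (n₂ , [] , n₃) , (n₃ , [] , n₁) ,
      (m₁ , [] , m₂) , (m₂ , [] , m₃) , (m₃ , [] , m₁) , (n₁ , np , m₁) , (n₂ , nq , m₂) , (n₃ , nr , m₃) })

mapPiece : (A → B) → Piece A → Piece B
mapPiece f ε             = ε
mapPiece f (X • Y)       = mapPiece f X • mapPiece f Y
mapPiece f (pt a)        = pt (f a)
mapPiece f (arc a p b)   = arc (f a) (map f p) (f b)
mapPiece f (spokes w ns) = spokes (f w) (map f ns)

map² : (A → B) → A × A → B × B
map² f (x , y) = f x , f y

map-path : ∀ (f : A → B) xs → path (map f xs) ≡ map (map² f) (path xs)
map-path f []           = refl
map-path f (x ∷ [])     = refl
map-path f (x ∷ y ∷ xs) = cong (_ ∷_) (map-path f (y ∷ xs))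

verts-map : ∀ (f : A → B) X → verts (mapPiece f X) ≡ map f (verts X)
verts-map f ε            = refl
verts-map f (X • Y)      = trans (cong₂ _++_ (verts-map f X) (verts-map f Y)) (sym (List.map-++ f (verts X) (verts Y)))
verts-map f (pt a)       = refl
verts-map f (arc a p b)  = refl
verts-map f (spokes _ _) = refl

edges-map : ∀ (f : A → B) X → edges′ (mapPiece f X) ≡ map (map² f) (edges′ X)
edges-map f ε            = refl
edges-map f (X • Y)      = trans (cong₂ _++_ (edges-map f X) (edges-map f Y)) (sym (List.map-++ (map² f) (edges′ X) (edges′ Y)))
edges-map f (pt a)       = refl
edges-map f (arc a p b)  = trans (cong (λ r → path (f a ∷ r)) (sym (List.map-++ f p (b ∷ [])))) (map-path f (a ∷ p ∷ʳ b))
edges-map f (spokes w ns) = trans (sym (List.map-∘ ns)) (List.map-∘ ns)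

map-≲ : ∀ (f : A → B) {es es′} → es ≲ es′ → map (map² f) es ≲ map (map² f) es′
map-≲ f g m with ∈-map⁻ (map² f) m
... | _ , m′ , refl = [ inj₁ ∘ ∈-map⁺ (map² f) , inj₂ ∘ ∈-map⁺ (map² f) ]′ (g m′)

mapPiece-≋ : ∀ (f : A → B) {X Y} → X ≋ Y → mapPiece f X ≋ mapPiece f Y
mapPiece-≋ f {X} {Y} (mk≋ v e e′)
  = ≋-trans (mk≋ (↭-trans (↭-reflexive (verts-map f X)) (↭-trans (Perm.map⁺ f v) (↭-reflexive (sym (verts-map f Y)))))
      (λ m → subst (λ es → Joined es _ _) (sym (edges-map f Y)) (map-≲ f e (subst (_ ∈_) (edges-map f X) m)))
      (λ m → subst (λ es → Joined es _ _) (sym (edges-map f X)) (map-≲ f e′ (subst (_ ∈_) (edges-map f Y) m)))) ≋-refl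

map-cyc : ∀ (f : A → B) c → mapPiece f (cyc c) ≡ cyc (map f c)
map-cyc f []       = refl
map-cyc f (x ∷ xs) = refl

InjectiveOn : (A → B) → List A → Set
InjectiveOn f xs = ∀ {x y} → x ∈ xs → y ∈ xs → f x ≡ f y → x ≡ y

unique-map : ∀ {f : A → B} xs → InjectiveOn f xs → Unique xs → Unique (map f xs)
unique-map []       i []       = []
unique-map {f = f} (x ∷ xs) i (x∉ ∷ u) =
  ∉⇒All≢ (λ m → let (y , m′ , eq) = ∈-map⁻ f m in All≢⇒∉ x∉ (subst (_∈ xs) (sym (i (here refl) (there m′) eq)) m′))
  ∷ unique-map xs (λ a b → i (there a) (there b)) u

length-map-≤ : ∀ {k} (f : A → B) xs → k ≤ⁿ length xs → k ≤ⁿ length (map f xs)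
length-map-≤ f xs l = subst (_ ≤ⁿ_) (sym (List.length-map f xs)) l

cycle-map : ∀ (f : A → B) {X} → Cycle X → Cycle (mapPiece f X)
cycle-map f (cycleOn c l e) = cycleOn (map f c) (length-map-≤ f c l)
  (subst (_ ≋_) (map-cyc f c) (mapPiece-≋ f e))

solid-map : ∀ (f : A → B) {X} → InjectiveOn f (verts X) → Solid X → Solid (mapPiece f X)
solid-map f {X} i (pyramid w c ns lc un ns⊆ ln e) =
  pyramid (f w) (map f c) (map f ns) (length-map-≤ f c lc)
    (unique-map ns (λ a b → i (in-X a) (in-X b)) un)
    (λ m → let (_ , m′ , eq) = ∈-map⁻ f m in subst (_∈ map f c) (sym eq) (∈-map⁺ f (ns⊆ m′)))
    (length-map-≤ f ns ln)
    (subst (λ Y → _ ≋ pt (f w) • Y • spokes (f w) (map f ns)) (map-cyc f c) (mapPiece-≋ f e))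
  where
  in-X : ∀ {x} → x ∈ ns → x ∈ verts X
  in-X m = Perm.∈-resp-↭ (↭-sym (verts-↭ e)) (there (∈-++⁺ˡ (subst (_ ∈_) (sym (verts-cyc c)) (ns⊆ m))))
solid-map f i (trihedron a b p q r lp lq lr e) =
  trihedron _ _ _ _ _ (length-map-≤ f p lp) (length-map-≤ f q lq) (length-map-≤ f r lr) (mapPiece-≋ f e)
solid-map f i (stamp x s t u p q r e) = stamp _ _ _ _ _ _ _ (mapPiece-≋ f e)
solid-map f i (prism x₁ x₂ x₃ y₁ y₂ y₃ p q r e) = prism _ _ _ _ _ _ _ _ _ (mapPiece-≋ f e)

-- The piece is the subgraph induced on its vertices. A bare relation in place of a graph lets the
-- same piece be compared in `G` and in the contraction, which have the same vertices.
record Realises {A : Set} (R : A → A → Set) (X : Piece A) : Set where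
  constructor realises
  field
    distinct : Distinct X
    sound    : ∀ {x y} → x ∈ verts X → y ∈ verts X → R x y → Joined (edges′ X) x y
    complete : ∀ {x y} → x ∈ verts X → y ∈ verts X → Joined (edges′ X) x y → R x y
open Realises public

realises-resp : ∀ {R : A → A → Set} {X Y} → X ≋ Y → Realises R Y → Realises R X
realises-resp e (realises d s c) = realises (distinct-resp (≋-sym e) d)
  (λ a b r → joined-mono (edges-≳ e) (s (Perm.∈-resp-↭ (verts-↭ e) a) (Perm.∈-resp-↭ (verts-↭ e) b) r))
  (λ a b j → c (Perm.∈-resp-↭ (verts-↭ e) a) (Perm.∈-resp-↭ (verts-↭ e) b) (joined-mono (edges-≲ e) j))

realises-map : ∀ {R : A → A → Set} {R′ : B → B → Set} (f : A → B) {X} → Closed X → InjectiveOn f (verts X) →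
  (∀ {x y} → x ∈ verts X → y ∈ verts X → R x y → R′ (f x) (f y)) →
  (∀ {x y} → x ∈ verts X → y ∈ verts X → R′ (f x) (f y) → R x y) →
  Realises R X → Realises R′ (mapPiece f X)
realises-map {R = R} {R′} f {X} k i to from (realises d s c) = realises
  (subst Unique (sym (verts-map f X)) (unique-map (verts X) i d)) s′ c′
  where
  s′ : ∀ {x y} → x ∈ verts (mapPiece f X) → y ∈ verts (mapPiece f X) → R′ x y → Joined (edges′ (mapPiece f X)) x y
  s′ a b r with ∈-map⁻ f (subst (_ ∈_) (verts-map f X) a) | ∈-map⁻ f (subst (_ ∈_) (verts-map f X) b)
  ... | _ , a′ , refl | _ , b′ , refl = subst (λ es → Joined es _ _) (sym (edges-map f X))
    ([ inj₁ ∘ ∈-map⁺ (map² f) , inj₂ ∘ ∈-map⁺ (map² f) ]′ (s a′ b′ (from a′ b′ r)))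
  edge : ∀ {x y} → (x , y) ∈ edges′ (mapPiece f X) → ∃[ x′ ] ∃[ y′ ] x ≡ f x′ × y ≡ f y′ × (x′ , y′) ∈ edges′ X
  edge m with ∈-map⁻ (map² f) (subst (_ ∈_) (edges-map f X) m)
  ... | (x′ , y′) , m′ , refl = x′ , y′ , refl , refl , m′
  c′ : ∀ {x y} → x ∈ verts (mapPiece f X) → y ∈ verts (mapPiece f X) → Joined (edges′ (mapPiece f X)) x y → R′ x y
  c′ _ _ (inj₁ m) with edge m
  ... | _ , _ , refl , refl , m′ = let (a , b) = k m′ in to a b (c a b (inj₁ m′))
  c′ _ _ (inj₂ m) with edge m
  ... | _ , _ , refl , refl , m′ = let (a , b) = k m′ in to b a (c b a (inj₂ m′))

realises-cong : ∀ {R R′ : A → A → Set} {X} →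
  (∀ {x y} → x ∈ verts X → y ∈ verts X → R x y → R′ x y) →
  (∀ {x y} → x ∈ verts X → y ∈ verts X → R′ x y → R x y) → Realises R X → Realises R′ X
realises-cong to from (realises d s c) = realises d (λ a b r → s a b (from a b r)) (λ a b j → to a b (c a b j))

module _ {A : Set} {R : A → A → Set} where

  -- Lifted solids are shown to be induced in this way: vertices are attached one at a time, each
  -- with all its neighbours in what is already there.
  realises-spokes : (∀ {x y} → R x y → R y x) → (∀ {x} → ¬ R x x) →
    ∀ {u X ns} → Realises R X → u ∉ verts X → (∀ {x y} → (x , y) ∈ edges′ X → u ≢ x × u ≢ y) → ns ⊆ verts X →
    (∀ {x} → x ∈ verts X → R u x → x ∈ ns) → (∀ {x} → x ∈ ns → R u x) → Realises R (pt u • X • spokes u ns)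
  realises-spokes R-sym R-irr {u} {X} {ns} (realises d s c) u∉ av ns⊆ into out = realises
    (∉⇒All≢ (λ m → u∉ (subst (u ∈_) (List.++-identityʳ _) m)) ∷ subst Unique (sym (List.++-identityʳ _)) d)
    (λ a b → s′ (vert a) (vert b)) (λ a b j → c′ (vert a) (vert b) (joined-++⁻ (edges′ X) j))
    where
    vert : ∀ {x} → x ∈ verts (pt u • X • spokes u ns) → x ≡ u ⊎ x ∈ verts X
    vert (here eq) = inj₁ eq
    vert (there m) = inj₂ (subst (_ ∈_) (List.++-identityʳ _) m)
    s′ : ∀ {x y} → x ≡ u ⊎ x ∈ verts X → y ≡ u ⊎ y ∈ verts X → R x y → Joined (edges′ X ++ map (u ,_) ns) x y
    s′ (inj₁ refl) (inj₁ refl) r = contradiction r R-irr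
    s′ (inj₁ refl) (inj₂ b)    r = inj₁ (∈-++⁺ʳ (edges′ X) (∈-map⁺ (u ,_) (into b r)))
    s′ (inj₂ a)    (inj₁ refl) r = inj₂ (∈-++⁺ʳ (edges′ X) (∈-map⁺ (u ,_) (into a (R-sym r))))
    s′ (inj₂ a)    (inj₂ b)    r = joined-++⁺ˡ (s a b r)
    c′ : ∀ {x y} → x ≡ u ⊎ x ∈ verts X → y ≡ u ⊎ y ∈ verts X →
         Joined (edges′ X) x y ⊎ Joined (map (u ,_) ns) x y → R x y
    c′ (inj₁ refl) _ (inj₁ (inj₁ m)) = contradiction refl (proj₁ (av m))
    c′ (inj₁ refl) _ (inj₁ (inj₂ m)) = contradiction refl (proj₂ (av m))
    c′ (inj₂ _) (inj₁ refl) (inj₁ (inj₁ m)) = contradiction refl (proj₂ (av m))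
    c′ (inj₂ _) (inj₁ refl) (inj₁ (inj₂ m)) = contradiction refl (proj₁ (av m))
    c′ (inj₂ a) (inj₂ b) (inj₁ j) = c a b j
    c′ _ _ (inj₂ (inj₁ m)) with ∈-map⁻ (u ,_) m
    ... | _ , m′ , refl = out m′
    c′ _ _ (inj₂ (inj₂ m)) with ∈-map⁻ (u ,_) m
    ... | _ , m′ , refl = R-sym (out m′)

  module _ {u X ns} (av : Avoids u X) (re : Realises R (pt u • X • spokes u ns)) where

    spokes-∉ : u ∉ verts X
    spokes-∉ m = All≢⇒∉ (AllPairs.head (distinct re)) (∈-++⁺ˡ m)

    realises-rest : Realises R X
    realises-rest = realises (distinctˡ X (spokes u ns) (AllPairs.tail (distinct re)))
      (λ a b r → s′ a b (joined-++⁻ (edges′ X) (sound re (there (∈-++⁺ˡ a)) (there (∈-++⁺ˡ b)) r)))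
      (λ a b j → complete re (there (∈-++⁺ˡ a)) (there (∈-++⁺ˡ b)) (joined-++⁺ˡ j))
      where
      s′ : ∀ {x y} → x ∈ verts X → y ∈ verts X → Joined (edges′ X) x y ⊎ Joined (map (u ,_) ns) x y → Joined (edges′ X) x y
      s′ a b (inj₁ j) = j
      s′ a b (inj₂ (inj₁ m)) with ∈-map⁻ (u ,_) m
      ... | _ , _ , refl = contradiction a spokes-∉
      s′ a b (inj₂ (inj₂ m)) with ∈-map⁻ (u ,_) m
      ... | _ , _ , refl = contradiction b spokes-∉

    spokes-sound : ∀ {x} → x ∈ verts X → R u x → x ∈ ns
    spokes-sound m r with joined-++⁻ (edges′ X) (sound re (here refl) (there (∈-++⁺ˡ m)) r)
    ... | inj₁ (inj₁ e) = contradiction refl (proj₁ (onEnds X av e))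
    ... | inj₁ (inj₂ e) = contradiction refl (proj₂ (onEnds X av e))
    ... | inj₂ (inj₁ e) with ∈-map⁻ (u ,_) e
    ...   | _ , m′ , refl = m′
    spokes-sound m r | inj₂ (inj₂ e) with ∈-map⁻ (u ,_) e
    ...   | _ , m′ , refl = contradiction m spokes-∉

    spokes-complete : ns ⊆ verts X → ∀ {x} → x ∈ ns → R u x
    spokes-complete ns⊆ m = complete re (here refl) (there (∈-++⁺ˡ (ns⊆ m))) (joined-++⁺ʳ (edges′ X) (inj₁ (∈-map⁺ (u ,_) m)))

-- The piece lives on the vertices of the whole graph. This avoids the renumbering in the induced
-- subgraph on `S` and makes pieces on different sets comparable.
record Has {n} (F : Piece (Fin n) → Set) (R : Fin n → Fin n → Set) (S : Subset n) : Set where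
  constructor has
  field
    piece  : Piece (Fin n)
    shape  : F piece
    real   : Realises R piece
    within : ∀ {x} → x ∈ˢ S → x ∈ verts piece
    onto   : ∀ {x} → x ∈ verts piece → x ∈ˢ S
open Has public

Spans : (H : Graph) → (Piece (Fin (Graph.order H)) → Set) → Set
Spans H F = ∃[ X ] F X × Realises (Graph.Adj H) X × (∀ v → v ∈ verts X)

module _ (H : Graph) where
  open Graph H

  graphOn⇒realises : ∀ X {vs es} → vs ↭ verts X → es ≡ edges′ X → IsGraphOn H vs es →
    Realises Adj X × (∀ v → v ∈ verts X)
  graphOn⇒realises X p refl (u , all , adj) =
    realises (unique-resp p u) (λ {x} {y} _ _ → Equivalence.to (adj x y)) (λ {x} {y} _ _ → Equivalence.from (adj x y)) ,
    λ v → Perm.∈-resp-↭ p (all v)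

  realises⇒graphOn : ∀ {X} Y {vs es} → X ≋ Y → vs ↭ verts Y → es ≡ edges′ Y →
    Realises Adj X → (∀ v → v ∈ verts X) → IsGraphOn H vs es
  realises⇒graphOn {X} Y e p refl re all =
    unique-resp (↭-sym p) (distinct-resp e (distinct re)) ,
    (λ v → Perm.∈-resp-↭ (↭-sym p) (Perm.∈-resp-↭ (verts-↭ e) (all v))) ,
    λ x y → mk⇔ (λ r → joined-mono (edges-≲ e) (sound re (all x) (all y) r))
                (λ j → complete re (all x) (all y) (joined-mono (edges-≳ e) j))

  edges-cyc : ∀ (c : List V) → cycle c ≡ edges′ (cyc c)
  edges-cyc []      = refl
  edges-cyc (_ ∷ _) = refl

  pyramid-verts : ∀ (w : V) c ns → w ∷ c ↭ verts (pt w • cyc c • spokes w ns)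
  pyramid-verts w c ns = ↭-reflexive (cong (w ∷_) (trans (sym (verts-cyc c)) (sym (List.++-identityʳ _))))

  isCycle⇒spans : IsCycle H → Spans H Cycle
  isCycle⇒spans (c , l , g) =
    cyc c , cycleOn c l ≋-refl , graphOn⇒realises (cyc c) (↭-reflexive (sym (verts-cyc c))) (edges-cyc c) g

  spans⇒isCycle : Spans H Cycle → IsCycle H
  spans⇒isCycle (X , cycleOn c l e , re , all) =
    c , l , realises⇒graphOn (cyc c) e (↭-reflexive (sym (verts-cyc c))) (edges-cyc c) re all

  isSolid⇒spans : IsSolid H → Spans H Solid
  isSolid⇒spans (inj₁ (w , c , ns , lc , un , ns∈ , ln , g)) =
    Y , pyramid w c ns lc un (All.lookup ns∈) ln ≋-refl ,
    graphOn⇒realises Y (pyramid-verts w c ns) (cong (_++ map (w ,_) ns) (edges-cyc c)) g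
    where Y = pt w • cyc c • spokes w ns
  isSolid⇒spans (inj₂ (inj₁ (a , b , p , q , r , lp , lq , lr , g))) =
    Y , trihedron a b p q r lp lq lr ≋-refl , graphOn⇒realises Y ↭-refl refl g
    where Y = trihedronPiece a b p q r
  isSolid⇒spans (inj₂ (inj₂ (inj₁ (x , s , t , u , p , q , r , g)))) =
    Y , stamp x s t u p q r ≋-refl , graphOn⇒realises Y ↭-refl refl g
    where Y = stampPiece x s t u p q r
  isSolid⇒spans (inj₂ (inj₂ (inj₂ (x₁ , x₂ , x₃ , y₁ , y₂ , y₃ , p , q , r , g)))) =
    Y , prism x₁ x₂ x₃ y₁ y₂ y₃ p q r ≋-refl , graphOn⇒realises Y ↭-refl refl g
    where Y = prismPiece x₁ x₂ x₃ y₁ y₂ y₃ p q r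

  spans⇒isSolid : Spans H Solid → IsSolid H
  spans⇒isSolid (X , pyramid w c ns lc un ns⊆ ln e , re , all) =
    inj₁ (w , c , ns , lc , un , All.tabulate ns⊆ , ln ,
      realises⇒graphOn (pt w • cyc c • spokes w ns) e (pyramid-verts w c ns) (cong (_++ map (w ,_) ns) (edges-cyc c)) re all)
  spans⇒isSolid (X , trihedron a b p q r lp lq lr e , re , all) =
    inj₂ (inj₁ (a , b , p , q , r , lp , lq , lr , realises⇒graphOn (trihedronPiece a b p q r) e ↭-refl refl re all))
  spans⇒isSolid (X , stamp x s t u p q r e , re , all) =
    inj₂ (inj₂ (inj₁ (x , s , t , u , p , q , r , realises⇒graphOn (stampPiece x s t u p q r) e ↭-refl refl re all)))
  spans⇒isSolid (X , prism x₁ x₂ x₃ y₁ y₂ y₃ p q r e , re , all) =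
    inj₂ (inj₂ (inj₂ (x₁ , x₂ , x₃ , y₁ , y₂ , y₃ , p , q , r ,
      realises⇒graphOn (prismPiece x₁ x₂ x₃ y₁ y₂ y₃ p q r) e ↭-refl refl re all)))

index : ∀ {n} (S : Subset n) {x} → x ∈ˢ S → Fin ∣ S ∣
index (true  ∷ᵛ S) Vec.here      = zero
index (true  ∷ᵛ S) (Vec.there m) = suc (index S m)
index (false ∷ᵛ S) (Vec.there m) = index S m

embed-index : ∀ {n} (S : Subset n) {x} (m : x ∈ˢ S) → embed S (index S m) ≡ x
embed-index (true  ∷ᵛ S) Vec.here      = refl
embed-index (true  ∷ᵛ S) (Vec.there m) = cong suc (embed-index S m)
embed-index (false ∷ᵛ S) (Vec.there m) = cong suc (embed-index S m)

module _ (F : ∀ {n} → Piece (Fin n) → Set)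
         (F-map : ∀ {n m} (f : Fin n → Fin m) {X} → InjectiveOn f (verts X) → F X → F (mapPiece f X))
         (F-closed : ∀ {n} {X : Piece (Fin n)} → F X → Closed X)
         (F-inhabited : ∀ {n} {X : Piece (Fin n)} → F X → ∃ (_∈ verts X))
         (G : Graph) (S : Subset (Graph.order G)) where
  open Graph G

  spans⇒has : Spans (G ⟨ S ⟩) F → Has F Adj S
  spans⇒has (X , s , re , all) = has (mapPiece (embed S) X) (F-map (embed S) inj s)
    (realises-map (embed S) (F-closed s) inj (λ _ _ r → r) (λ _ _ r → r) re)
    (λ {x} m → subst₂ _∈_ (embed-index S m) (sym (verts-map (embed S) X)) (∈-map⁺ (embed S) (all (index S m))))
    (λ m → let (i , _ , eq) = ∈-map⁻ (embed S) (subst (_ ∈_) (verts-map (embed S) X) m)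
           in subst (_∈ˢ S) (sym eq) (embed-∈ S i))
    where
    inj : InjectiveOn (embed S) (verts X)
    inj _ _ = embed-injective S

  has⇒spans : Has F Adj S → Spans (G ⟨ S ⟩) F
  has⇒spans (has X s re within onto) = mapPiece r X , F-map r inj s ,
    realises-map r (F-closed s) inj
      (λ a b → subst₂ Adj (sym (embed-r (onto a))) (sym (embed-r (onto b))))
      (λ a b → subst₂ Adj (embed-r (onto a)) (embed-r (onto b))) re ,
    λ v → subst₂ _∈_ (embed-injective S (embed-r (embed-∈ S v))) (sym (verts-map r X))
            (∈-map⁺ r (within (embed-∈ S v)))
    where
    r : V → Fin ∣ S ∣
    r x with x Sub.∈? S
    ... | yes m = index S m
    -- Outside `S` the value is arbitrary; one exists because the piece has a vertex.
    ... | no  _ = index S (onto (proj₂ (F-inhabited s)))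
    embed-r : ∀ {x} → x ∈ˢ S → embed S (r x) ≡ x
    embed-r {x} m with x Sub.∈? S
    ... | yes m′ = embed-index S m′
    ... | no ¬m  = contradiction m ¬m
    inj : InjectiveOn r (verts X)
    inj a b eq = trans (sym (embed-r (onto a))) (trans (cong (embed S) eq) (embed-r (onto b)))

inhabited-resp : ∀ {A : Set} {X Y : Piece A} → X ≋ Y → ∃ (_∈ verts Y) → ∃ (_∈ verts X)
inhabited-resp e (x , m) = x , Perm.∈-resp-↭ (↭-sym (verts-↭ e)) m

cycle-inhabited : ∀ {A : Set} {X : Piece A} → Cycle X → ∃ (_∈ verts X)
cycle-inhabited (cycleOn (x ∷ c) _ e) = inhabited-resp e (x , here refl)

solid-inhabited : ∀ {A : Set} {X : Piece A} → Solid X → ∃ (_∈ verts X)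
solid-inhabited (pyramid _ _ _ _ _ _ _ e)         = inhabited-resp e (_ , here refl)
solid-inhabited (trihedron _ _ _ _ _ _ _ _ e)     = inhabited-resp e (_ , here refl)
solid-inhabited (stamp _ _ _ _ _ _ _ e)           = inhabited-resp e (_ , here refl)
solid-inhabited (prism _ _ _ _ _ _ _ _ _ e)       = inhabited-resp e (_ , here refl)

module _ (G : Graph) (S : Subset (Graph.order G)) where

  isCycle⇒has : IsCycle (G ⟨ S ⟩) → Has Cycle (Graph.Adj G) S
  isCycle⇒has = spans⇒has Cycle (λ f _ → cycle-map f) cycle-closed cycle-inhabited G S ∘ isCycle⇒spans (G ⟨ S ⟩)

  has⇒isCycle : Has Cycle (Graph.Adj G) S → IsCycle (G ⟨ S ⟩)
  has⇒isCycle = spans⇒isCycle (G ⟨ S ⟩) ∘ has⇒spans Cycle (λ f _ → cycle-map f) cycle-closed cycle-inhabited G S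

  isSolid⇒has : IsSolid (G ⟨ S ⟩) → Has Solid (Graph.Adj G) S
  isSolid⇒has = spans⇒has Solid (λ f i → solid-map f i) solid-closed solid-inhabited G S ∘ isSolid⇒spans (G ⟨ S ⟩)

  has⇒isSolid : Has Solid (Graph.Adj G) S → IsSolid (G ⟨ S ⟩)
  has⇒isSolid = spans⇒isSolid (G ⟨ S ⟩) ∘ has⇒spans Solid (λ f i → solid-map f i) solid-closed solid-inhabited G S

-- Neighbours on cycles, and paths contain no cycles

record CycleAt {A : Set} (w : A) (X : Piece A) : Set where
  constructor cycleAt
  field
    prev  : A
    mid   : List A
    next  : A
    around : X ≋ pt w • rim prev mid next • spokes w (prev ∷ next ∷ [])

lookAt : ∀ {X : Piece A} {w} → Cycle X → w ∈ verts X → CycleAt w X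
lookAt {w = w} (cycleOn c l e) w∈ with rotate-to (subst (w ∈_) (verts-cyc c) (Perm.∈-resp-↭ (verts-↭ e) w∈))
... | r , f with two-ends r (ℕ.≤-pred (ℕ.≤-trans l (ℕ.≤-reflexive (Perm.↭-length (cyc-↭ f)))))
...   | a , m , b , refl = cycleAt a m b (≋-trans e (≋-trans f (≋-trans (rim-≋ w a m b) (↷ ↷ ≡⇒≋ refl refl))))

module _ {X : Piece A} {w : A} (d : Distinct X) (at : CycleAt w X) where
  open CycleAt at

  cycleAt-off : Off w (rim prev mid next)
  cycleAt-off = split-off {X = rim prev mid next} d around

  cycleAt-avoids : Avoids w (rim prev mid next)
  cycleAt-avoids with cycleAt-off
  ... | na , nm , nb = tt , (na , nm , nb) , tt

  prev≢next : prev ≢ next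
  prev≢next with distinct-resp around d
  ... | _ ∷ (n ∷ _) = λ { refl → All≢⇒∉ n (∈-++⁺ˡ (∈-++⁺ʳ mid (here refl))) }

  prev∈ : prev ∈ verts X
  prev∈ = Perm.∈-resp-↭ (verts-↭ (≋-sym around)) (there (here refl))

  next∈ : next ∈ verts X
  next∈ = Perm.∈-resp-↭ (verts-↭ (≋-sym around)) (there (there (∈-++⁺ˡ (∈-++⁺ʳ mid (here refl)))))

  rim-joined : Joined (edges′ X) w prev × Joined (edges′ X) w next
  rim-joined =
    joined-mono (edges-≳ around) (joined-++⁺ʳ (edges′ (rim prev mid next)) (inj₁ (here refl))) ,
    joined-mono (edges-≳ around) (joined-++⁺ʳ (edges′ (rim prev mid next)) (inj₁ (there (here refl))))

module _ {A : Set} {R : A → A → Set} (R-irr : ∀ {x} → ¬ R x x) where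

  cycle-neighbours : ∀ {X w x} → Realises R X → (at : CycleAt w X) → x ∈ verts X → R w x →
                     x ∈ CycleAt.prev at ∷ CycleAt.next at ∷ []
  cycle-neighbours {x = x} re at@(cycleAt a m b e) x∈ r with Perm.∈-resp-↭ (verts-↭ e) x∈
  ... | here refl = contradiction r R-irr
  ... | there x∈′ = spokes-sound (cycleAt-avoids (distinct re) at) (realises-resp (≋-sym e) re)
                      (subst (x ∈_) (List.++-identityʳ _) x∈′) r

  cycle-degree : ∀ {X w x y z} → Cycle X → Realises R X → w ∈ verts X → x ∈ verts X → y ∈ verts X → z ∈ verts X →
    x ≢ y → x ≢ z → y ≢ z → R w x → R w y → R w z → ⊥
  cycle-degree {X} {w} {x} {y} {z} c re w∈ x∈ y∈ z∈ x≢y x≢z y≢z rx ry rz = ℕ.<-irrefl refl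
    (unique-⊆-length {xs = x ∷ y ∷ z ∷ []} ((x≢y ∷ x≢z ∷ []) ∷ (y≢z ∷ []) ∷ [] ∷ [])
      (λ { (here refl) → nb x∈ rx ; (there (here refl)) → nb y∈ ry ; (there (there (here refl))) → nb z∈ rz }))
    where
    at = lookAt c w∈
    nb : ∀ {x} → x ∈ verts X → R w x → x ∈ CycleAt.prev at ∷ CycleAt.next at ∷ []
    nb = cycle-neighbours re at

TwoNeighbours : List (A × A) → List A → Set
TwoNeighbours es W = ∀ {w} → w ∈ W →
  ∃[ y ] ∃[ y′ ] y ≢ y′ × (y ∈ W × Joined es w y) × (y′ ∈ W × Joined es w y′)

joined-path-∈ : ∀ {xs : List A} {x y} → Joined (path xs) x y → x ∈ xs × y ∈ xs
joined-path-∈ {xs = xs} (inj₁ m) = onEnds-path {xs = xs} (All.tabulate id) m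
joined-path-∈ {xs = xs} (inj₂ m) = let (a , b) = onEnds-path {xs = xs} (All.tabulate id) m in b , a

joined-path-head : ∀ {x y : A} {xs z} → x ∉ y ∷ xs → Joined (path (x ∷ y ∷ xs)) x z → z ≡ y
joined-path-head x∉ (inj₁ (here refl)) = refl
joined-path-head x∉ (inj₂ (here refl)) = contradiction (here refl) x∉
joined-path-head {y = y} {xs} x∉ (inj₁ (there m)) = contradiction (proj₁ (joined-path-∈ {xs = y ∷ xs} (inj₁ m))) x∉
joined-path-head {y = y} {xs} x∉ (inj₂ (there m)) = contradiction (proj₁ (joined-path-∈ {xs = y ∷ xs} (inj₂ m))) x∉

joined-path-tail : ∀ {x y : A} {xs w z} → x ≢ w → x ≢ z → Joined (path (x ∷ y ∷ xs)) w z → Joined (path (y ∷ xs)) w z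
joined-path-tail x≢w x≢z (inj₁ (here refl)) = contradiction refl x≢w
joined-path-tail x≢w x≢z (inj₂ (here refl)) = contradiction refl x≢z
joined-path-tail x≢w x≢z (inj₁ (there m))   = inj₁ m
joined-path-tail x≢w x≢z (inj₂ (there m))   = inj₂ m

module _ {A : Set} (_≟_ : DecidableEquality A) where
  open DecMembership _≟_ using (_∈?_)

  -- The vertex of `W` that comes first along `P` has at most one neighbour in `W`, its successor.
  -- Vertices of `P` before it are discarded one by one.
  path-acyclic : ∀ P → Unique P → ∀ W {w} → w ∈ W → W ⊆ P → TwoNeighbours (path P) W → ⊥
  path-acyclic [] _ W w∈ W⊆ two with W⊆ w∈
  ... | ()
  path-acyclic (x ∷ []) _ W w∈ W⊆ two with two w∈
  ... | _ , _ , _ , (_ , inj₁ ()) , _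
  ... | _ , _ , _ , (_ , inj₂ ()) , _
  path-acyclic (x ∷ y ∷ P) (x∉ ∷ u) W w∈ W⊆ two with x ∈? W
  ... | yes x∈ with two x∈
  ...   | a , b , a≢b , (_ , ja) , (_ , jb) =
    a≢b (trans (joined-path-head (All≢⇒∉ x∉) ja) (sym (joined-path-head (All≢⇒∉ x∉) jb)))
  path-acyclic (x ∷ y ∷ P) (x∉ ∷ u) W w∈ W⊆ two | no x∉W = path-acyclic (y ∷ P) u W w∈
    (λ m → case W⊆ m of λ { (here refl) → contradiction m x∉W ; (there m′) → m′ })
    (λ m → let (a , b , a≢b , (a∈ , ja) , (b∈ , jb)) = two m in
       a , b , a≢b , (a∈ , joined-path-tail (off-x m) (off-x a∈) ja) , (b∈ , joined-path-tail (off-x m) (off-x b∈) jb))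
    where
    off-x : ∀ {z} → z ∈ W → x ≢ z
    off-x m refl = x∉W m

ring-cyc : ∀ (a b : A) p q → pt a • pt b • arc a p b • arc a q b ≋ cyc (a ∷ p ++ b ∷ reverse q)
ring-cyc a b p q = begin
  pt a • pt b • arc a p b • arc a q b ≈⟨ ↷ ↷ ↷ arc-reverse a q b ⟩
  _ ≈⟨ solve 4 (λ a b p q → a ⊕ b ⊕ p ⊕ q ⊜ a ⊕ p ⊕ b ⊕ q) ≋-refl _ _ _ _ ⟩
  _ ≈⟨ ↷ arc-++ a p b (reverse q) a ⟨
  cyc (a ∷ p ++ b ∷ reverse q) ∎

module _ {n} {R : Fin n → Fin n → Set} (R-irr : ∀ {x} → ¬ R x x) where

  -- Removing `z` from the induced cycle on `S` leaves a path that contains all of `X`. A claw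
  -- contradicts the degrees in the cycle, a ring contradicts `path-acyclic`.
  nonPath-not-cycle : ∀ {X S z} → Realises R X → NonPath X → z ∉ verts X → Has Cycle R S → z ∈ˢ S →
    (∀ {x} → x ∈ verts X → x ∈ˢ S) → ⊥
  nonPath-not-cycle {X} {S} {z} re (claw a x y w Y e) z∉ H z∈ X⊆ with distinct-resp e (distinct re)
  ... | _ ∷ (x≢y ∷ x≢w ∷ _) ∷ (y≢w ∷ _) ∷ _ =
    cycle-degree R-irr (shape H) (real H) (in-H (here refl)) (in-H (there (here refl))) (in-H (there (there (here refl))))
      (in-H (there (there (there (here refl))))) x≢y x≢w y≢w
      (adj (there (here refl)) (here refl)) (adj (there (there (here refl))) (there (here refl)))
      (adj (there (there (there (here refl)))) (there (there (here refl))))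
    where
    in-X : ∀ {t} → t ∈ a ∷ x ∷ y ∷ w ∷ verts Y → t ∈ verts X
    in-X m = Perm.∈-resp-↭ (verts-↭ (≋-sym e)) m
    in-H : ∀ {t} → t ∈ a ∷ x ∷ y ∷ w ∷ verts Y → t ∈ verts (piece H)
    in-H m = within H (X⊆ (in-X m))
    adj : ∀ {t} → t ∈ a ∷ x ∷ y ∷ w ∷ verts Y → (a , t) ∈ (a , x) ∷ (a , y) ∷ (a , w) ∷ edges′ Y → R a t
    adj m m′ = complete re (in-X (here refl)) (in-X m) (joined-mono (edges-≳ e) (inj₁ m′))
  nonPath-not-cycle {X} {S} {z} re (ring a b p q Y l e) z∉ H z∈ X⊆ =
    path-acyclic Fin._≟_ P (subst Unique P≡ (distinct rimR)) (a ∷ p ++ b ∷ reverse q) (here refl) (λ m → in-P (in-X m)) two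
    where
    at = lookAt (shape H) (within H z∈)
    open CycleAt at renaming (around to C≋)
    P = prev ∷ mid ∷ʳ next
    rimR : Realises R (rim prev mid next)
    rimR = realises-rest (cycleAt-avoids (distinct (real H)) at) (realises-resp (≋-sym C≋) (real H))
    P≡ : verts (rim prev mid next) ≡ P
    P≡ = refl
    c = a ∷ p ++ b ∷ reverse q
    e′ : X ≋ cyc c • Y
    e′ = ≋-trans e (≋-trans (solve 5 (λ a b p q y → a ⊕ b ⊕ p ⊕ q ⊕ y ⊜ (a ⊕ b ⊕ p ⊕ q) ⊕ y) ≋-refl _ _ _ _ _)
           (•-cong (ring-cyc a b p q) ≋-refl))
    in-X : c ⊆ verts X
    in-X m = Perm.∈-resp-↭ (verts-↭ (≋-sym e′)) (∈-++⁺ˡ m)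
    in-P : ∀ {x} → x ∈ verts X → x ∈ P
    in-P {x} m with Perm.∈-resp-↭ (verts-↭ C≋) (within H (X⊆ m))
    ... | here refl = contradiction m z∉
    ... | there m′  = subst (x ∈_) (List.++-identityʳ _) m′
    3≤c : 3 ≤ⁿ length c
    3≤c = s≤s (subst (2 ≤ⁿ_) (sym (trans (List.length-++ p)
            (trans (ℕ.+-suc _ _) (cong (λ k → suc (length p +ⁿ k)) (List.length-reverse q)))))
            (s≤s (subst (1 ≤ⁿ_) (List.length-++ p) l)))
    path-joined : ∀ {x y} → x ∈ verts X → y ∈ verts X → R x y → Joined (path P) x y
    path-joined x∈ y∈ r = subst (λ es → Joined es _ _) (List.++-identityʳ _) (sound rimR (in-P x∈) (in-P y∈) r)
    two : TwoNeighbours (path P) c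
    two {w} m = CycleAt.prev wt , CycleAt.next wt , prev≢next dc wt ,
      (prev∈ dc wt , nbr (prev∈ dc wt) (proj₁ (rim-joined dc wt))) ,
      (next∈ dc wt , nbr (next∈ dc wt) (proj₂ (rim-joined dc wt)))
      where
      dc : Distinct (cyc c)
      dc = distinctˡ (cyc c) Y (distinct-resp e′ (distinct re))
      wt = lookAt (cycleOn c 3≤c ≋-refl) m
      nbr : ∀ {y} → y ∈ c → Joined (edges′ (cyc c)) w y → Joined (path P) w y
      nbr y∈ j = path-joined (in-X m) (in-X y∈)
        (complete re (in-X m) (in-X y∈) (joined-mono (edges-≳ e′) (joined-++⁺ˡ j)))

member? : ∀ {n} (x : Fin n) (xs : List (Fin n)) → Dec (x ∈ xs)
member? = DecMembership._∈?_ Fin._≟_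

abstract
  setOf : ∀ {n} → List (Fin n) → Subset n
  setOf xs = Vec.tabulate λ x → does (member? x xs)

  ∈-setOf⁺ : ∀ {n} {x : Fin n} {xs} → x ∈ xs → x ∈ˢ setOf xs
  ∈-setOf⁺ {x = x} {xs} m = lookup⇒[]= x (setOf xs) (trans (lookup∘tabulate _ x) (dec-true (member? x xs) m))

  ∈-setOf⁻ : ∀ {n} {x : Fin n} {xs} → x ∈ˢ setOf xs → x ∈ xs
  ∈-setOf⁻ {x = x} {xs} m with member? x xs | trans (sym (lookup∘tabulate (λ x → does (member? x xs)) x)) ([]=⇒lookup m)
  ... | yes p | _ = p
  ... | no ¬p | ()

hasPiece : ∀ {n} {F : Piece (Fin n) → Set} {R : Fin n → Fin n → Set} (X : Piece (Fin n)) → F X → Realises R X →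
  Has F R (setOf (verts X))
hasPiece X s re = has X s re ∈-setOf⁻ ∈-setOf⁺

-- Contracting an edge

-- The vertex set is kept: u takes over the neighbours of v, and v becomes isolated.
contract : (G : Graph) (u v : Graph.V G) → Graph
contract G u v = record
  { order  = order
  ; Adj    = λ x y → x ≢ v × y ≢ v × (Adj x y ⊎ (x ≡ u × y ≢ u × Adj v y) ⊎ (y ≡ u × x ≢ u × Adj v x))
  ; adj?   = λ x y → ¬? (x Fin.≟ v) ×-dec ¬? (y Fin.≟ v) ×-dec
                     (adj? x y ⊎-dec ((x Fin.≟ u) ×-dec ¬? (y Fin.≟ u) ×-dec adj? v y)
                               ⊎-dec ((y Fin.≟ u) ×-dec ¬? (x Fin.≟ u) ×-dec adj? v x))
  ; symm   = λ { (a , b , inj₁ r) → b , a , inj₁ (symm r)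
               ; (a , b , inj₂ (inj₁ r)) → b , a , inj₂ (inj₂ r)
               ; (a , b , inj₂ (inj₂ r)) → b , a , inj₂ (inj₁ r) }
  ; irrefl = λ { refl (_ , _ , inj₁ r) → irrefl refl r
               ; refl (_ , _ , inj₂ (inj₁ (p , q , _))) → q p
               ; refl (_ , _ , inj₂ (inj₂ (p , q , _))) → q p }
  }
  where open Graph G

module _ (G : Graph) where
  open Graph G

  irr : ∀ {x} → ¬ Adj x x
  irr = irrefl refl

  -- For an induced cycle `Q` through `a` but not `b`: if `a` dominates `b`, merging `b` into `a`
  -- adds no edge within `Q`; otherwise `a` acquires a chord.
  Dominates : V → V → Subset order → Set
  Dominates a b Q = ∀ y → y ∈ˢ Q → y ≢ a → y ≢ b → Adj b y → Adj a y

  Undominated : V → V → Subset order → Set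
  Undominated a b Q = ∃[ y ] y ∈ˢ Q × y ≢ a × y ≢ b × Adj b y × ¬ Adj a y

  dominates? : ∀ a b Q → Dominates a b Q ⊎ Undominated a b Q
  dominates? a b Q with Fin.any? (λ y → (y Sub.∈? Q) ×-dec ¬? (y Fin.≟ a) ×-dec ¬? (y Fin.≟ b) ×-dec adj? b y ×-dec ¬? (adj? a y))
  ... | yes p = inj₂ p
  ... | no ¬p = inj₁ dom
    where
    dom : Dominates a b Q
    dom y y∈ y≢a y≢b r with adj? a y
    ... | yes r′ = r′
    ... | no ¬r  = contradiction (y , y∈ , y≢a , y≢b , r , ¬r) ¬p

  record _≈[_,_]_ (S : Subset order) (u v : V) (T : Subset order) : Set where
    constructor agree
    field
      ahead : ∀ {x} → x ≢ u → x ≢ v → x ∈ˢ S → x ∈ˢ T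
      back  : ∀ {x} → x ≢ u → x ≢ v → x ∈ˢ T → x ∈ˢ S
  open _≈[_,_]_ public

  In : Bool → V → Subset order → Set
  In true  x S = x ∈ˢ S
  In false x S = ¬ x ∈ˢ S

  -- A structure that differs from `S` at most in `u` and `v`. The Booleans record its trace on
  -- these two, which together with `S` determines the set.
  Moved : (F : Piece V → Set) (R : V → V → Set) (u v : V) (S : Subset order) (bu bv : Bool) → Set
  Moved F R u v S bu bv = ∃[ T ] Has F R T × S ≈[ u , v ] T × In bu u T × In bv v T

  moved : ∀ {F R u v S} {bu bv : Bool} X → F X → Realises R X →
    (∀ {x} → x ≢ u → x ≢ v → x ∈ˢ S → x ∈ verts X) → (∀ {x} → x ≢ u → x ≢ v → x ∈ verts X → x ∈ˢ S) →
    In bu u (setOf (verts X)) → In bv v (setOf (verts X)) → Moved F R u v S bu bv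
  moved X f re to from iu iv =
    setOf (verts X) , hasPiece X f re ,
    agree (λ a b m → ∈-setOf⁺ (to a b m)) (λ a b m → from a b (∈-setOf⁻ m)) , iu , iv

  -- Covers `none`, `single` and `pair` of `Attached` at once. It is refuted in two ways: by two
  -- neighbours that are not adjacent and by a third neighbour.
  AtMostAnEdge : V → Subset order → Set
  AtMostAnEdge z Q = ∀ {x y} → x ∈ˢ Q → y ∈ˢ Q → x ≢ y → Adj z x → Adj z y →
    Adj x y × (∀ {w} → w ∈ˢ Q → Adj z w → w ≡ x ⊎ w ≡ y)

  cycle-plus-vertex : ∀ {Q z} → Has Cycle Adj Q → ¬ z ∈ˢ Q →
    (∃[ X ] Solid X × Realises Adj X × (∀ {x} → x ∈ verts X → x ≡ z ⊎ x ∈ˢ Q) × (∀ {x} → x ≡ z ⊎ x ∈ˢ Q → x ∈ verts X))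
    ⊎ AtMostAnEdge z Q
  cycle-plus-vertex {Q} {z} (has X (cycleOn c l e) re into onto) z∉ =
    case attach z c ns l (Unique.filter⁺ (adj? z) (subst Unique (verts-cyc c) (distinct-resp e (distinct re))))
           (λ m → proj₁ (∈-filter⁻ (adj? z) m)) of go refl
    where
    ns = filter (adj? z) c
    c⊆ : ∀ {x} → x ∈ c → x ∈ verts X
    c⊆ m = Perm.∈-resp-↭ (verts-↭ (≋-sym e)) (subst (_ ∈_) (sym (verts-cyc c)) m)
    X⊆ : ∀ {x} → x ∈ verts X → x ∈ c
    X⊆ m = subst (_ ∈_) (verts-cyc c) (Perm.∈-resp-↭ (verts-↭ e) m)
    nbr : ∀ {x} → x ∈ˢ Q → Adj z x → x ∈ ns
    nbr m r = ∈-filter⁺ (adj? z) (X⊆ (into m)) r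
    Goal = (∃[ X ] Solid X × Realises Adj X × (∀ {x} → x ∈ verts X → x ≡ z ⊎ x ∈ˢ Q) × (∀ {x} → x ≡ z ⊎ x ∈ˢ Q → x ∈ verts X))
           ⊎ AtMostAnEdge z Q
    go : ∀ {ms} → ms ≡ ns → Attached z c ms → Goal
    go eq (solid s) = inj₁ (pt z • cyc c • spokes z ns , subst (λ ms → Solid (pt z • cyc c • spokes z ms)) eq s ,
      realises-spokes symm irr (realises-resp (≋-sym e) re) (λ m → z∉ (onto (c⊆ (subst (z ∈_) (verts-cyc c) m))))
        (onEnds (cyc c) (avoids-cyc c (λ m → z∉ (onto (c⊆ m))))) (λ m → subst (_ ∈_) (sym (verts-cyc c)) (proj₁ (∈-filter⁻ (adj? z) m)))
        (λ m r → ∈-filter⁺ (adj? z) (subst (_ ∈_) (verts-cyc c) m) r) (λ m → proj₂ (∈-filter⁻ (adj? z) {xs = c} m)) ,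
      (λ { (here eq) → inj₁ eq
         ; (there m) → inj₂ (onto (c⊆ (subst (_ ∈_) (trans (List.++-identityʳ _) (verts-cyc c)) m))) }) ,
      λ { (inj₁ eq) → here eq
        ; (inj₂ m) → there (subst (_ ∈_) (sym (trans (List.++-identityʳ _) (verts-cyc c))) (X⊆ (into m))) })
    go eq none = inj₂ λ {x} x∈ _ _ rx _ → case subst (x ∈_) (sym eq) (nbr x∈ rx) of λ ()
    go eq single = inj₂ λ {x} {y} x∈ y∈ x≢y rx ry →
      case subst (x ∈_) (sym eq) (nbr x∈ rx) of λ { (here refl) → case subst (y ∈_) (sym eq) (nbr y∈ ry) of λ
        { (here refl) → contradiction refl x≢y } }
    go eq (pair {d} {d′} p _ f) = inj₂ edge
      where
      two : ∀ {x} → x ∈ˢ Q → Adj z x → x ≡ d ⊎ x ≡ d′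
      two {x} m r with subst (x ∈_) (sym eq) (nbr m r)
      ... | here e₁         = inj₁ e₁
      ... | there (here e₂) = inj₂ e₂
      g = ≋-trans e f
      dd′ : Adj d d′
      dd′ = complete re (Perm.∈-resp-↭ (verts-↭ (≋-sym g)) (here refl)) (Perm.∈-resp-↭ (verts-↭ (≋-sym g)) (there (here refl)))
              (joined-mono (edges-≳ g) (inj₁ (here refl)))
      edge : AtMostAnEdge z Q
      edge x∈ y∈ x≢y rx ry with two x∈ rx | two y∈ ry
      ... | inj₁ refl | inj₁ refl = contradiction refl x≢y
      ... | inj₁ refl | inj₂ refl = dd′ , two
      ... | inj₂ refl | inj₁ refl = symm dd′ , (λ m r → swap (two m r))
      ... | inj₂ refl | inj₂ refl = contradiction refl x≢y

  module Contraction {u v : V} (uv : Adj u v) where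

    u≢v : u ≢ v
    u≢v refl = irr uv

    G/uv : Graph
    G/uv = contract G u v

    open Graph G/uv using () renaming (Adj to Adj′; irrefl to irrefl′)

    lower : ∀ {x y} → x ≢ u → y ≢ u → Adj′ x y → Adj x y
    lower _   _   (_ , _ , inj₁ r)                  = r
    lower x≢u _   (_ , _ , inj₂ (inj₁ (x≡u , _)))   = contradiction x≡u x≢u
    lower _   y≢u (_ , _ , inj₂ (inj₂ (y≡u , _)))   = contradiction y≡u y≢u

    at-u : ∀ {x} → x ≢ u → Adj′ u x → Adj u x ⊎ Adj v x
    at-u _   (_ , _ , inj₁ r)                    = inj₁ r
    at-u _   (_ , _ , inj₂ (inj₁ (_ , _ , r)))   = inj₂ r
    at-u x≢u (_ , _ , inj₂ (inj₂ (x≡u , _ , _))) = contradiction x≡u x≢u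

    from-u : ∀ {x} → x ≢ v → Adj u x → Adj′ u x
    from-u x≢v r = u≢v , x≢v , inj₁ r

    from-v : ∀ {x} → x ≢ u → x ≢ v → Adj v x → Adj′ u x
    from-v x≢u x≢v r = u≢v , x≢v , inj₂ (inj₁ (refl , x≢u , r))

    cycle-stays : ∀ {Q} → Has Cycle Adj Q → ¬ v ∈ˢ Q → (u ∈ˢ Q → Dominates u v Q) → Has Cycle Adj′ Q
    cycle-stays {Q} (has X f re into onto) v∉ dom = has X f (realises-cong to from re) into onto
      where
      ≢v : ∀ {x} → x ∈ verts X → x ≢ v
      ≢v m refl = v∉ (onto m)
      to : ∀ {x y} → x ∈ verts X → y ∈ verts X → Adj x y → Adj′ x y
      to x∈ y∈ r = ≢v x∈ , ≢v y∈ , inj₁ r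
      from : ∀ {x y} → x ∈ verts X → y ∈ verts X → Adj′ x y → Adj x y
      from x∈ y∈ (_ , _ , inj₁ r) = r
      from x∈ y∈ (_ , y≢v , inj₂ (inj₁ (refl , y≢u , r))) = dom (onto x∈) _ (onto y∈) y≢u y≢v r
      from x∈ y∈ (x≢v , _ , inj₂ (inj₂ (refl , x≢u , r))) = symm (dom (onto y∈) _ (onto x∈) x≢u x≢v r)

    rename : V → V
    rename x with x Fin.≟ v
    ... | yes _ = u
    ... | no  _ = x

    rename-v : rename v ≡ u
    rename-v with v Fin.≟ v
    ... | yes _ = refl
    ... | no n  = contradiction refl n

    rename-≢ : ∀ {x} → x ≢ v → rename x ≡ x
    rename-≢ {x} n with x Fin.≟ v
    ... | yes p = contradiction p n
    ... | no _  = refl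

    -- After the contraction `u` has the neighbours of both vertices, and on `Q` those of `u` are
    -- among those of `v`; so `u` takes the place of `v` without a new edge.
    cycle-moves : ∀ {Q} → Has Cycle Adj Q → v ∈ˢ Q → ¬ u ∈ˢ Q → Dominates v u Q → Moved Cycle Adj′ u v Q true false
    cycle-moves {Q} (has X f re into onto) v∈ u∉ dom =
      moved (mapPiece rename X) (cycle-map rename f)
        (realises-map rename (cycle-closed f) inj to from re)
        (λ {x} _ x≢v m → image (subst (_∈ map rename (verts X)) (rename-≢ x≢v) (∈-map⁺ rename (into m))))
        (λ {x} x≢u x≢v m → pre x≢u (preimage m))
        (∈-setOf⁺ (image (subst (_∈ map rename (verts X)) rename-v (∈-map⁺ rename (into v∈)))))
        (λ m → no-v (preimage (∈-setOf⁻ m)))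
      where
      image : ∀ {x} → x ∈ map rename (verts X) → x ∈ verts (mapPiece rename X)
      image {x} = subst (x ∈_) (sym (verts-map rename X))
      preimage : ∀ {x} → x ∈ verts (mapPiece rename X) → ∃[ y ] y ∈ verts X × x ≡ rename y
      preimage {x} m = ∈-map⁻ rename (subst (x ∈_) (verts-map rename X) m)
      pre : ∀ {x} → x ≢ u → ∃[ y ] y ∈ verts X × x ≡ rename y → x ∈ˢ Q
      pre x≢u (y , m , eq) with y Fin.≟ v
      ... | yes _ = contradiction eq x≢u
      pre x≢u (y , m , refl) | no _ = onto m
      no-v : ¬ (∃[ y ] y ∈ verts X × v ≡ rename y)
      no-v (y , m , eq) with y Fin.≟ v
      ... | yes _ = u≢v (sym eq)
      ... | no n  = n (sym eq)
      ≢u : ∀ {x} → x ∈ verts X → x ≢ u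
      ≢u m refl = u∉ (onto m)
      inj : InjectiveOn rename (verts X)
      inj {x} {y} x∈ y∈ eq with x Fin.≟ v | y Fin.≟ v
      ... | yes refl | yes refl = refl
      ... | yes _    | no _     = contradiction (sym eq) (≢u y∈)
      ... | no _     | yes _    = contradiction eq (≢u x∈)
      ... | no _     | no _     = eq
      to : ∀ {x y} → x ∈ verts X → y ∈ verts X → Adj x y → Adj′ (rename x) (rename y)
      to {x} {y} x∈ y∈ r with x Fin.≟ v | y Fin.≟ v
      ... | yes refl | yes refl = contradiction r irr
      ... | yes refl | no y≢v   = from-v (≢u y∈) y≢v r
      ... | no x≢v   | yes refl = Graph.symm G/uv (from-v (≢u x∈) x≢v (symm r))
      ... | no x≢v   | no y≢v   = x≢v , y≢v , inj₁ r
      from : ∀ {x y} → x ∈ verts X → y ∈ verts X → Adj′ (rename x) (rename y) → Adj x y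
      from {x} {y} x∈ y∈ r with x Fin.≟ v | y Fin.≟ v
      ... | yes refl | yes refl = contradiction r (irrefl′ refl)
      ... | yes refl | no y≢v   = [ dom _ (onto y∈) y≢v (≢u y∈) , id ]′ (at-u (≢u y∈) r)
      ... | no x≢v   | yes refl = symm ([ dom _ (onto x∈) x≢v (≢u x∈) , id ]′ (at-u (≢u x∈) (Graph.symm G/uv r)))
      ... | no x≢v   | no y≢v   = lower (≢u x∈) (≢u y∈) r

-- Lifting solids and shrinking cycles

module Lifts (G : Graph) {u v : Graph.V G} (uv : Graph.Adj G u v) where
  open Graph G
  open Contraction G uv
  open Graph G/uv using () renaming (Adj to Adj′; symm to symm′; irrefl to irrefl′)

  -- Every vertex of a solid has a neighbour in it, whereas `v` has none in the contraction.
  isolated : ∀ {S} → Has Solid Adj′ S → ¬ v ∈ˢ S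
  isolated (has X f re into onto) v∈ with view Fin._≟_ f (distinct re) (into v∈)
  ... | mkView Y N e av N⊆ (c , c∈) _ _ =
    proj₁ (spokes-complete av (realises-resp (≋-sym e) re) N⊆ c∈) refl

  solid-stays : ∀ {S} → Has Solid Adj′ S → ¬ u ∈ˢ S → Has Solid Adj S
  solid-stays H@(has X f re into onto) u∉ = has X f (realises-cong
    (λ x∈ y∈ → lower (≢u x∈) (≢u y∈)) (λ x∈ y∈ r → ≢v x∈ , ≢v y∈ , inj₁ r) re) into onto
    where
    ≢u : ∀ {x} → x ∈ verts X → x ≢ u
    ≢u m refl = u∉ (onto m)
    ≢v : ∀ {x} → x ∈ verts X → x ≢ v
    ≢v m refl = isolated H (onto m)

  enlarge : ∀ {Q z w} → (z ≡ v × w ≡ u) ⊎ (z ≡ u × w ≡ v) → w ∈ˢ Q →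
    ∃[ X ] Solid X × Realises Adj X × (∀ {x} → x ∈ verts X → x ≡ z ⊎ x ∈ˢ Q) × (∀ {x} → x ≡ z ⊎ x ∈ˢ Q → x ∈ verts X) →
    Moved G Solid Adj u v Q true true
  enlarge (inj₁ (refl , refl)) w∈ (X , s , re , to , from) = moved G {bu = true} {bv = true} X s re (λ _ _ m → from (inj₂ m))
    (λ _ x≢v m → [ (λ eq → contradiction eq x≢v) , id ]′ (to m)) (∈-setOf⁺ (from (inj₂ w∈))) (∈-setOf⁺ (from (inj₁ refl)))
  enlarge (inj₂ (refl , refl)) w∈ (X , s , re , to , from) = moved G {bu = true} {bv = true} X s re (λ _ _ m → from (inj₂ m))
    (λ x≢u _ m → [ (λ eq → contradiction eq x≢u) , id ]′ (to m)) (∈-setOf⁺ (from (inj₁ refl))) (∈-setOf⁺ (from (inj₂ w∈)))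

  -- On the cycle `z` sees both `w` and the witness `y`, and these are not adjacent, so the
  -- neighbours of `z` are more than an edge.
  undominated-solid : ∀ {Q z w} → (z ≡ v × w ≡ u) ⊎ (z ≡ u × w ≡ v) → Adj z w →
    Has Cycle Adj Q → w ∈ˢ Q → ¬ z ∈ˢ Q → Undominated G w z Q → Moved G Solid Adj u v Q true true
  undominated-solid zw r H w∈ z∉ (y , y∈ , y≢w , _ , ry , ¬r) with cycle-plus-vertex G H z∉
  ... | inj₁ X = enlarge zw w∈ X
  ... | inj₂ k = contradiction (proj₁ (k w∈ y∈ (≢-sym y≢w) r ry)) ¬r

  -- On the cycle `u` sees `v` and, by domination, both neighbours of `v`: three vertices.
  double-solid : ∀ {Q} → Has Cycle Adj Q → v ∈ˢ Q → ¬ u ∈ˢ Q → Dominates G u v Q → Moved G Solid Adj u v Q true true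
  double-solid {Q} H v∈ u∉ dom with cycle-plus-vertex G H u∉
  ... | inj₁ X = enlarge (inj₂ (refl , refl)) v∈ X
  ... | inj₂ k = contradiction (proj₂ (k v∈ (onto H (prev∈ d at)) (≢-sym (≢v rp)) uv (to-u (prev∈ d at) rp)) (onto H (next∈ d at)) (to-u (next∈ d at) rn))
      [ ≢v rn , (λ eq → prev≢next d at (sym eq)) ]′
    where
    at = lookAt (shape H) (within H v∈)
    open CycleAt at
    d = distinct (real H)
    ≢v : ∀ {x} → Adj v x → x ≢ v
    ≢v r refl = irr G r
    rp : Adj v prev
    rp = complete (real H) (within H v∈) (prev∈ d at) (proj₁ (rim-joined d at))
    rn : Adj v next
    rn = complete (real H) (within H v∈) (next∈ d at) (proj₂ (rim-joined d at))
    to-u : ∀ {x} → x ∈ verts (piece H) → Adj v x → Adj u x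
    to-u m r = dom _ (onto H m) (λ { refl → u∉ (onto H m) }) (≢v r) r

  Triangle : Subset order → Set
  Triangle Q = ∃[ d ] d ≢ u × d ≢ v × Adj u d × Adj v d × d ∈ˢ Q × (∀ {x} → x ∈ˢ Q → x ≡ u ⊎ x ≡ v ⊎ x ≡ d)

  -- The two witnesses tell this cycle from cycles through only one of `u`, `v` that have the same
  -- image.
  Shrunk : Subset order → Set
  Shrunk Q = Moved G Cycle Adj′ u v Q true false × Undominated G u v Q × Undominated G v u Q

  -- On the cycle `u` lies between `v` and `d`, and `m` leads from `v` to `d`. If `m` is empty, this
  -- is a triangle. Otherwise let `x` be the vertex after `v`: merging `v` into `u` leaves a cycle
  -- through `d`, `u`, `x`. Since the old cycle is induced, `x` is not adjacent to `u` nor `d` to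
  -- `v`, which gives the two witnesses.
  shrink-from : ∀ {Q X m d} → X ≋ pt u • rim v m d • spokes u (v ∷ d ∷ []) → Realises Adj X →
    (∀ {x} → x ∈ˢ Q → x ∈ verts X) → (∀ {x} → x ∈ verts X → x ∈ˢ Q) → Triangle Q ⊎ Shrunk Q
  shrink-from {Q} {X} {[]} {d} e re into onto with distinct-resp e (distinct re)
  ... | (_ ∷ u≢d ∷ _) ∷ (v≢d ∷ _) ∷ _ = inj₁
    (d , ≢-sym u≢d , ≢-sym v≢d ,
     complete re (at (here refl)) (at (there (there (here refl)))) (joined-mono (edges-≳ e) (inj₁ (there (there (here refl))))) ,
     complete re (at (there (here refl))) (at (there (there (here refl)))) (joined-mono (edges-≳ e) (inj₁ (here refl))) ,
     onto (at (there (there (here refl)))) ,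
     (λ m → case Perm.∈-resp-↭ (verts-↭ e) (into m) of λ
       { (here eq) → inj₁ eq ; (there (here eq)) → inj₂ (inj₁ eq) ; (there (there (here eq))) → inj₂ (inj₂ eq) }))
    where
    at : ∀ {x} → x ∈ u ∷ v ∷ d ∷ [] → x ∈ verts X
    at m = Perm.∈-resp-↭ (verts-↭ (≋-sym e)) m
  shrink-from {Q} {X} {x ∷ m} {d} e re into onto =
    inj₂ (moved G {bu = true} {bv = false} Z (cycleOn (u ∷ x ∷ m ∷ʳ d) (s≤s (s≤s (nonempty-mid m))) (≋-sym (≋-trans (rim-≋ u x m d) (↷ ↷ ≡⇒≋ refl refl))))
        reZ (λ x≢u x≢v m → there (∈-++⁺ˡ (strip x≢u x≢v (Perm.∈-resp-↭ (verts-↭ e′) (into m)))))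
        (λ { x≢u x≢v (here eq) → contradiction eq x≢u
           ; {x} x≢u x≢v (there m) → onto (in-X (subst (x ∈_) (List.++-identityʳ _) m)) })
        (∈-setOf⁺ {xs = verts Z} (here refl))
        (λ m → case ∈-setOf⁻ {xs = verts Z} m of λ { (here eq) → u≢v (sym eq) ; (there m) → v∉Y (subst (v ∈_) (List.++-identityʳ _) m) }) ,
      (x , onto (in-X x∈Y) , ≢u x∈Y , ≢v x∈Y , vx , λ r → x≢d (only-d x∈Y r)) ,
      (d , onto (in-X d∈Y) , ≢v d∈Y , ≢u d∈Y , ud , λ r → x≢d (sym (only-x d∈Y r))))
    where
    Y = rim x m d
    W = pt v • Y • spokes v (x ∷ [])
    Z = pt u • Y • spokes u (x ∷ d ∷ [])
    e′ : X ≋ pt u • W • spokes u (v ∷ d ∷ [])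
    e′ = begin
      X ≈⟨ e ⟩
      pt u • (pt v • arc v (x ∷ m) d • pt d) • spokes u (v ∷ d ∷ [])
        ≈⟨ ↷ •-cong (↷ •-cong (arc-∷ v x m d) ≋-refl) ≋-refl ⟩
      pt u • (pt v • (ed v x • pt x • arc x m d) • pt d) • spokes u (v ∷ d ∷ [])
        ≈⟨ solve 7 (λ u v e x m d s → u ⊕ (v ⊕ (e ⊕ x ⊕ m) ⊕ d) ⊕ s ⊜ u ⊕ (v ⊕ (x ⊕ m ⊕ d) ⊕ e) ⊕ s) ≋-refl _ _ _ _ _ _ _ ⟩
      pt u • (pt v • Y • ed v x) • spokes u (v ∷ d ∷ []) ≈⟨ ↷ •-cong (↷ ↷ ≡⇒≋ refl refl) ≋-refl ⟩
      pt u • W • spokes u (v ∷ d ∷ []) ∎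
    re′ = realises-resp (≋-sym e′) re
    avW : Avoids u W
    avW = case split-off {X = W} (distinct re) e′ of λ
      { (nv , (nx , nm , nd) , _) → tt , (tt , (nx , nm , nd) , tt) , (nv , nx ∷ []) }
    reW = realises-rest avW re′
    avY : Avoids v Y
    avY = case split-off {X = Y} {N = x ∷ []} (distinct reW) ≋-refl of λ { (nx , nm , nd) → tt , (nx , nm , nd) , tt }
    reY = realises-rest avY reW
    v∉Y = spokes-∉ avY reW
    u∉Y : u ∉ verts Y
    u∉Y m = spokes-∉ avW re′ (there (∈-++⁺ˡ m))
    in-W : ∀ {y} → y ∈ verts Y → y ∈ verts W
    in-W m = there (∈-++⁺ˡ m)
    in-X : ∀ {y} → y ∈ verts Y → y ∈ verts X
    in-X m = Perm.∈-resp-↭ (verts-↭ (≋-sym e′)) (there (∈-++⁺ˡ (in-W m)))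
    ≢u : ∀ {y} → y ∈ verts Y → y ≢ u
    ≢u m refl = u∉Y m
    ≢v : ∀ {y} → y ∈ verts Y → y ≢ v
    ≢v m refl = v∉Y m
    strip : ∀ {y} → y ≢ u → y ≢ v → y ∈ verts (pt u • W • spokes u (v ∷ d ∷ [])) → y ∈ verts Y
    strip y≢u y≢v (here eq) = contradiction eq y≢u
    strip {y} y≢u y≢v (there m) with ∈-++⁻ (verts W) m
    ... | inj₁ (here eq)  = contradiction eq y≢v
    ... | inj₁ (there m′) = subst (y ∈_) (List.++-identityʳ _) m′
    x∈Y : x ∈ verts Y
    x∈Y = here refl
    d∈Y : d ∈ verts Y
    d∈Y = there (∈-++⁺ʳ m (here refl))
    x≢d : x ≢ d
    x≢d refl = All≢⇒∉ (AllPairs.head (distinct reY)) (∈-++⁺ʳ m (here refl))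
    only-d : ∀ {y} → y ∈ verts Y → Adj u y → y ≡ d
    only-d m r = case spokes-sound avW re′ (in-W m) r of λ
      { (here eq) → contradiction eq (≢v m) ; (there (here eq)) → eq }
    only-x : ∀ {y} → y ∈ verts Y → Adj v y → y ≡ x
    only-x m r = case spokes-sound avY reW m r of λ { (here eq) → eq }
    vx : Adj v x
    vx = spokes-complete avY reW (λ { (here refl) → x∈Y }) (here refl)
    ud : Adj u d
    ud = spokes-complete avW re′ (λ { (here refl) → here refl ; (there (here refl)) → in-W d∈Y }) (there (here refl))
    avY′ : Avoids u Y
    avY′ = proj₁ (proj₂ avW)
    reZ : Realises Adj′ Z
    reZ = realises-spokes symm′ (irrefl′ refl)
      (realises-cong (λ a b r → ≢v a , ≢v b , inj₁ r) (λ a b → lower (≢u a) (≢u b)) reY)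
      u∉Y (onEnds Y avY′) (λ { (here refl) → x∈Y ; (there (here refl)) → d∈Y })
      (λ m r → case at-u (≢u m) r of λ { (inj₁ r) → there (here (only-d m r)) ; (inj₂ r) → here (only-x m r) })
      (λ { (here refl) → from-v (≢u x∈Y) (≢v x∈Y) vx ; (there (here refl)) → from-u (≢v d∈Y) ud })

  rim-flip : ∀ (b : V) m d → rim b m d ≋ rim d (reverse m) b
  rim-flip b m d = ≋-trans (↷ •-cong (arc-reverse b m d) ≋-refl)
    (solve 3 (λ b m d → b ⊕ m ⊕ d ⊜ d ⊕ m ⊕ b) ≋-refl _ _ _)

  shrink : ∀ {Q} → Has Cycle Adj Q → u ∈ˢ Q → v ∈ˢ Q → Triangle Q ⊎ Shrunk Q
  shrink {Q} H u∈ v∈ with lookAt (shape H) (within H u∈) | cycle-neighbours (irr G) (real H) (lookAt (shape H) (within H u∈)) (within H v∈) uv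
  ... | cycleAt b m d e | here refl = shrink-from {m = m} e (real H) (within H) (onto H)
  ... | cycleAt b m d e | there (here refl) = shrink-from {m = reverse m}
    (≋-trans e (↷ •-cong (rim-flip b m d) (spokes-cong u two two))) (real H) (within H) (onto H)
    where
    two : ∀ {a b : V} → a ∷ b ∷ [] ⊆ b ∷ a ∷ []
    two (here eq)         = there (here eq)
    two (there (here eq)) = here eq

  -- Keeps a lift through both `u` and `v` apart from the solids that are matched with cycles: such
  -- a solid is an induced cycle once the right one of `u`, `v` is removed.
  NoCycle : Subset order → Set
  NoCycle S = ∀ {Q z} → Has Cycle Adj Q → _≈[_,_]_ G Q u v S → z ∈ˢ Q → (z ≡ u × ¬ v ∈ˢ Q) ⊎ (z ≡ v × ¬ u ∈ˢ Q) → ⊥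

module SolidLifts (G : Graph) {u v : Graph.V G} (uv : Graph.Adj G u v) where
  open Graph G
  open Contraction G uv
  open Lifts G uv
  open Graph G/uv using () renaming (Adj to Adj′)

  -- A lift through `u` alone has the vertex set of the solid it comes from. Solids matched with
  -- cycles contain both `u` and `v`, so `NoCycle` is asked of lifts through both.
  SolidLift : Subset order → Set
  SolidLift S = Has Solid Adj S ⊎ Moved G Solid Adj u v S false true ⊎ (Moved G Solid Adj u v S true true × NoCycle S)

  module _ {S : Subset order} (H : Has Solid Adj′ S) (u∈ : u ∈ˢ S)
           (Y : Piece V) (N : List V) (e : piece H ≋ pt u • Y • spokes u N) (av : Avoids u Y) (N⊆ : N ⊆ verts Y)
           (lift : LiftAll Y N) (np : NonPath Y) where

    private
      re′ : Realises Adj′ (pt u • Y • spokes u N)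
      re′ = realises-resp (≋-sym e) (real H)
      u∉ : u ∉ verts Y
      u∉ = spokes-∉ av re′
      Y⊆ : ∀ {x} → x ∈ verts Y → x ∈ˢ S
      Y⊆ m = onto H (Perm.∈-resp-↭ (verts-↭ (≋-sym e)) (there (∈-++⁺ˡ m)))
      v∉ : v ∉ verts Y
      v∉ m = isolated H (Y⊆ m)
      ≢u : ∀ {x} → x ∈ verts Y → x ≢ u
      ≢u m refl = u∉ m
      ≢v : ∀ {x} → x ∈ verts Y → x ≢ v
      ≢v m refl = v∉ m
      S⊆ : ∀ {x} → x ≢ u → x ∈ˢ S → x ∈ verts Y
      S⊆ {x} x≢u m = case Perm.∈-resp-↭ (verts-↭ e) (within H m) of λ
        { (here eq) → contradiction eq x≢u ; (there m′) → subst (x ∈_) (List.++-identityʳ _) m′ }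
      reY : Realises Adj Y
      reY = realises-cong (λ a b → lower (≢u a) (≢u b)) (λ a b r → ≢v a , ≢v b , inj₁ r) (realises-rest av re′)
      Nᵘ Nᵛ : List V
      Nᵘ = filter (adj? u) (verts Y)
      Nᵛ = filter (adj? v) (verts Y)
      nᵘ⁻ : ∀ {x} → x ∈ Nᵘ → x ∈ verts Y × Adj u x
      nᵘ⁻ = ∈-filter⁻ (adj? u) {xs = verts Y}
      nᵛ⁻ : ∀ {x} → x ∈ Nᵛ → x ∈ verts Y × Adj v x
      nᵛ⁻ = ∈-filter⁻ (adj? v) {xs = verts Y}
      edge-in-Y : ∀ {x y} → (x , y) ∈ edges′ Y → x ∈ verts Y × y ∈ verts Y
      edge-in-Y m = let (a , b) = closed-resp (≋-sym e) (solid-closed (shape H)) (∈-++⁺ˡ m)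
                        (nx , ny) = onEnds Y av m
                    in strip nx a , strip ny b
        where
        strip : ∀ {x} → u ≢ x → x ∈ verts (pt u • Y • spokes u N) → x ∈ verts Y
        strip {x} u≢x (here eq) = contradiction (sym eq) u≢x
        strip {x} u≢x (there m) = subst (x ∈_) (List.++-identityʳ _) m
      reU : Realises Adj (pt u • Y • spokes u Nᵘ)
      reU = realises-spokes symm (irr G) reY u∉ (onEnds Y av) (proj₁ ∘ nᵘ⁻) (∈-filter⁺ (adj? u)) (proj₂ ∘ nᵘ⁻)
      reV : Realises Adj (pt v • Y • spokes v Nᵛ)
      reV = realises-spokes symm (irr G) reY v∉
              (λ m → (λ { refl → v∉ (proj₁ (edge-in-Y m)) }) , (λ { refl → v∉ (proj₂ (edge-in-Y m)) }))
              (proj₁ ∘ nᵛ⁻) (∈-filter⁺ (adj? v)) (proj₂ ∘ nᵛ⁻)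
      Z : Piece V
      Z = pt u • pt v • ed u v • Y • spokes u Nᵘ • spokes v Nᵛ
      Z≋ : Z ≋ pt u • (pt v • Y • spokes v Nᵛ) • spokes u (v ∷ Nᵘ)
      Z≋ = ≋-trans (solve 6 (λ u v e y s t → u ⊕ v ⊕ e ⊕ y ⊕ s ⊕ t ⊜ u ⊕ (v ⊕ y ⊕ t) ⊕ e ⊕ s) ≋-refl _ _ _ _ _ _)
                   (↷ ↷ ≡⇒≋ refl refl)
      in-VB : ∀ {x} → x ∈ verts Y → x ∈ verts (pt v • Y • spokes v Nᵛ)
      in-VB m = there (∈-++⁺ˡ m)
      from-VB : ∀ {x} → x ∈ verts (pt v • Y • spokes v Nᵛ) → x ≡ v ⊎ x ∈ verts Y
      from-VB     (here eq) = inj₁ eq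
      from-VB {x} (there m) = inj₂ (subst (x ∈_) (List.++-identityʳ _) m)
      reZ : Realises Adj Z
      reZ = realises-resp Z≋ (realises-spokes symm (irr G) reV
        (λ m → [ u≢v , u∉ ]′ (from-VB m))
        (onEnds (pt v • Y • spokes v Nᵛ) (tt , av , u≢v , All.tabulate λ m → ≢-sym (≢u (proj₁ (nᵛ⁻ m)))))
        (λ { (here refl) → here refl ; (there m) → in-VB (proj₁ (nᵘ⁻ m)) })
        (λ m r → [ here , (λ m′ → there (∈-filter⁺ (adj? u) m′ r)) ]′ (from-VB m))
        (λ { (here refl) → uv ; (there m) → proj₂ (nᵘ⁻ m) }))
      D : Distinct (pt u • pt v • Y)
      D = (u≢v ∷ ∉⇒All≢ u∉) ∷ ∉⇒All≢ v∉ ∷ distinct reY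
      uniqueY : Unique (verts Y)
      uniqueY = distinct reY
      lifted : Lifted Y u v (spokes u Nᵘ) (spokes v Nᵛ)
      lifted = lift D (Unique.filter⁺ (adj? u) uniqueY) (Unique.filter⁺ (adj? v) uniqueY)
        (λ m → spokes-sound av re′ (proj₁ (nᵘ⁻ m)) (from-u (≢v (proj₁ (nᵘ⁻ m))) (proj₂ (nᵘ⁻ m))))
        (λ m → spokes-sound av re′ (proj₁ (nᵛ⁻ m)) (from-v (≢u (proj₁ (nᵛ⁻ m))) (≢v (proj₁ (nᵛ⁻ m))) (proj₂ (nᵛ⁻ m))))
        (λ m → [ inj₁ ∘ ∈-filter⁺ (adj? u) (N⊆ m) , inj₂ ∘ ∈-filter⁺ (adj? v) (N⊆ m) ]′
                 (at-u (≢u (N⊆ m)) (spokes-complete av re′ N⊆ m)))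
      -- Off `u` and `v` the set `Q` agrees with `S`, so `Q` contains the non-path `Y` and, besides,
      -- `z`; `nonPath-not-cycle` excludes this.
      noCycle : NoCycle S
      noCycle {Q} {z} HQ agr z∈ status = nonPath-not-cycle (irr G) reY np z∉ HQ z∈ (λ m → back agr (≢u m) (≢v m) (Y⊆ m))
        where
        z∉ : z ∉ verts Y
        z∉ = [ (λ { (refl , _) → u∉ }) , (λ { (refl , _) → v∉ }) ]′ status

    solid-lifts-at : SolidLift S
    solid-lifts-at = case lifted of λ
      { (inj₁ s) → inj₁ (has (pt u • Y • spokes u Nᵘ) s reU
          (λ m → Perm.∈-resp-↭ (verts-↭ e) (within H m)) (λ m → onto H (Perm.∈-resp-↭ (verts-↭ (≋-sym e)) m)))
      ; (inj₂ (inj₁ s)) → inj₂ (inj₁ (moved G {bu = false} {bv = true} (pt v • Y • spokes v Nᵛ) s reV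
          (λ x≢u _ m → in-VB (S⊆ x≢u m))
          (λ _ x≢v m → [ (λ eq → contradiction eq x≢v) , Y⊆ ]′ (from-VB m))
          (λ m → [ u≢v , u∉ ]′ (from-VB (∈-setOf⁻ {xs = verts (pt v • Y • spokes v Nᵛ)} m)))
          (∈-setOf⁺ {xs = verts (pt v • Y • spokes v Nᵛ)} (here refl))))
      ; (inj₂ (inj₂ s)) → inj₂ (inj₂ (moved G {bu = true} {bv = true} Z s reZ
          (λ x≢u _ m → there (there (∈-++⁺ˡ (S⊆ x≢u m))))
          (λ { x≢u _ (here eq) → contradiction eq x≢u
             ; _ x≢v (there (here eq)) → contradiction eq x≢v
             ; {x} _ _ (there (there m)) → Y⊆ (subst (x ∈_) (List.++-identityʳ _) m) })
          (∈-setOf⁺ {xs = verts Z} (here refl)) (∈-setOf⁺ {xs = verts Z} (there (here refl))) , (λ {Q} {z} → noCycle {Q} {z}))) }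

  solid-lifts : ∀ {S} → Has Solid Adj′ S → u ∈ˢ S → SolidLift S
  solid-lifts H u∈ with view Fin._≟_ (shape H) (distinct (real H)) (within H u∈)
  ... | mkView Y N e av N⊆ _ lift np = solid-lifts-at H u∈ Y N e av N⊆ lift np

-- Counting

-- A relation in place of a function: a source may be matched in several ways, as long as no target
-- serves two sources.
pigeonhole : ∀ (T : A → B → Set) {xs ys} → Unique xs → (∀ {x} → x ∈ xs → ∃[ y ] y ∈ ys × T x y) →
  (∀ {x x′ y} → T x y → T x′ y → x ≡ x′) → length xs ≤ⁿ length ys
pigeonhole T {[]}     {ys} _ total inj = z≤n
pigeonhole T {x ∷ xs} {ys} (x∉ ∷ u) total inj with total (here refl)
... | y , y∈ , t with ∈-∃++ y∈
...   | as , bs , refl = ℕ.≤-trans (s≤s (pigeonhole T u total′ inj)) (ℕ.≤-reflexive (sym (List.length-++-sucʳ as y bs)))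
  where
  total′ : ∀ {x′} → x′ ∈ xs → ∃[ y′ ] y′ ∈ as ++ bs × T x′ y′
  total′ m with total (there m)
  ... | y′ , y′∈ , t′ with ∈-++⁻ as y′∈
  ...   | inj₁ m′          = y′ , ∈-++⁺ˡ m′ , t′
  ...   | inj₂ (here refl) = contradiction (inj t t′) (All.lookup x∉ m)
  ...   | inj₂ (there m′)  = y′ , ∈-++⁺ʳ as m′ , t′

∈-subsets : ∀ {n} (S : Subset n) → S ∈ subsets n
∈-subsets Vec.[]         = here refl
∈-subsets (false ∷ᵛ S) = ∈-++⁺ˡ (∈-map⁺ (outside ∷ᵛ_) (∈-subsets S))
∈-subsets {suc n} (true ∷ᵛ S) = ∈-++⁺ʳ (map (outside ∷ᵛ_) (subsets n)) (∈-map⁺ (inside ∷ᵛ_) (∈-subsets S))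

subsets-unique : ∀ n → Unique (subsets n)
subsets-unique zero    = [] ∷ []
subsets-unique (suc n) = Unique.++⁺ (Unique.map⁺ tail-≡ (subsets-unique n)) (Unique.map⁺ tail-≡ (subsets-unique n)) disjoint
  where
  tail-≡ : ∀ {b} {S T : Subset n} → b ∷ᵛ S ≡ b ∷ᵛ T → S ≡ T
  tail-≡ refl = refl
  disjoint : ∀ {S} → ¬ (S ∈ map (outside ∷ᵛ_) (subsets n) × S ∈ map (inside ∷ᵛ_) (subsets n))
  disjoint (a , b) with ∈-map⁻ _ a | ∈-map⁻ _ b
  ... | _ , _ , refl | _ , _ , ()

-- Edges as sets of two vertices: orientation disappears, and they can be compared off `u` and `v`
-- just like cycles and solids.
record HasEdge {n} (R : Fin n → Fin n → Set) (S : Subset n) : Set where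
  constructor hasEdge
  field
    {end₁ end₂} : Fin n
    joined      : R end₁ end₂
    end₁∈       : end₁ ∈ˢ S
    end₂∈       : end₂ ∈ˢ S
    only-ends   : ∀ {x} → x ∈ˢ S → x ≡ end₁ ⊎ x ≡ end₂
open HasEdge public

edge-set : ∀ {n} {R : Fin n → Fin n → Set} {a b} → R a b → HasEdge R (setOf (a ∷ b ∷ []))
edge-set r = hasEdge r (∈-setOf⁺ (here refl)) (∈-setOf⁺ (there (here refl)))
  (λ m → case ∈-setOf⁻ m of λ { (here eq) → inj₁ eq ; (there (here eq)) → inj₂ eq })

module _ (G : Graph) where
  open Graph G

  ∈-solids⁺ : ∀ {S} → Has Solid Adj S → S ∈ solids G
  ∈-solids⁺ {S} H = ∈-filter⁺ (λ S → isSolid? (G ⟨ S ⟩)) (∈-subsets S) (has⇒isSolid G S H)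

  ∈-solids⁻ : ∀ {S} → S ∈ solids G → Has Solid Adj S
  ∈-solids⁻ {S} m = isSolid⇒has G S (proj₂ (∈-filter⁻ (λ S → isSolid? (G ⟨ S ⟩)) {xs = subsets order} m))

  solids-unique : Unique (solids G)
  solids-unique = Unique.filter⁺ _ (subsets-unique order)

  ∈-cycles⁺ : ∀ {S} → Has Cycle Adj S → S ∈ inducedCycles G
  ∈-cycles⁺ {S} H = ∈-filter⁺ (λ S → isCycle? (G ⟨ S ⟩)) (∈-subsets S) (has⇒isCycle G S H)

  ∈-cycles⁻ : ∀ {S} → S ∈ inducedCycles G → Has Cycle Adj S
  ∈-cycles⁻ {S} m = isCycle⇒has G S (proj₂ (∈-filter⁻ (λ S → isCycle? (G ⟨ S ⟩)) {xs = subsets order} m))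

  cycles-unique : Unique (inducedCycles G)
  cycles-unique = Unique.filter⁺ _ (subsets-unique order)

  pairSet : V × V → Subset order
  pairSet (a , b) = setOf (a ∷ b ∷ [])

  edgeSets : List (Subset order)
  edgeSets = map pairSet (edges G)

  length-edgeSets : length edgeSets ≡ length (edges G)
  length-edgeSets = List.length-map pairSet (edges G)

  ∈-edges⁺ : ∀ {a b} → a < b → Adj a b → (a , b) ∈ edges G
  ∈-edges⁺ {a} {b} a<b r = ∈-filter⁺ _ (∈-cartesianProduct⁺ (∈-allFin a) (∈-allFin b)) (a<b , r)

  ∈-edges⁻ : ∀ {a b} → (a , b) ∈ edges G → a < b × Adj a b
  ∈-edges⁻ m = proj₂ (∈-filter⁻ _ {xs = cartesianProduct (allFin order) (allFin order)} m)

  edges-unique : Unique (edges G)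
  edges-unique = Unique.filter⁺ _ (Unique.cartesianProduct⁺ (Unique.allFin⁺ order) (Unique.allFin⁺ order))

  edgeSets-unique : Unique edgeSets
  edgeSets-unique = unique-map (edges G) inj edges-unique
    where
    inj : InjectiveOn pairSet (edges G)
    inj {a , b} {c , d} m m′ eq = go (mem (here refl)) (mem (there (here refl)))
      where
      mem : ∀ {x} → x ∈ a ∷ b ∷ [] → x ∈ c ∷ d ∷ []
      mem {x} n = ∈-setOf⁻ (subst (x ∈ˢ_) eq (∈-setOf⁺ n))
      a<b = proj₁ (∈-edges⁻ m)
      c<d = proj₁ (∈-edges⁻ m′)
      go : a ∈ c ∷ d ∷ [] → b ∈ c ∷ d ∷ [] → (a , b) ≡ (c , d)
      go (here refl) (here refl)                 = contradiction a<b (Fin.<-irrefl refl)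
      go (here refl) (there (here refl))         = refl
      go (there (here refl)) (here refl)         = contradiction (Fin.<-trans a<b c<d) (Fin.<-irrefl refl)
      go (there (here refl)) (there (here refl)) = contradiction a<b (Fin.<-irrefl refl)

  ∈-edgeSets⁺ : ∀ {S} → HasEdge Adj S → S ∈ edgeSets
  ∈-edgeSets⁺ {S} (hasEdge {a} {b} r a∈ b∈ only) with Fin.<-cmp a b
  ... | tri< a<b _ _  = subst (_∈ edgeSets) (Sub.⊆-antisym
    (λ m → case ∈-setOf⁻ m of λ { (here refl) → a∈ ; (there (here refl)) → b∈ ; (there (there ())) })
    (λ m → ∈-setOf⁺ ([ here , there ∘ here ]′ (only m)))) (∈-map⁺ pairSet (∈-edges⁺ a<b r))
  ... | tri≈ _ refl _ = contradiction r (irr G)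
  ... | tri> _ _ b<a  = subst (_∈ edgeSets) (Sub.⊆-antisym
    (λ m → case ∈-setOf⁻ m of λ { (here refl) → b∈ ; (there (here refl)) → a∈ ; (there (there ())) })
    (λ m → ∈-setOf⁺ ([ there ∘ here , here ]′ (only m)))) (∈-map⁺ pairSet (∈-edges⁺ b<a (symm r)))

  ∈-edgeSets⁻ : ∀ {S} → S ∈ edgeSets → HasEdge Adj S
  ∈-edgeSets⁻ m with ∈-map⁻ pairSet m
  ... | (a , b) , m′ , refl = edge-set (proj₂ (∈-edges⁻ m′))

-- The point is matched with the contracted edge uv, and accounts for the vertex v that is lost.
data Cell (n : ℕ) : Set where
  solidCell cycleCell edgeCell : Subset n → Cell n
  pointCell                    : Cell n

cells : ∀ {n} → List (Subset n) → List (Subset n) → List (Subset n) → List (Cell n)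
cells ss cs es = map solidCell ss ++ map cycleCell cs ++ map edgeCell es

length-cells : ∀ {n} (ss cs es : List (Subset n)) → length (cells ss cs es) ≡ length ss +ⁿ (length cs +ⁿ length es)
length-cells ss cs es = trans (List.length-++ (map solidCell ss)) (cong₂ _+ⁿ_ (List.length-map solidCell ss)
  (trans (List.length-++ (map cycleCell cs)) (cong₂ _+ⁿ_ (List.length-map cycleCell cs) (List.length-map edgeCell es))))

cells-unique : ∀ {n} {ss cs es : List (Subset n)} → Unique ss → Unique cs → Unique es → Unique (pointCell ∷ cells ss cs es)
cells-unique {n} {ss} {cs} {es} us uc ue =
  ∉⇒All≢ no-point ∷ Unique.++⁺ (Unique.map⁺ (λ { refl → refl }) us)
    (Unique.++⁺ (Unique.map⁺ (λ { refl → refl }) uc) (Unique.map⁺ (λ { refl → refl }) ue) cycle-edge) solid-rest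
  where
  cycle-edge : ∀ {x} → ¬ (x ∈ map cycleCell cs × x ∈ map edgeCell es)
  cycle-edge (a , b) with ∈-map⁻ _ a | ∈-map⁻ _ b
  ... | _ , _ , refl | _ , _ , ()
  solid-rest : ∀ {x} → ¬ (x ∈ map solidCell ss × x ∈ map cycleCell cs ++ map edgeCell es)
  solid-rest (a , b) with ∈-map⁻ _ a | ∈-++⁻ (map cycleCell cs) b
  ... | _ , _ , refl | inj₁ c with ∈-map⁻ _ c
  ...   | _ , _ , ()
  solid-rest (a , b) | _ , _ , refl | inj₂ c with ∈-map⁻ _ c
  ...   | _ , _ , ()
  no-point : pointCell ∉ cells ss cs es
  no-point m with ∈-++⁻ (map solidCell ss) m
  ... | inj₁ a with ∈-map⁻ _ a
  ...   | _ , _ , ()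
  no-point m | inj₂ b with ∈-++⁻ (map cycleCell cs) b
  ...   | inj₁ c with ∈-map⁻ _ c
  ...     | _ , _ , ()
  no-point m | inj₂ b | inj₂ c with ∈-map⁻ _ c
  ...     | _ , _ , ()

module _ {n} {ss cs es : List (Subset n)} {S : Subset n} where

  ∈-cells-solid : S ∈ ss → solidCell S ∈ cells ss cs es
  ∈-cells-solid m = ∈-++⁺ˡ (∈-map⁺ solidCell m)

  ∈-cells-cycle : S ∈ cs → cycleCell S ∈ cells ss cs es
  ∈-cells-cycle m = ∈-++⁺ʳ (map solidCell ss) (∈-++⁺ˡ (∈-map⁺ cycleCell m))

  ∈-cells-edge : S ∈ es → edgeCell S ∈ cells ss cs es
  ∈-cells-edge m = ∈-++⁺ʳ (map solidCell ss) (∈-++⁺ʳ (map cycleCell cs) (∈-map⁺ edgeCell m))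

cells-elim : ∀ {n} {ss cs es : List (Subset n)} {P : Cell n → Set} →
  (∀ {S} → S ∈ ss → P (solidCell S)) → (∀ {S} → S ∈ cs → P (cycleCell S)) → (∀ {S} → S ∈ es → P (edgeCell S)) →
  ∀ {x} → x ∈ cells ss cs es → P x
cells-elim {ss = ss} {cs} {es} f g h m with ∈-++⁻ (map solidCell ss) m
... | inj₁ a with ∈-map⁻ _ a
...   | _ , a′ , refl = f a′
cells-elim {ss = ss} {cs} {es} f g h m | inj₂ b with ∈-++⁻ (map cycleCell cs) b
...   | inj₁ c with ∈-map⁻ _ c
...     | _ , c′ , refl = g c′
cells-elim {ss = ss} {cs} {es} f g h m | inj₂ b | inj₂ c with ∈-map⁻ _ c
...     | _ , c′ , refl = h c′

-- The injection for one contraction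

module Inequality (G : Graph) {u v : Graph.V G} (uv : Graph.Adj G u v) where
  open Graph G
  open Contraction G uv
  open Lifts G uv
  open SolidLifts G uv
  open Graph G/uv using () renaming (Adj to Adj′)

  private
    _≈_ : Subset order → Subset order → Set
    S ≈ T = _≈[_,_]_ G S u v T

    ≈-join : ∀ {S S′ T} → S ≈ T → S′ ≈ T → S ≈ S′
    ≈-join p q = agree (λ a b m → back q a b (ahead p a b m)) (λ a b m → back p a b (ahead q a b m))

    In′ : Bool → V → Subset order → Set
    In′ = In G

    in-transfer : ∀ {b x} {S T : Subset order} → In′ b x S → In′ b x T → x ∈ˢ S → x ∈ˢ T
    in-transfer {true}  _ t _ = t
    in-transfer {false} s _ m = contradiction m s

    ≈-≡ : ∀ {S T bu bv} → S ≈ T → In′ bu u S → In′ bu u T → In′ bv v S → In′ bv v T → S ≡ T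
    ≈-≡ {S} {T} {bu} {bv} p us ut vs vt = Sub.⊆-antisym fwd bwd
      where
      fwd : S ⊆ˢ T
      fwd {x} m with x Fin.≟ u | x Fin.≟ v
      ... | yes refl | _        = in-transfer {bu} us ut m
      ... | no _     | yes refl = in-transfer {bv} vs vt m
      ... | no a     | no b     = ahead p a b m
      bwd : T ⊆ˢ S
      bwd {x} m with x Fin.≟ u | x Fin.≟ v
      ... | yes refl | _        = in-transfer {bu} ut us m
      ... | no _     | yes refl = in-transfer {bv} vt vs m
      ... | no a     | no b     = back p a b m

    in-unique : ∀ {b b′ x} {S : Subset order} → In′ b x S → In′ b′ x S → b ≡ b′
    in-unique {true}  {true}  _ _ = refl
    in-unique {true}  {false} a b = contradiction a b
    in-unique {false} {true}  a b = contradiction b a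
    in-unique {false} {false} _ _ = refl

    clash : ∀ {S T} → Dominates G u v S → Undominated G u v T → T ≈ S → ⊥
    clash dom (y , y∈ , y≢u , y≢v , r , ¬r) p = ¬r (dom y (ahead p y≢u y≢v y∈) y≢u y≢v r)

    clash′ : ∀ {S T} → Dominates G v u S → Undominated G v u T → T ≈ S → ⊥
    clash′ dom (y , y∈ , y≢v , y≢u , r , ¬r) p = ¬r (dom y (ahead p y≢u y≢v y∈) y≢v y≢u r)

  -- A cell of the contraction together with the cycles of G (the second argument) is matched with
  -- a cell of G together with the cycles of the contraction (the third argument); the booleans
  -- record whether the latter contains u and v.
  data Match : Bool → Bool → Cell order → Cell order → Set where
    solid-same    : ∀ {bu S} → Match bu false (solidCell S) (solidCell S)
    solid-v       : ∀ {S T} → S ≈ T → u ∈ˢ S → ¬ v ∈ˢ S → Match false true (solidCell S) (solidCell T)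
    solid-uv      : ∀ {S T} → S ≈ T → u ∈ˢ S → ¬ v ∈ˢ S → NoCycle S → Match true true (solidCell S) (solidCell T)
    cycle-u-solid : ∀ {Q T} → Has Cycle Adj Q → Q ≈ T → u ∈ˢ Q → ¬ v ∈ˢ Q → Undominated G u v Q →
                    Match true true (cycleCell Q) (solidCell T)
    cycle-v-solid : ∀ {Q T} → Has Cycle Adj Q → Q ≈ T → ¬ u ∈ˢ Q → v ∈ˢ Q →
                    Match true true (cycleCell Q) (solidCell T)
    cycle-same    : ∀ {bu Q} → (u ∈ˢ Q → Dominates G u v Q) → Match bu false (cycleCell Q) (cycleCell Q)
    cycle-v       : ∀ {Q R} → Q ≈ R → ¬ u ∈ˢ Q → v ∈ˢ Q → Dominates G v u Q → Undominated G u v Q →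
                    Match true false (cycleCell Q) (cycleCell R)
    cycle-uv      : ∀ {Q R} → Q ≈ R → u ∈ˢ Q → v ∈ˢ Q → Undominated G u v Q → Undominated G v u Q →
                    Match true false (cycleCell Q) (cycleCell R)
    triangle      : ∀ {Q E} → Q ≈ E → u ∈ˢ Q → v ∈ˢ Q → (∃[ y ] y ∈ˢ E × y ≢ u × y ≢ v × Adj u y) →
                    Match false true (cycleCell Q) (edgeCell E)
    edge-same     : ∀ {bu E} → Match bu false (edgeCell E) (edgeCell E)
    edge-v        : ∀ {E F} → E ≈ F → u ∈ˢ E → ¬ v ∈ˢ E → (∀ {y} → y ∈ˢ F → y ≢ v → ¬ Adj u y) →
                    Match false true (edgeCell E) (edgeCell F)
    point         : ∀ {E} → Match true true pointCell (edgeCell E)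

  -- In T - v = Q a vertex y adjacent to v but not to u has two neighbours besides u, hence three in T - u = Q′.
  two-cycles : ∀ {Q Q′ T} → Has Cycle Adj Q → Q ≈ T → u ∈ˢ Q → ¬ v ∈ˢ Q → Undominated G u v Q →
    Has Cycle Adj Q′ → Q′ ≈ T → ¬ u ∈ˢ Q′ → v ∈ˢ Q′ → ⊥
  two-cycles {Q} {Q′} H p u∈ v∉ (y , y∈ , y≢u , y≢v , r , ¬r) H′ p′ u∉′ v∈′ =
    cycle-degree (irr G) (shape H′) (real H′) (within H′ (move y≢u y≢v y∈)) (in-Q′ prev (prev∈ d at) rp) (in-Q′ next (next∈ d at) rn)
      (within H′ v∈′) (prev≢next d at) (≢v (prev∈ d at)) (≢v (next∈ d at)) rp rn (symm r)
    where
    at = lookAt (shape H) (within H y∈)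
    open CycleAt at
    d = distinct (real H)
    rp : Adj y prev
    rp = complete (real H) (within H y∈) (prev∈ d at) (proj₁ (rim-joined d at))
    rn : Adj y next
    rn = complete (real H) (within H y∈) (next∈ d at) (proj₂ (rim-joined d at))
    move : ∀ {x} → x ≢ u → x ≢ v → x ∈ˢ Q → x ∈ˢ Q′
    move a b m = back p′ a b (ahead p a b m)
    ≢v : ∀ {x} → x ∈ verts (piece H) → x ≢ v
    ≢v m refl = v∉ (onto H m)
    in-Q′ : ∀ x → x ∈ verts (piece H) → Adj y x → x ∈ verts (piece H′)
    in-Q′ x m rx = within H′ (move (λ { refl → ¬r (symm rx) }) (≢v m) (onto H m))

  -- Both matches carry the same Booleans, read off the target, so many constructors never meet.
  -- Where they do, `NoCycle` separates lifted solids from cycles matched with solids, `two-cycles`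
  -- separates the two sorts of the latter, domination separates cycles with the same image, and
  -- adjacency to `u` separates triangles from edges. The first argument ties the Boolean for `u` to
  -- membership, which releases the domination stored in `cycle-same`.
  match-injective : ∀ {bu bv x x′ y} → (∀ {S} → y ≡ cycleCell S → bu ≡ true → u ∈ˢ S) →
    Match bu bv x y → Match bu bv x′ y → x ≡ x′
  match-injective _ solid-same solid-same = refl
  match-injective _ (solid-v p a b) (solid-v p′ a′ b′) = cong solidCell (≈-≡ {bu = true} {false} (≈-join p p′) a a′ b b′)
  match-injective _ (solid-uv p a b _) (solid-uv p′ a′ b′ _) = cong solidCell (≈-≡ {bu = true} {false} (≈-join p p′) a a′ b b′)
  match-injective _ (solid-uv p a b k) (cycle-u-solid H q a′ b′ _) = ⊥-elim (k H (≈-join q p) a′ (inj₁ (refl , b′)))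
  match-injective _ (solid-uv p a b k) (cycle-v-solid H q a′ b′) = ⊥-elim (k H (≈-join q p) b′ (inj₂ (refl , a′)))
  match-injective _ (cycle-u-solid H q a′ b′ _) (solid-uv p a b k) = ⊥-elim (k H (≈-join q p) a′ (inj₁ (refl , b′)))
  match-injective _ (cycle-v-solid H q a′ b′) (solid-uv p a b k) = ⊥-elim (k H (≈-join q p) b′ (inj₂ (refl , a′)))
  match-injective _ (cycle-u-solid _ p a b _) (cycle-u-solid _ p′ a′ b′ _) =
    cong cycleCell (≈-≡ {bu = true} {false} (≈-join p p′) a a′ b b′)
  match-injective _ (cycle-v-solid _ p a b) (cycle-v-solid _ p′ a′ b′) =
    cong cycleCell (≈-≡ {bu = false} {true} (≈-join p p′) a a′ b b′)
  match-injective _ (cycle-u-solid H p a b k) (cycle-v-solid H′ p′ a′ b′) = ⊥-elim (two-cycles H p a b k H′ p′ a′ b′)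
  match-injective _ (cycle-v-solid H′ p′ a′ b′) (cycle-u-solid H p a b k) = ⊥-elim (two-cycles H p a b k H′ p′ a′ b′)
  match-injective _ (cycle-same _) (cycle-same _) = refl
  match-injective u∈ (cycle-same dom) (cycle-v p _ _ _ k) = ⊥-elim (clash (dom (u∈ refl refl)) k p)
  match-injective u∈ (cycle-same dom) (cycle-uv p _ _ k _) = ⊥-elim (clash (dom (u∈ refl refl)) k p)
  match-injective u∈ (cycle-v p _ _ _ k) (cycle-same dom) = ⊥-elim (clash (dom (u∈ refl refl)) k p)
  match-injective u∈ (cycle-uv p _ _ k _) (cycle-same dom) = ⊥-elim (clash (dom (u∈ refl refl)) k p)
  match-injective _ (cycle-v p a b _ _) (cycle-v p′ a′ b′ _ _) = cong cycleCell (≈-≡ {bu = false} {true} (≈-join p p′) a a′ b b′)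
  match-injective _ (cycle-uv p a b _ _) (cycle-uv p′ a′ b′ _ _) = cong cycleCell (≈-≡ {bu = true} {true} (≈-join p p′) a a′ b b′)
  match-injective _ (cycle-v p _ _ dom _) (cycle-uv p′ _ _ _ k) = ⊥-elim (clash′ dom k (≈-join p′ p))
  match-injective _ (cycle-uv p′ _ _ _ k) (cycle-v p _ _ dom _) = ⊥-elim (clash′ dom k (≈-join p′ p))
  match-injective _ (triangle p a b _) (triangle p′ a′ b′ _) = cong cycleCell (≈-≡ {bu = true} {true} (≈-join p p′) a a′ b b′)
  match-injective _ (triangle _ _ _ (y , y∈ , _ , y≢v , r)) (edge-v _ _ _ k) = ⊥-elim (k y∈ y≢v r)
  match-injective _ (edge-v _ _ _ k) (triangle _ _ _ (y , y∈ , _ , y≢v , r)) = ⊥-elim (k y∈ y≢v r)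
  match-injective _ edge-same edge-same = refl
  match-injective _ (edge-v p a b _) (edge-v p′ a′ b′ _) = cong edgeCell (≈-≡ {bu = true} {false} (≈-join p p′) a a′ b b′)
  match-injective _ point point = refl

  carrier : Cell order → Subset order
  carrier (solidCell S) = S
  carrier (cycleCell S) = S
  carrier (edgeCell S)  = S
  carrier pointCell     = full

  Matched : Cell order → Cell order → Set
  Matched x y = ∃[ bu ] ∃[ bv ] In′ bu u (carrier y) × In′ bv v (carrier y) × Match bu bv x y

  matched-injective : ∀ {x x′ y} → Matched x y → Matched x′ y → x ≡ x′
  matched-injective {y = y} (bu , bv , iu , iv , m) (bu′ , bv′ , iu′ , iv′ , m′)
    with in-unique {bu} {bu′} iu iu′ | in-unique {bv} {bv′} iv iv′
  ... | refl | refl = match-injective (λ { refl refl → iu }) m m′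

  sources targets : List (Cell order)
  sources = pointCell ∷ cells (solids G/uv) (inducedCycles G) (edgeSets G/uv)
  targets = cells (solids G) (inducedCycles G/uv) (edgeSets G)

  private
    Found : Cell order → Set
    Found x = ∃[ y ] y ∈ targets × Matched x y

    to-solid : ∀ {x S} bu bv → Has Solid Adj S → In′ bu u S → In′ bv v S → Match bu bv x (solidCell S) → Found x
    to-solid bu bv H iu iv m = _ , ∈-cells-solid {ss = solids G} {inducedCycles G/uv} {edgeSets G} (∈-solids⁺ G H) , bu , bv , iu , iv , m

    to-cycle : ∀ {x S} bu bv → Has Cycle Adj′ S → In′ bu u S → In′ bv v S → Match bu bv x (cycleCell S) → Found x
    to-cycle bu bv H iu iv m =
      _ , ∈-cells-cycle {ss = solids G} {inducedCycles G/uv} {edgeSets G} (∈-cycles⁺ G/uv H) , bu , bv , iu , iv , m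

    to-edge : ∀ {x S} bu bv → HasEdge Adj S → In′ bu u S → In′ bv v S → Match bu bv x (edgeCell S) → Found x
    to-edge bu bv H iu iv m =
      _ , ∈-cells-edge {ss = solids G} {inducedCycles G/uv} {edgeSets G} (∈-edgeSets⁺ G H) , bu , bv , iu , iv , m

  point-found : Found pointCell
  point-found = to-edge true true (edge-set uv) (∈-setOf⁺ (here refl)) (∈-setOf⁺ (there (here refl))) point

  solid-lift-found : ∀ {S} → Has Solid Adj′ S → u ∈ˢ S → SolidLift S → Found (solidCell S)
  solid-lift-found H u∈ (inj₁ H′) = to-solid true false H′ u∈ (isolated H) solid-same
  solid-lift-found H u∈ (inj₂ (inj₁ (T , H′ , p , iu , iv))) = to-solid false true H′ iu iv (solid-v p u∈ (isolated H))
  solid-lift-found H u∈ (inj₂ (inj₂ ((T , H′ , p , iu , iv) , k))) =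
    to-solid true true H′ iu iv (solid-uv p u∈ (isolated H) (λ {Q} {z} → k {Q} {z}))

  solid-found : ∀ {S} → Has Solid Adj′ S → Found (solidCell S)
  solid-found {S} H = case u Sub.∈? S of λ
    { (no u∉)  → to-solid false false (solid-stays H u∉) u∉ (isolated H) solid-same
    ; (yes u∈) → solid-lift-found H u∈ (solid-lifts H u∈) }

  cycle-u-found : ∀ {Q} → Has Cycle Adj Q → u ∈ˢ Q → ¬ v ∈ˢ Q → Dominates G u v Q ⊎ Undominated G u v Q → Found (cycleCell Q)
  cycle-u-found H u∈ v∉ (inj₁ dom) =
    to-cycle true false (cycle-stays H v∉ (λ _ → dom)) u∈ v∉ (cycle-same λ _ → dom)
  cycle-u-found H u∈ v∉ (inj₂ k) = case undominated-solid (inj₁ (refl , refl)) (symm uv) H u∈ v∉ k of λ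
    { (T , H′ , p , iu , iv) → to-solid true true H′ iu iv (cycle-u-solid H p u∈ v∉ k) }

  -- A cycle through `v` gives way to one through `u`. If `u` and `v` dominate each other on it,
  -- exchanging `v` for `u` yields another cycle of `G`, which already claims the common image; so a
  -- solid must be used, and `double-solid` provides it.
  cycle-v-found : ∀ {Q} → Has Cycle Adj Q → ¬ u ∈ˢ Q → v ∈ˢ Q →
    Dominates G u v Q ⊎ Undominated G u v Q → Dominates G v u Q ⊎ Undominated G v u Q → Found (cycleCell Q)
  cycle-v-found H u∉ v∈ _ (inj₂ k) = case undominated-solid (inj₂ (refl , refl)) uv H v∈ u∉ k of λ
    { (T , H′ , p , iu , iv) → to-solid true true H′ iu iv (cycle-v-solid H p u∉ v∈) }
  cycle-v-found H u∉ v∈ (inj₁ dom) (inj₁ _) = case double-solid H v∈ u∉ dom of λ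
    { (T , H′ , p , iu , iv) → to-solid true true H′ iu iv (cycle-v-solid H p u∉ v∈) }
  cycle-v-found H u∉ v∈ (inj₂ k) (inj₁ dom) = case cycle-moves H v∈ u∉ dom of λ
    { (R , H′ , p , iu , iv) → to-cycle true false H′ iu iv (cycle-v p u∉ v∈ dom k) }

  cycle-uv-found : ∀ {Q} → u ∈ˢ Q → v ∈ˢ Q → Triangle Q ⊎ Shrunk Q → Found (cycleCell Q)
  cycle-uv-found u∈ v∈ (inj₂ ((R , H′ , p , iu , iv) , k , k′)) = to-cycle true false H′ iu iv (cycle-uv p u∈ v∈ k k′)
  cycle-uv-found u∈ v∈ (inj₁ (d , d≢u , d≢v , ud , vd , d∈ , only)) =
    to-edge false true (edge-set vd)
      (λ m → case ∈-setOf⁻ m of λ { (here eq) → u≢v eq ; (there (here eq)) → d≢u (sym eq) }) (∈-setOf⁺ (here refl))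
      (triangle (agree
          (λ x≢u x≢v m → [ (λ eq → contradiction eq x≢u) , [ (λ eq → contradiction eq x≢v) , (λ { refl → ∈-setOf⁺ (there (here refl)) }) ]′ ]′ (only m))
          (λ x≢u x≢v m → case ∈-setOf⁻ m of λ { (here eq) → contradiction eq x≢v ; (there (here refl)) → d∈ }))
        u∈ v∈ (d , ∈-setOf⁺ (there (here refl)) , d≢u , d≢v , ud))

  cycle-found : ∀ {Q} → Has Cycle Adj Q → Found (cycleCell Q)
  cycle-found {Q} H = case u Sub.∈? Q of λ
    { (yes u∈) → case v Sub.∈? Q of λ
        { (yes v∈) → cycle-uv-found u∈ v∈ (shrink H u∈ v∈)
        ; (no v∉)  → cycle-u-found H u∈ v∉ (dominates? G u v Q) }
    ; (no u∉)  → case v Sub.∈? Q of λ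
        { (yes v∈) → cycle-v-found H u∉ v∈ (dominates? G u v Q) (dominates? G v u Q)
        ; (no v∉)  → to-cycle false false (cycle-stays H v∉ (λ u∈ → contradiction u∈ u∉)) u∉ v∉
                       (cycle-same λ u∈ → contradiction u∈ u∉) } }

  edge-same-found : ∀ {E} → HasEdge Adj E → ¬ v ∈ˢ E → Found (edgeCell E)
  edge-same-found {E} H v∉ = case u Sub.∈? E of λ
    { (yes u∈) → to-edge true false H u∈ v∉ edge-same
    ; (no u∉)  → to-edge false false H u∉ v∉ edge-same }

  -- An edge `u y` that is new in the contraction stems from `v y` and is matched with it. The edges
  -- `v y` with `y` adjacent to both ends stay free for the triangles, and `u v` for the point.
  edge-v-found : ∀ {E y} → y ≢ u → y ≢ v → Adj v y → ¬ Adj u y → u ∈ˢ E → ¬ v ∈ˢ E → y ∈ˢ E →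
    (∀ {x} → x ∈ˢ E → x ≡ u ⊎ x ≡ y) → Found (edgeCell E)
  edge-v-found {E} {y} y≢u y≢v vy ¬uy u∈ v∉ y∈ only = to-edge false true (edge-set vy)
    (λ m → case ∈-setOf⁻ m of λ { (here eq) → u≢v eq ; (there (here eq)) → y≢u (sym eq) }) (∈-setOf⁺ (here refl))
    (edge-v (agree (λ x≢u _ m → [ (λ eq → contradiction eq x≢u) , (λ { refl → ∈-setOf⁺ (there (here refl)) }) ]′ (only m))
                   (λ x≢u x≢v m → case ∈-setOf⁻ m of λ { (here eq) → contradiction eq x≢v ; (there (here refl)) → y∈ }))
      u∈ v∉ (λ m x≢v ux → case ∈-setOf⁻ m of λ { (here eq) → x≢v eq ; (there (here refl)) → ¬uy ux }))

  edge-found-at : ∀ {E a b} → a ≢ v → b ≢ v → a ∈ˢ E → b ∈ˢ E → (∀ {x} → x ∈ˢ E → x ≡ a ⊎ x ≡ b) → ¬ v ∈ˢ E → Dec (Adj a b) →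
    Adj a b ⊎ (a ≡ u × b ≢ u × Adj v b) ⊎ (b ≡ u × a ≢ u × Adj v a) → Found (edgeCell E)
  edge-found-at a≢v b≢v a∈ b∈ only v∉ (yes r) _ = edge-same-found (hasEdge r a∈ b∈ only) v∉
  edge-found-at a≢v b≢v a∈ b∈ only v∉ (no ¬r) (inj₁ r) = contradiction r ¬r
  edge-found-at a≢v b≢v a∈ b∈ only v∉ (no ¬r) (inj₂ (inj₁ (refl , b≢u , vb))) = edge-v-found b≢u b≢v vb ¬r a∈ v∉ b∈ only
  edge-found-at a≢v b≢v a∈ b∈ only v∉ (no ¬r) (inj₂ (inj₂ (refl , a≢u , va))) =
    edge-v-found a≢u a≢v va (λ r → ¬r (symm r)) b∈ v∉ a∈ (λ m → swap (only m))

  edge-found : ∀ {E} → HasEdge Adj′ E → Found (edgeCell E)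
  edge-found (hasEdge {a} {b} (a≢v , b≢v , r) a∈ b∈ only) = edge-found-at a≢v b≢v a∈ b∈ only
    (λ m → [ (λ eq → a≢v (sym eq)) , (λ eq → b≢v (sym eq)) ]′ (only m)) (adj? a b) r

  -- This is b(G/uv) ≤ b(G) with the negative terms moved across. As `contract` keeps the vertex
  -- set, the loss of `v` appears as `suc`.
  contraction-bound : suc (length (solids G/uv) +ⁿ (length (inducedCycles G) +ⁿ length (edges G/uv))) ≤ⁿ
                      length (solids G) +ⁿ (length (inducedCycles G/uv) +ⁿ length (edges G))
  contraction-bound = subst₂ _≤ⁿ_
    (cong suc (trans (length-cells (solids G/uv) (inducedCycles G) (edgeSets G/uv))
      (cong (λ k → length (solids G/uv) +ⁿ (length (inducedCycles G) +ⁿ k)) (length-edgeSets G/uv))))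
    (trans (length-cells (solids G) (inducedCycles G/uv) (edgeSets G))
      (cong (λ k → length (solids G) +ⁿ (length (inducedCycles G/uv) +ⁿ k)) (length-edgeSets G)))
    (pigeonhole Matched {sources} {targets}
      (cells-unique (solids-unique G/uv) (cycles-unique G) (edgeSets-unique G/uv)) found matched-injective)
    where
    found : ∀ {x} → x ∈ sources → Found x
    found (here refl) = point-found
    found (there m)   = cells-elim {ss = solids G/uv} {inducedCycles G} {edgeSets G/uv} {Found}
      (solid-found ∘ ∈-solids⁻ G/uv) (cycle-found ∘ ∈-cycles⁻ G) (edge-found ∘ ∈-edgeSets⁻ G/uv) m

-- Complete graphs

-- Generated by Pascal's rule, so that the length satisfies the recursion of the binomial
-- coefficients.
choose : ∀ {n} → Subset n → ℕ → List (Subset n)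
choose Vec.[]       zero    = Vec.[] ∷ []
choose Vec.[]       (suc k) = []
choose (false ∷ᵛ L) k       = map (outside ∷ᵛ_) (choose L k)
choose (true ∷ᵛ L)  zero    = map (outside ∷ᵛ_) (choose L zero)
choose (true ∷ᵛ L)  (suc k) = map (inside ∷ᵛ_) (choose L k) ++ map (outside ∷ᵛ_) (choose L (suc k))

length-choose : ∀ {n} (L : Subset n) k → length (choose L k) ≡ ∣ L ∣ C k
length-choose Vec.[]       zero    = refl
length-choose Vec.[]       (suc k) = sym (k>n⇒nCk≡0 {0} {suc k} (s≤s z≤n))
length-choose (false ∷ᵛ L) k       = trans (List.length-map _ (choose L k)) (length-choose L k)
length-choose (true ∷ᵛ L)  zero    = trans (List.length-map _ (choose L zero)) (length-choose L zero)
length-choose (true ∷ᵛ L)  (suc k) = trans (List.length-++ (map (inside ∷ᵛ_) (choose L k)))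
  (trans (cong₂ _+ⁿ_ (trans (List.length-map _ (choose L k)) (length-choose L k))
                     (trans (List.length-map _ (choose L (suc k))) (length-choose L (suc k))))
         (nCk+nC[k+1]≡[n+1]C[k+1] ∣ L ∣ k))

∷ᵛ-injective : ∀ {n b} {S T : Subset n} → b ∷ᵛ S ≡ b ∷ᵛ T → S ≡ T
∷ᵛ-injective refl = refl

choose-unique : ∀ {n} (L : Subset n) k → Unique (choose L k)
choose-unique Vec.[]       zero    = [] ∷ []
choose-unique Vec.[]       (suc k) = []
choose-unique (false ∷ᵛ L) k       = Unique.map⁺ ∷ᵛ-injective (choose-unique L k)
choose-unique (true ∷ᵛ L)  zero    = Unique.map⁺ ∷ᵛ-injective (choose-unique L zero)
choose-unique (true ∷ᵛ L)  (suc k) =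
  Unique.++⁺ (Unique.map⁺ ∷ᵛ-injective (choose-unique L k)) (Unique.map⁺ ∷ᵛ-injective (choose-unique L (suc k))) disjoint
  where
  disjoint : ∀ {S} → ¬ (S ∈ map (inside ∷ᵛ_) (choose L k) × S ∈ map (outside ∷ᵛ_) (choose L (suc k)))
  disjoint (a , b) with ∈-map⁻ _ a | ∈-map⁻ _ b
  ... | _ , _ , refl | _ , _ , ()

∈-choose⁺ : ∀ {n} {L S : Subset n} → S ⊆ˢ L → S ∈ choose L ∣ S ∣
∈-choose⁺ {L = Vec.[]}       {Vec.[]}       _ = here refl
∈-choose⁺ {L = false ∷ᵛ L} {false ∷ᵛ S} s = ∈-map⁺ _ (∈-choose⁺ (Sub.drop-∷-⊆ s))
∈-choose⁺ {L = false ∷ᵛ L} {true ∷ᵛ S}  s with s Vec.here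
... | ()
∈-choose⁺ {L = true ∷ᵛ L}  {true ∷ᵛ S}  s = ∈-++⁺ˡ (∈-map⁺ _ (∈-choose⁺ (Sub.drop-∷-⊆ s)))
∈-choose⁺ {L = true ∷ᵛ L}  {false ∷ᵛ S} s with ∣ S ∣ | ∈-choose⁺ {L = L} {S} (Sub.drop-∷-⊆ s)
... | zero  | m = ∈-map⁺ _ m
... | suc k | m = ∈-++⁺ʳ (map (inside ∷ᵛ_) (choose L k)) (∈-map⁺ _ m)

∈-choose⁻ : ∀ {n} (L : Subset n) k {S} → S ∈ choose L k → S ⊆ˢ L × ∣ S ∣ ≡ k
∈-choose⁻ Vec.[] zero (here refl) = id , refl
∈-choose⁻ (false ∷ᵛ L) k m with ∈-map⁻ _ m
... | S , m′ , refl = let (s , c) = ∈-choose⁻ L k m′ in (λ { (Vec.there x) → Vec.there (s x) }) , c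
∈-choose⁻ (true ∷ᵛ L) zero m with ∈-map⁻ _ m
... | S , m′ , refl = let (s , c) = ∈-choose⁻ L zero m′ in (λ { (Vec.there x) → Vec.there (s x) }) , c
∈-choose⁻ (true ∷ᵛ L) (suc k) m with ∈-++⁻ (map (inside ∷ᵛ_) (choose L k)) m
... | inj₁ a with ∈-map⁻ _ a
...   | S , m′ , refl = let (s , c) = ∈-choose⁻ L k m′ in
        (λ { Vec.here → Vec.here ; (Vec.there x) → Vec.there (s x) }) , cong suc c
∈-choose⁻ (true ∷ᵛ L) (suc k) m | inj₂ b with ∈-map⁻ _ b
...   | S , m′ , refl = let (s , c) = ∈-choose⁻ L (suc k) m′ in (λ { (Vec.there x) → Vec.there (s x) }) , c

elements : ∀ {n} → Subset n → List (Fin n)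
elements S = map (embed S) (allFin ∣ S ∣)

length-elements : ∀ {n} (S : Subset n) → length (elements S) ≡ ∣ S ∣
length-elements S = trans (List.length-map (embed S) (allFin ∣ S ∣)) (List.length-tabulate id)

elements-unique : ∀ {n} (S : Subset n) → Unique (elements S)
elements-unique S = Unique.map⁺ (embed-injective S) (Unique.allFin⁺ ∣ S ∣)

∈-elements⁺ : ∀ {n} {S : Subset n} {x} → x ∈ˢ S → x ∈ elements S
∈-elements⁺ {S = S} m = subst (λ y → y ∈ elements S) (embed-index S m) (∈-map⁺ (embed S) (∈-allFin (index S m)))

∈-elements⁻ : ∀ {n} {S : Subset n} {x} → x ∈ elements S → x ∈ˢ S
∈-elements⁻ {S = S} m with ∈-map⁻ (embed S) m
... | i , _ , refl = embed-∈ S i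

card : ∀ {n} {S : Subset n} {xs} → Unique xs → (∀ {x} → x ∈ˢ S → x ∈ xs) → (∀ {x} → x ∈ xs → x ∈ˢ S) → ∣ S ∣ ≡ length xs
card {S = S} u to from = trans (sym (length-elements S)) (ℕ.≤-antisym
  (unique-⊆-length (elements-unique S) (to ∘ ∈-elements⁻)) (unique-⊆-length u (∈-elements⁺ ∘ from)))

same-length : ∀ {A : Set} {xs ys : List A} → Unique xs → Unique ys → xs ⊆ ys → ys ⊆ xs → length xs ≡ length ys
same-length u w f g = ℕ.≤-antisym (unique-⊆-length u f) (unique-⊆-length w g)

-- A complete graph on `L` with all other vertices isolated. This is what remains after all
-- contractions, since vertices are never removed; with `L` full it is also `K t`.
module Clique (G : Graph) (L : Subset (Graph.order G))
              (in-L : ∀ {x y} → Graph.Adj G x y → x ∈ˢ L × y ∈ˢ L)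
              (all-joined : ∀ {x y} → x ∈ˢ L → y ∈ˢ L → x ≢ y → Graph.Adj G x y) where
  open Graph G

  -- In a clique every other vertex of `X` is a neighbour of `w`, so the degree of `w` in `X` bounds
  -- the size. Degree 2 leaves only triangles as cycles, degree 3 only solids on four vertices.
  star-bound : ∀ {X w Y N} → Realises Adj X → (∀ {x} → x ∈ verts X → x ∈ˢ L) →
    X ≋ pt w • Y • spokes w N → Avoids w Y → length (verts X) ≤ⁿ suc (length N)
  star-bound {X} {w} {Y} {N} re ⊆L e av = ℕ.≤-trans
    (ℕ.≤-reflexive (trans (Perm.↭-length (verts-↭ e)) (cong (suc ∘ length) (List.++-identityʳ (verts Y)))))
    (s≤s (unique-⊆-length (distinct (realises-rest av re′)) (λ m → spokes-sound av re′ m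
      (all-joined (in-X (here refl)) (in-X (there (∈-++⁺ˡ m))) (λ { refl → spokes-∉ av re′ m })))))
    where
    re′ = realises-resp (≋-sym e) re
    in-X : ∀ {x} → x ∈ w ∷ verts Y ++ [] → x ∈ˢ L
    in-X m = ⊆L (Perm.∈-resp-↭ (verts-↭ (≋-sym e)) m)

  cycle-bound : ∀ {X} → Cycle X → Realises Adj X → (∀ {x} → x ∈ verts X → x ∈ˢ L) → length (verts X) ≤ⁿ 3
  cycle-bound c re ⊆L = let (w , w∈) = cycle-inhabited c; at = lookAt c w∈ in
    star-bound re ⊆L (CycleAt.around at) (cycleAt-avoids (distinct re) at)

  view-bound : ∀ {X w X₀} → Realises Adj X → (∀ {x} → x ∈ verts X → x ∈ˢ L) → X ≋ X₀ → (o : View w X₀) →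
    length (verts X) ≤ⁿ suc (length (View.N o))
  view-bound re ⊆L e o = star-bound re ⊆L (≋-trans e (View.split o)) (View.avoid o)

  -- The hub of a pyramid may have large degree, so there the rim is bounded as an induced cycle; in
  -- the other kinds a vertex of degree 3 is at hand.
  solid-bound : ∀ {X} → Solid X → Realises Adj X → (∀ {x} → x ∈ verts X → x ∈ˢ L) → length (verts X) ≤ⁿ 4
  solid-bound {X} (pyramid w c ns lc un ns⊆ ln e) re ⊆L = ℕ.≤-trans
    (ℕ.≤-reflexive (trans (Perm.↭-length (verts-↭ e)) (cong (suc ∘ length) (List.++-identityʳ (verts (cyc c))))))
    (s≤s (cycle-bound (cycleOn c lc ≋-refl) (realises-rest av re′)
      (λ m → ⊆L (Perm.∈-resp-↭ (verts-↭ (≋-sym e)) (there (∈-++⁺ˡ m))))))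
    where
    re′ = realises-resp (≋-sym e) re
    av : Avoids w (cyc c)
    av = avoids-cyc c (λ m → All≢⇒∉ (AllPairs.head (distinct re′)) (∈-++⁺ˡ (subst (w ∈_) (sym (verts-cyc c)) m)))
  solid-bound (trihedron a b p q r lp lq lr e) re ⊆L =
    view-bound re ⊆L e (viewTrihedronEnd Fin._≟_ a b p q r lp lq lr (distinct-resp e (distinct re)))
  solid-bound (stamp x s t u p q r e) re ⊆L =
    view-bound re ⊆L e (viewStampCorner Fin._≟_ x s t u p q r (distinct-resp e (distinct re)))
  solid-bound (prism x₁ x₂ x₃ y₁ y₂ y₃ p q r e) re ⊆L =
    view-bound re ⊆L e (viewPrismCorner Fin._≟_ x₁ x₂ x₃ y₁ y₂ y₃ p q r (distinct-resp e (distinct re)))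

  size-resp : ∀ {k} {X Y : Piece V} → X ≋ Y → k ≤ⁿ length (verts Y) → k ≤ⁿ length (verts X)
  size-resp e l = ℕ.≤-trans l (ℕ.≤-reflexive (sym (Perm.↭-length (verts-↭ e))))

  cycle-size : ∀ {X : Piece V} → Cycle X → 3 ≤ⁿ length (verts X)
  cycle-size (cycleOn c l e) = size-resp {Y = cyc c} e (subst (λ c → 3 ≤ⁿ length c) (sym (verts-cyc c)) l)

  solid-size : ∀ {X : Piece V} → Solid X → 4 ≤ⁿ length (verts X)
  solid-size (pyramid w c ns l _ _ _ e) = size-resp {Y = pt w • cyc c • spokes w ns} e
    (s≤s (subst (λ c → 3 ≤ⁿ length c) (sym (trans (List.++-identityʳ _) (verts-cyc c))) l))
  solid-size (trihedron a b (x ∷ p) (y ∷ q) r _ _ _ e) =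
    size-resp {Y = trihedronPiece a b (x ∷ p) (y ∷ q) r} e (s≤s (s≤s (s≤s (nonempty-mid p))))
  solid-size (stamp x s t u p q r e) = size-resp {Y = stampPiece x s t u p q r} e (s≤s (s≤s (s≤s (s≤s z≤n))))
  solid-size (prism x₁ x₂ x₃ y₁ y₂ y₃ p q r e) =
    size-resp {Y = prismPiece x₁ x₂ x₃ y₁ y₂ y₃ p q r} e (s≤s (s≤s (s≤s (s≤s z≤n))))

  has-choose : ∀ {F k S} → (H : Has F Adj S) → (∀ {x} → x ∈ˢ S → x ∈ˢ L) → length (verts (piece H)) ≤ⁿ k →
    k ≤ⁿ length (verts (piece H)) → S ∈ choose L k
  has-choose {S = S} H ⊆L le ge = subst (λ k → S ∈ choose L k)
    (trans (card (distinct (real H)) (within H) (onto H)) (ℕ.≤-antisym le ge)) (∈-choose⁺ ⊆L)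

  solid-in-L : ∀ {S} → Has Solid Adj S → ∀ {x} → x ∈ˢ S → x ∈ˢ L
  solid-in-L H m with view Fin._≟_ (shape H) (distinct (real H)) (within H m)
  ... | mkView Y N e av N⊆ (c , c∈) _ _ = proj₁ (in-L (spokes-complete av (realises-resp (≋-sym e) (real H)) N⊆ c∈))

  cycle-in-L : ∀ {S} → Has Cycle Adj S → ∀ {x} → x ∈ˢ S → x ∈ˢ L
  cycle-in-L H m = proj₁ (in-L (complete (real H) (within H m) (prev∈ (distinct (real H)) at) (proj₁ (rim-joined (distinct (real H)) at))))
    where at = lookAt (shape H) (within H m)

  solid⇒choose : ∀ {S} → Has Solid Adj S → S ∈ choose L 4
  solid⇒choose H = has-choose H (solid-in-L H)
    (solid-bound (shape H) (real H) (λ m → solid-in-L H (onto H m))) (solid-size (shape H))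

  cycle⇒choose : ∀ {S} → Has Cycle Adj S → S ∈ choose L 3
  cycle⇒choose H = has-choose H (cycle-in-L H)
    (cycle-bound (shape H) (real H) (λ m → cycle-in-L H (onto H m))) (cycle-size (shape H))

  edge⇒choose : ∀ {S} → HasEdge Adj S → S ∈ choose L 2
  edge⇒choose {S} (hasEdge {a} {b} r a∈ b∈ only) = subst (λ k → S ∈ choose L k)
    (card {xs = a ∷ b ∷ []} (((λ { refl → irr G r }) ∷ []) ∷ [] ∷ []) (λ m → [ here , there ∘ here ]′ (only m))
      (λ { (here refl) → a∈ ; (there (here refl)) → b∈ }))
    (∈-choose⁺ (λ m → [ (λ { refl → proj₁ (in-L r) }) , (λ { refl → proj₂ (in-L r) }) ]′ (only m)))

  clique-realises : ∀ X → Distinct X → (∀ {x} → x ∈ verts X → x ∈ˢ L) → Closed X → (∀ {x y} → (x , y) ∈ edges′ X → x ≢ y) →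
    (∀ {x y} → x ∈ verts X → y ∈ verts X → x ≢ y → Joined (edges′ X) x y) → Realises Adj X
  clique-realises X d ⊆L k irr′ j = realises d (λ a b r → j a b (λ { refl → irr G r }))
    (λ { a b (inj₁ m) → all-joined (⊆L a) (⊆L b) (irr′ m)
       ; a b (inj₂ m) → all-joined (⊆L a) (⊆L b) (λ eq → irr′ m (sym eq)) })

  choose⇒elements : ∀ {k S} → S ∈ choose L k → (∀ {x} → x ∈ elements S → x ∈ˢ L) × length (elements S) ≡ k
  choose⇒elements {k} {S} m with ∈-choose⁻ L k m
  ... | s , c = (λ x → s (∈-elements⁻ x)) , trans (length-elements S) c

  choose⇒edge : ∀ {S} → S ∈ choose L 2 → HasEdge Adj S
  choose⇒edge {S} m = go (elements S) (elements-unique S) (choose⇒elements m) ∈-elements⁺ ∈-elements⁻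
    where
    go : ∀ xs → Unique xs → (∀ {x} → x ∈ xs → x ∈ˢ L) × length xs ≡ 2 →
         (∀ {x} → x ∈ˢ S → x ∈ xs) → (∀ {x} → x ∈ xs → x ∈ˢ S) → HasEdge Adj S
    go (a ∷ b ∷ []) ((a≢b ∷ _) ∷ _) (⊆L , _) to from =
      hasEdge (all-joined (⊆L (here refl)) (⊆L (there (here refl))) a≢b) (from (here refl)) (from (there (here refl)))
        (λ m → case to m of λ { (here eq) → inj₁ eq ; (there (here eq)) → inj₂ eq })

  choose⇒cycle : ∀ {S} → S ∈ choose L 3 → Has Cycle Adj S
  choose⇒cycle {S} m = go (elements S) (elements-unique S) (choose⇒elements m) ∈-elements⁺ ∈-elements⁻
    where
    go : ∀ xs → Unique xs → (∀ {x} → x ∈ xs → x ∈ˢ L) × length xs ≡ 3 →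
         (∀ {x} → x ∈ˢ S → x ∈ xs) → (∀ {x} → x ∈ xs → x ∈ˢ S) → Has Cycle Adj S
    go (a ∷ b ∷ c ∷ []) u@((a≢b ∷ a≢c ∷ _) ∷ (b≢c ∷ _) ∷ _) (⊆L , _) to from = has X f
      (clique-realises X u ⊆L (cycle-closed f)
        (λ { (here refl) → a≢b ; (there (here refl)) → b≢c ; (there (there (here refl))) → ≢-sym a≢c })
        λ { (here refl) (here refl) n → contradiction refl n
          ; (here refl) (there (here refl)) _ → inj₁ (here refl)
          ; (here refl) (there (there (here refl))) _ → inj₂ (there (there (here refl)))
          ; (there (here refl)) (here refl) _ → inj₂ (here refl)
          ; (there (here refl)) (there (here refl)) n → contradiction refl n
          ; (there (here refl)) (there (there (here refl))) _ → inj₁ (there (here refl))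
          ; (there (there (here refl))) (here refl) _ → inj₁ (there (there (here refl)))
          ; (there (there (here refl))) (there (here refl)) _ → inj₂ (there (here refl))
          ; (there (there (here refl))) (there (there (here refl))) n → contradiction refl n })
      to from
      where
      X = cyc (a ∷ b ∷ c ∷ [])
      f : Cycle X
      f = cycleOn (a ∷ b ∷ c ∷ []) (s≤s (s≤s (s≤s z≤n))) ≋-refl

  choose⇒solid : ∀ {S} → S ∈ choose L 4 → Has Solid Adj S
  choose⇒solid {S} m = go (elements S) (elements-unique S) (choose⇒elements m) ∈-elements⁺ ∈-elements⁻
    where
    go : ∀ xs → Unique xs → (∀ {x} → x ∈ xs → x ∈ˢ L) × length xs ≡ 4 →
         (∀ {x} → x ∈ˢ S → x ∈ xs) → (∀ {x} → x ∈ xs → x ∈ˢ S) → Has Solid Adj S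
    go (x ∷ s ∷ t ∷ u ∷ []) d@((x≢s ∷ x≢t ∷ x≢u ∷ _) ∷ (s≢t ∷ s≢u ∷ _) ∷ (t≢u ∷ _) ∷ _) (⊆L , _) to from = has X f
      (clique-realises X d ⊆L (solid-closed f)
        (λ { (here refl) → s≢t ; (there (here refl)) → t≢u ; (there (there (here refl))) → ≢-sym s≢u
           ; (there (there (there (here refl)))) → ≢-sym x≢s ; (there (there (there (there (here refl))))) → ≢-sym x≢t
           ; (there (there (there (there (there (here refl)))))) → ≢-sym x≢u })
        λ { (here refl) (here refl) n → contradiction refl n
          ; (here refl) (there (here refl)) _ → inj₂ (there (there (there (here refl))))
          ; (here refl) (there (there (here refl))) _ → inj₂ (there (there (there (there (here refl)))))
          ; (here refl) (there (there (there (here refl)))) _ → inj₂ (there (there (there (there (there (here refl))))))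
          ; (there (here refl)) (here refl) _ → inj₁ (there (there (there (here refl))))
          ; (there (here refl)) (there (here refl)) n → contradiction refl n
          ; (there (here refl)) (there (there (here refl))) _ → inj₁ (here refl)
          ; (there (here refl)) (there (there (there (here refl)))) _ → inj₂ (there (there (here refl)))
          ; (there (there (here refl))) (here refl) _ → inj₁ (there (there (there (there (here refl)))))
          ; (there (there (here refl))) (there (here refl)) _ → inj₂ (here refl)
          ; (there (there (here refl))) (there (there (here refl))) n → contradiction refl n
          ; (there (there (here refl))) (there (there (there (here refl)))) _ → inj₁ (there (here refl))
          ; (there (there (there (here refl)))) (here refl) _ → inj₁ (there (there (there (there (there (here refl))))))
          ; (there (there (there (here refl)))) (there (here refl)) _ → inj₁ (there (there (here refl)))
          ; (there (there (there (here refl)))) (there (there (here refl))) _ → inj₂ (there (here refl))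
          ; (there (there (there (here refl)))) (there (there (there (here refl)))) n → contradiction refl n })
      to from
      where
      -- Four mutually adjacent vertices form the stamp whose three paths are single edges.
      X = stampPiece x s t u [] [] []
      f : Solid X
      f = stamp x s t u [] [] [] ≋-refl

  solids-count : length (solids G) ≡ ∣ L ∣ C 4
  solids-count = trans (same-length (solids-unique G) (choose-unique L 4)
    (λ m → solid⇒choose (∈-solids⁻ G m)) (λ m → ∈-solids⁺ G (choose⇒solid m))) (length-choose L 4)

  cycles-count : length (inducedCycles G) ≡ ∣ L ∣ C 3
  cycles-count = trans (same-length (cycles-unique G) (choose-unique L 3)
    (λ m → cycle⇒choose (∈-cycles⁻ G m)) (λ m → ∈-cycles⁺ G (choose⇒cycle m))) (length-choose L 3)

  edges-count : length (edges G) ≡ ∣ L ∣ C 2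
  edges-count = trans (sym (length-edgeSets G)) (trans (same-length (edgeSets-unique G) (choose-unique L 2)
    (λ m → edge⇒choose (∈-edgeSets⁻ G m)) (λ m → ∈-edgeSets⁺ G (choose⇒edge m))) (length-choose L 2))

-- From minors to contractions

-- A K t-model in G: f x is the branch set of x, if any; vertices outside L are isolated leftovers of
-- earlier contractions.
record Model {t} (G : Graph) (L : Subset (Graph.order G)) (f : Graph.V G → Maybe (Fin t)) : Set where
  open Graph G
  field
    live      : ∀ {x y} → Adj x y → x ∈ˢ L
    root      : V
    rootIndex : Fin t
    root-f    : f root ≡ just rootIndex
    reach     : ∀ {x} → x ∈ˢ L → Star Adj x root
    fibre     : ∀ {i x y} → x ∈ˢ L → y ∈ˢ L → f x ≡ just i → f y ≡ just i →
                Star (λ a b → Adj a b × f a ≡ just i × f b ≡ just i) x y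
    touch     : ∀ {i j} → i ≢ j → ∃[ a ] ∃[ b ] Adj a b × f a ≡ just i × f b ≡ just j
    onto-f    : ∀ i → ∃[ x ] x ∈ˢ L × f x ≡ just i

-- Merging `v` into `u` never joins two different branch sets, and it absorbs unassigned vertices.
-- As `u` keeps its index, the same `f` serves after the contraction.
Joinable : ∀ {n t} → (Fin n → Maybe (Fin t)) → Fin n → Fin n → Set
Joinable f u v = ∃[ i ] f u ≡ just i × (f v ≡ nothing ⊎ f v ≡ just i)

_⊝_ : ∀ {n} → Subset n → Fin n → Subset n
(_ ∷ᵛ S) ⊝ zero  = false ∷ᵛ S
(b ∷ᵛ S) ⊝ suc x = b ∷ᵛ (S ⊝ x)

⊝-card : ∀ {n} {S : Subset n} {x} → x ∈ˢ S → ∣ S ∣ ≡ suc ∣ S ⊝ x ∣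
⊝-card Vec.here = refl
⊝-card {S = true ∷ᵛ S}  (Vec.there m) = cong suc (⊝-card m)
⊝-card {S = false ∷ᵛ S} (Vec.there m) = ⊝-card m

∈-⊝⁺ : ∀ {n} {S : Subset n} {x y} → y ∈ˢ S → y ≢ x → y ∈ˢ S ⊝ x
∈-⊝⁺ {x = zero}  Vec.here      n = contradiction refl n
∈-⊝⁺ {x = suc x} Vec.here      n = Vec.here
∈-⊝⁺ {x = zero}  (Vec.there m) n = Vec.there m
∈-⊝⁺ {x = suc x} (Vec.there m) n = Vec.there (∈-⊝⁺ m (n ∘ cong suc))

∈-⊝⁻ : ∀ {n} {S : Subset n} {x y} → y ∈ˢ S ⊝ x → y ∈ˢ S × y ≢ x
∈-⊝⁻ {S = _ ∷ᵛ S} {zero}  (Vec.there m) = Vec.there m , λ ()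
∈-⊝⁻ {S = _ ∷ᵛ S} {suc x} Vec.here      = Vec.here , λ ()
∈-⊝⁻ {S = _ ∷ᵛ S} {suc x} (Vec.there m) = let (a , b) = ∈-⊝⁻ m in Vec.there a , λ { refl → b refl }

module ContractModel {t} (G : Graph) {L} {f : Graph.V G → Maybe (Fin t)} (M : Model G L f)
                     {u v : Graph.V G} (uv : Graph.Adj G u v) (join : Joinable f u v) where
  open Graph G
  open Model M
  open Contraction G uv
  open Graph G/uv using () renaming (Adj to Adj′)

  f-rename : ∀ {x i} → f x ≡ just i → f (rename x) ≡ just i
  f-rename {x} {i} eq = case x Fin.≟ v of λ
    { (yes refl) → trans (cong f rename-v) (at-v join eq)
    ; (no x≢v)   → trans (cong f (rename-≢ x≢v)) eq }
    where
    at-v : Joinable f u v → f v ≡ just i → f u ≡ just i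
    at-v (_ , fu , inj₁ fv) eq = case trans (sym fv) eq of λ ()
    at-v (_ , fu , inj₂ fv) eq = trans fu (trans (sym fv) eq)

  rename-step : ∀ {x y} → Adj x y → rename x ≡ rename y ⊎ Adj′ (rename x) (rename y)
  rename-step {x} {y} r with x Fin.≟ v | y Fin.≟ v
  ... | yes refl | yes refl = inj₁ refl
  ... | no x≢v   | no y≢v   = inj₂ (x≢v , y≢v , inj₁ r)
  ... | yes refl | no y≢v with y Fin.≟ u
  ...   | yes refl = inj₁ refl
  ...   | no y≢u   = inj₂ (from-v y≢u y≢v r)
  rename-step {x} {y} r | no x≢v | yes refl with x Fin.≟ u
  ...   | yes refl = inj₁ refl
  ...   | no x≢u   = inj₂ (Graph.symm G/uv (from-v x≢u x≢v (symm r)))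

  rename-star : ∀ {x y} → Star Adj x y → Star Adj′ (rename x) (rename y)
  rename-star ε       = ε
  rename-star (r ◅ s) = [ (λ eq → subst (λ z → Star Adj′ z _) (sym eq) (rename-star s)) , _◅ rename-star s ]′ (rename-step r)

  rename-fibre : ∀ {i x y} → Star (λ a b → Adj a b × f a ≡ just i × f b ≡ just i) x y →
                 Star (λ a b → Adj′ a b × f a ≡ just i × f b ≡ just i) (rename x) (rename y)
  rename-fibre ε = ε
  rename-fibre ((r , p , q) ◅ s) =
    [ (λ eq → subst (λ z → Star _ z _) (sym eq) (rename-fibre s))
    , (λ r′ → (r′ , f-rename p , f-rename q) ◅ rename-fibre s) ]′ (rename-step r)

  live′ : ∀ {x y} → Adj′ x y → x ∈ˢ L ⊝ v
  live′ (x≢v , y≢v , inj₁ r)                     = ∈-⊝⁺ (live r) x≢v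
  live′ (x≢v , y≢v , inj₂ (inj₁ (refl , _ , _))) = ∈-⊝⁺ (live uv) x≢v
  live′ (x≢v , y≢v , inj₂ (inj₂ (_ , _ , r)))    = ∈-⊝⁺ (live (symm r)) x≢v

  rename-live : ∀ {x} → x ∈ˢ L → rename x ∈ˢ L ⊝ v
  rename-live {x} m = case x Fin.≟ v of λ
    { (yes refl) → subst (_∈ˢ (L ⊝ v)) (sym rename-v) (∈-⊝⁺ (live uv) u≢v)
    ; (no x≢v)   → subst (_∈ˢ (L ⊝ v)) (sym (rename-≢ x≢v)) (∈-⊝⁺ m x≢v) }

  model′ : Model G/uv (L ⊝ v) f
  model′ = record
    { live      = live′
    ; root      = rename root
    ; rootIndex = rootIndex
    ; root-f    = f-rename root-f
    ; reach     = λ m → let (m′ , x≢v) = ∈-⊝⁻ m in subst (λ z → Star Adj′ z _) (rename-≢ x≢v) (rename-star (reach m′))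
    ; fibre     = λ m n p q → let (m′ , x≢v) = ∈-⊝⁻ m ; (n′ , y≢v) = ∈-⊝⁻ n in
                    subst₂ (Star _) (rename-≢ x≢v) (rename-≢ y≢v) (rename-fibre (fibre m′ n′ p q))
    -- An edge between different branch sets cannot collapse, because its ends keep different
    -- indices.
    ; touch     = λ i≢j → let (a , b , r , p , q) = touch i≢j in rename a , rename b ,
                    [ (λ eq → contradiction (just-injective (trans (sym (f-rename p)) (trans (cong f eq) (f-rename q)))) i≢j) , id ]′
                      (rename-step r) , f-rename p , f-rename q
    ; onto-f    = λ i → let (x , m , p) = onto-f i in rename x , rename-live m , f-rename p
    }

-- Without joinable edges every live vertex is assigned and every branch set is a single vertex, so
-- the live vertices form a clique of size `t`.
module Contracted {t} (G : Graph) {L} {f : Graph.V G → Maybe (Fin t)} (M : Model G L f)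
                  (stuck : ∀ {u v} → Graph.Adj G u v → ¬ Joinable f u v) where
  open Graph G
  open Model M

  -- An unassigned vertex followed by an assigned one would make a joinable edge, so along a walk
  -- assignment propagates back from the root.
  has-index : ∀ {x} → Star Adj x root → ∃[ i ] f x ≡ just i
  has-index ε = rootIndex , root-f
  has-index {x} (r ◅ s) with f x in eq | has-index s
  ... | just i  | _      = i , refl
  ... | nothing | j , fy = contradiction (j , fy , inj₁ eq) (stuck (symm r))

  indexed : ∀ {x} → x ∈ˢ L → ∃[ i ] f x ≡ just i
  indexed m = has-index (reach m)

  singleton-fibre : ∀ {i x y} → x ∈ˢ L → y ∈ˢ L → f x ≡ just i → f y ≡ just i → x ≡ y
  singleton-fibre m n p q with fibre m n p q
  ... | ε = refl
  ... | (r , p′ , q′) ◅ _ = contradiction (_ , p′ , inj₂ q′) (stuck r)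

  all-joined : ∀ {x y} → x ∈ˢ L → y ∈ˢ L → x ≢ y → Adj x y
  all-joined {x} {y} m n x≢y with indexed m | indexed n
  ... | i , p | j , q with touch {i} {j} (λ { refl → x≢y (singleton-fibre m n p q) })
  ...   | a , b , r , p′ , q′ =
    subst₂ Adj (singleton-fibre (live r) m p′ p) (singleton-fibre (live (symm r)) n q′ q) r

  card-L : ∣ L ∣ ≡ t
  card-L = trans (sym (length-elements L)) (trans (ℕ.≤-antisym
    (pigeonhole (λ x i → x ∈ˢ L × f x ≡ just i) (elements-unique L)
      (λ m → let (i , p) = indexed (∈-elements⁻ m) in i , ∈-allFin i , ∈-elements⁻ m , p)
      (λ { (m , p) (n , q) → singleton-fibre m n p q }))
    (pigeonhole (λ i x → f x ≡ just i) (Unique.allFin⁺ t)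
      (λ {i} _ → let (x , m , p) = onto-f i in x , ∈-elements⁺ m , p)
      (λ p q → just-injective (trans (sym p) q)))) (List.length-tabulate id))

  open Clique G L (λ r → live r , live (symm r)) all-joined public

-- (t C 4) - (t C 3) + (t C 2) - t ≤ |S(G)| - |C(G)| + |E(G)| - k, without subtractions.
Bound : ℕ → Graph → ℕ → Set
Bound t G k = (t C 4) +ⁿ length (inducedCycles G) +ⁿ (t C 2) +ⁿ k ≤ⁿ length (solids G) +ⁿ (t C 3) +ⁿ length (edges G) +ⁿ t

-- Adding the two inequalities makes the quantities `s′`, `c′`, `e′` of the contraction cancel; the
-- `suc` of the lost vertex raises `k` by one.
bound-step : ∀ {t₂ t₃ t₄ t s s′ c c′ e e′ k} → suc (s′ +ⁿ (c +ⁿ e′)) ≤ⁿ s +ⁿ (c′ +ⁿ e) →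
  t₄ +ⁿ c′ +ⁿ t₂ +ⁿ k ≤ⁿ s′ +ⁿ t₃ +ⁿ e′ +ⁿ t → t₄ +ⁿ c +ⁿ t₂ +ⁿ suc k ≤ⁿ s +ⁿ t₃ +ⁿ e +ⁿ t
bound-step {t₂} {t₃} {t₄} {t} {s} {s′} {c} {c′} {e} {e′} {k} p q =
  ℕ.+-cancelʳ-≤ (s′ +ⁿ c′ +ⁿ e′) _ _ (subst₂ _≤ⁿ_
    (lhs t₂ t₄ s′ c c′ e′ k) (rhs t₃ t s s′ c′ e e′) (ℕ.+-mono-≤ p q))
  where
  lhs : ∀ t₂ t₄ s′ c c′ e′ k → suc (s′ +ⁿ (c +ⁿ e′)) +ⁿ (t₄ +ⁿ c′ +ⁿ t₂ +ⁿ k) ≡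
        t₄ +ⁿ c +ⁿ t₂ +ⁿ suc k +ⁿ (s′ +ⁿ c′ +ⁿ e′)
  lhs = ℕRing.solve-∀
  rhs : ∀ t₃ t s s′ c′ e e′ → s +ⁿ (c′ +ⁿ e) +ⁿ (s′ +ⁿ t₃ +ⁿ e′ +ⁿ t) ≡
        s +ⁿ t₃ +ⁿ e +ⁿ t +ⁿ (s′ +ⁿ c′ +ⁿ e′)
  rhs = ℕRing.solve-∀

joinable? : ∀ {n t} (f : Fin n → Maybe (Fin t)) u v → Dec (Joinable f u v)
joinable? f u v with f u | f v
... | nothing | _       = no λ { (_ , () , _) }
... | just i  | nothing = yes (i , refl , inj₁ refl)
... | just i  | just j with i Fin.≟ j
...   | yes refl = yes (i , refl , inj₂ refl)
...   | no i≢j   = no λ { (_ , refl , inj₁ ()) ; (_ , refl , inj₂ refl) → i≢j refl }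

-- Here equality holds: the live vertices form a clique of size `t`, and the isolated ones are not
-- counted in `∣ L ∣`.
contracted-bound : ∀ {t} (G : Graph) {L} {f : Graph.V G → Maybe (Fin t)} → Model G L f →
  (∀ {u v} → Graph.Adj G u v → ¬ Joinable f u v) → Bound t G ∣ L ∣
contracted-bound {t} G M stuck = ℕ.≤-reflexive (cong₂ _+ⁿ_ (cong₂ _+ⁿ_ (cong₂ _+ⁿ_
    (sym (trans solids-count (cong (_C 4) card-L))) (trans cycles-count (cong (_C 3) card-L)))
    (sym (trans edges-count (cong (_C 2) card-L)))) card-L)
  where open Contracted G M stuck

contract-bound : ∀ {t k} (G : Graph) {u v} (uv : Graph.Adj G u v) → Bound t (contract G u v) k → Bound t G (suc k)
contract-bound {t} {k} G {u} {v} uv = bound-step {t C 2} {t C 3} {t C 4} {t}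
  {length (solids G)} {length (solids G′)} {length (inducedCycles G)} {length (inducedCycles G′)}
  {length (edges G)} {length (edges G′)} {k} (Inequality.contraction-bound G uv)
  where G′ = contract G u v

-- The induction runs over the number of live vertices, as the order of the graph does not change.
ModelBound : ℕ → ℕ → Set₁
ModelBound t k = ∀ (G : Graph) L (f : Graph.V G → Maybe (Fin t)) → Model G L f → ∣ L ∣ ≡ k → Bound t G k

model-bound-at : ∀ {t} k → (∀ k′ → k ≡ suc k′ → ModelBound t k′) → (G : Graph) (L : Subset (Graph.order G))
  (f : Graph.V G → Maybe (Fin t)) → Model G L f → ∣ L ∣ ≡ k →
  Dec (∃[ u ] ∃[ v ] Graph.Adj G u v × Joinable f u v) → Bound t G k
model-bound-at k ih G L f M refl (no ¬p) = contracted-bound G M (λ r j → ¬p (_ , _ , r , j))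
model-bound-at {t} k ih G L f M refl (yes (u , v , uv , j)) = subst (Bound t G) (sym eq)
  (contract-bound G uv (ih ∣ L ⊝ v ∣ eq (contract G u v) (L ⊝ v) f (ContractModel.model′ G M uv j) refl))
  where
  eq : ∣ L ∣ ≡ suc ∣ L ⊝ v ∣
  eq = ⊝-card (Model.live M (Graph.symm G uv))

model-bound : ∀ {t} k → ModelBound t k
model-bound k G L f M eq = model-bound-at k (smaller k) G L f M eq
  (Fin.any? (λ u → Fin.any? λ v → Graph.adj? G u v ×-dec joinable? f u v))
  where
  smaller : ∀ k k′ → k ≡ suc k′ → ModelBound _ k′
  smaller (suc k) .k refl = model-bound k

-- From the Hadwiger number to the bound

K₁-minor : ∀ (G : Graph) → Graph.V G → K 1 ≼ G
K₁-minor G x = S Vec.∷ Vec.[] , (λ { zero → connected }) , (λ { zero zero _ _ _ → refl }) ,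
  λ { zero zero n → contradiction refl n }
  where
  S = ⁅ x ⁆
  one : ∀ {k} → k ≡ 1 → (i j : Fin k) → i ≡ j
  one refl zero zero = refl
  connected : Connected (G ⟨ S ⟩)
  connected = index S (Sub.x∈⁅x⁆ x) , λ i j → subst (Star _ i) (one (Sub.∣⁅x⁆∣≡1 x) i j) ε

-- The index `suc t` guarantees a branch set to hold the root. At the outset every vertex is live,
-- and connectedness of `G` is what provides `reach`.
module FromMinor (G : Graph) (conn : ∀ x y → Star (Graph.Adj G) x y) {t} (B : Vec.Vec (Subset (Graph.order G)) (suc t))
                 (isModel : IsModel (K (suc t)) G B) where
  open Graph G

  private
    bag : Fin (suc t) → Subset order
    bag = Vec.lookup B
    branch : ∀ i → Connected (G ⟨ bag i ⟩)
    branch = proj₁ isModel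
    disjoint : ∀ i j x → x ∈ˢ bag i → x ∈ˢ bag j → i ≡ j
    disjoint = proj₁ (proj₂ isModel)

  f : V → Maybe (Fin (suc t))
  f x with Fin.any? (λ i → x Sub.∈? bag i)
  ... | yes (i , _) = just i
  ... | no  _       = nothing

  f⁺ : ∀ {x i} → x ∈ˢ bag i → f x ≡ just i
  f⁺ {x} {i} m with Fin.any? (λ i → x Sub.∈? bag i)
  ... | yes (j , m′) = cong just (disjoint j i x m′ m)
  ... | no n         = contradiction (i , m) n

  f⁻ : ∀ {x i} → f x ≡ just i → x ∈ˢ bag i
  f⁻ {x} eq with Fin.any? (λ i → x Sub.∈? bag i)
  f⁻ refl | yes (i , m) = m

  inside-bag : ∀ i {a b} → Star (Graph.Adj (G ⟨ bag i ⟩)) a b →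
    Star (λ a b → Adj a b × f a ≡ just i × f b ≡ just i) (embed (bag i) a) (embed (bag i) b)
  inside-bag i = Star.gmap (embed (bag i)) (λ r → r , f⁺ (embed-∈ (bag i) _) , f⁺ (embed-∈ (bag i) _))

  representative : ∀ i → V
  representative i = embed (bag i) (proj₁ (branch i))

  model : Model G full f
  model = record
    { live      = λ _ → Sub.∈⊤
    ; root      = representative zero
    ; rootIndex = zero
    ; root-f    = f⁺ (embed-∈ (bag zero) _)
    ; reach     = λ {x} _ → conn x (representative zero)
    ; fibre     = λ {i} _ _ p q → subst₂ (Star _) (embed-index (bag i) (f⁻ p)) (embed-index (bag i) (f⁻ q))
                    (inside-bag i (proj₂ (branch i) (index (bag i) (f⁻ p)) (index (bag i) (f⁻ q))))
    ; touch     = λ {i} {j} i≢j → let (a , b , a∈ , b∈ , r) = proj₂ (proj₂ isModel) i j i≢j in a , b , r , f⁺ a∈ , f⁺ b∈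
    ; onto-f    = λ i → representative i , Sub.∈⊤ , f⁺ (embed-∈ (bag i) _)
    }

hadwiger-bound : ∀ G → Connected G → Bound (h G) G (Graph.order G)
hadwiger-bound G (x , conn) = go (h G) (proj₁ (proj₂ (hadwiger G))) (proj₂ (proj₂ (hadwiger G)))
  where
  go : ∀ t → K t ≼ G → (∀ t′ → K t′ ≼ G → t′ ≤ⁿ t) → Bound t G (Graph.order G)
  -- A graph with a vertex has `K 1` as a minor, so its Hadwiger number is not zero.
  go zero    _       max = contradiction (max 1 (K₁-minor G x)) λ ()
  go (suc t) (B , m) _   = model-bound (Graph.order G) G full _ (FromMinor.model G conn B m) (Sub.∣⊤∣≡n _)

module Complete (t : ℕ) where
  open Clique (K t) full (λ _ → Sub.∈⊤ , Sub.∈⊤) (λ _ _ n → n) public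

ℶ³-K : ∀ t → ℶ³ (K t) ≡ + (t C 4) - + (t C 3) + + (t C 2) - + t
ℶ³-K t = cong₂ (λ a b → a - b) (cong₂ _+_ (cong₂ (λ a b → + a - + b)
  (trans solids-count (cong (_C 4) (Sub.∣⊤∣≡n t))) (trans cycles-count (cong (_C 3) (Sub.∣⊤∣≡n t))))
  (cong +_ (trans edges-count (cong (_C 2) (Sub.∣⊤∣≡n t))))) refl
  where open Complete t

bound⇒≤ : ∀ {t₂ t₃ t₄ t s c e n} → t₄ +ⁿ c +ⁿ t₂ +ⁿ n ≤ⁿ s +ⁿ t₃ +ⁿ e +ⁿ t →
  + t₄ - + t₃ + + t₂ - + t ≤ + s - + c + + e - + n
bound⇒≤ {t₂} {t₃} {t₄} {t} {s} {c} {e} {n} le = subst₂ _≤_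
  (lhs (+ t₂) (+ t₃) (+ t₄) (+ t) (+ c) (+ n)) (rhs (+ t₃) (+ t) (+ s) (+ c) (+ e) (+ n))
  (ℤ.+-monoˡ-≤ (- + c - + n - + t₃ - + t) (+≤+ le))
  where
  lhs : ∀ t₂ t₃ t₄ t c n → t₄ + c + t₂ + n + (- c - n - t₃ - t) ≡ t₄ - t₃ + t₂ - t
  lhs = ℤRing.solve-∀
  rhs : ∀ t₃ t s c e n → s + t₃ + e + t + (- c - n - t₃ - t) ≡ s - c + e - n
  rhs = ℤRing.solve-∀

corollary4p2p1 : (G : Graph) → Connected G →
    (ℶ³ (K (h G)) ≤ ℶ³ G) ×
    (+ (h G C 4) - + (h G C 3) + + (h G C 2) - + (h G C 1) ≤ ℶ³ G)
corollary4p2p1 G conn =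
  subst (_≤ ℶ³ G) (sym (ℶ³-K (h G))) bound ,
  subst (λ k → + (h G C 4) - + (h G C 3) + + (h G C 2) - + k ≤ ℶ³ G) (sym (nC1≡n (h G))) bound
  where
  bound = bound⇒≤ {h G C 2} {h G C 3} {h G C 4} {h G} {length (solids G)} {length (inducedCycles G)} {length (edges G)} {Graph.order G}
    (hadwiger-bound G conn)
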